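{- Let $L/\mathbb{Q}$ be a cyclic quartic extension, $L=\mathbb{Q}\big(\sqrt{a(d+b_0\sqrt d)}\big)$ with parameters $a,b_0,c_0,d$ as in the context, and let $H$ be its unique non-classical Hopf-Galois structure. Put $(b,c)=(b_0,c_0)$ if $b_0$ is odd and $(b,c)=(c_0,b_0)$ if $b_0$ is even (so $b$ is odd and $d=b^2+c^2$). The following are equivalent: 1. $\mathcal{O}_L$ is $\mathfrak{A}_H$-free. 2. The quadratic form $[b,2c,-b]$ represents $1$, i.e. there are $U,V\in\mathbb{Z}$ with $bU^2+2cUV-bV^2=1$. 3. The equation $x^2-dy^2=b$ is solvable in $\mathbb{Z}$ and has some solution $(x,y)$ such that $b$ divides $x-cy$. Moreover, in that case, with $(x,y)$ a solution as in 3, $x'=\frac{x-cy}{b}$ and $y'=\frac{y-x'+1}{2}$, $\mathcal{O}_L$ has an $\mathfrak{A}_H$-generator $\beta=\beta_1\gamma_1+\beta_2\gamma_2+\beta_3\gamma_3+\beta_4\gamma_4$, where $\{\gamma_1,\gamma_2,\gamma_3,\gamma_4\}$ is the integral basis given in the context and the values of $\beta_i\in\mathbb{Z}$ are: - Case 1: $(\beta_1,\beta_2,\beta_3,\beta_4)=(1,1,x',y)$. - Cases 2 and 3: $(\beta_1,\beta_2,\beta_3,\beta_4)=(0,1,x',y)$. - Case 4: $(\beta_1,\beta_2,\beta_3,\beta_4)=\big(-\lceil y/2\rceil,\ y',\ x',\ y\big)$. - Case 5: $(\beta_1,\beta_2,\beta_3,\beta_4)=\big(-\lceil y/2\rceil,\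 y',\ y,\ x'\big)$.
   Context: Every cyclic quartic extension of $\mathbb{Q}$ is of the form $L=\mathbb{Q}\big(\sqrt{a(d+b_0\sqrt d)}\big)$, where $a\in\mathbb{Z}$ is odd and square-free, $b_0\in\mathbb{Z}_{>0}$, $d=b_0^2+c_0^2$ is square-free for some $c_0\in\mathbb{Z}_{>0}$, and $\gcd(a,d)=1$. Let $z=\sqrt{a(d+b_0\sqrt d)}$ and $w=\sqrt{a(d-b_0\sqrt d)}$ (principal square roots, so that $zw=ac_0\sqrt d$). An integral basis $\{\gamma_1,\gamma_2,\gamma_3,\gamma_4\}$ of $L$ (in this order) is: Case 1, $d$ even: $\{1,\sqrt d,z,w\}$. Case 2, $d$ odd and $b_0$ odd: $\{1,\frac{1+\sqrt d}{2},z,w\}$. Case 3, $d$ odd, $b_0$ even, $a+b_0\equiv3\pmod 4$: $\{1,\frac{1+\sqrt d}{2},\frac{z+w}{2},\frac{z-w}{2}\}$. Case 4, $d$ odd, $b_0$ even, $a+b_0\equiv1\pmod 4$, $a\equiv c_0\pmod 4$: $\{1,\frac{1+\sqrt d}{2},\frac{1+\sqrt d+z+w}{4},\frac{1-\sqrt d+z-w}{4}\}$. Case 5, $d$ odd, $b_0$ even, $a+b_0\equiv1\pmod 4$, $a\equiv-c_0\pmod 4$: $\{1,\frac{1+\sqrt d}{2},\frac{1+\sqrt d+z-w}{4},\frac{1-\sqrt d+z+w}{4}\}$. $L/\mathbb{Q}$ has a unique non-classical Hopf-Galois structure $H$ (a Hopf-Galois structure is a finite-dimensional cocommutative $\mathbb{Q}$-Hopf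 algebra $H$ with an action making $L$ a left $H$-module algebra such that $L\otimes_{\mathbb{Q}} H\to\mathrm{End}_{\mathbb{Q}}(L)$, $x\otimes h\mapsto (y\mapsto x(h\cdot y))$ is bijective; the classical one is the group algebra $\mathbb{Q}[\mathrm{Gal}(L/\mathbb{Q})]$ with the Galois action). Explicitly, let $\sigma$ be the generator of $\mathrm{Gal}(L/\mathbb{Q})$ with $z\mapsto w\mapsto -z\mapsto -w$. Since the action is faithful, $H$ is identified, as an algebra acting on $L$, with the subalgebra of $\mathrm{End}_{\mathbb{Q}}(L)$ having $\mathbb{Q}$-basis $\mathrm{id},\ \sigma^2,\ \sigma+\sigma^3,\ \sqrt d\,(\sigma-\sigma^3)$. $\mathcal{O}_L$ is the ring of integers of $L$, and the associated order is $\mathfrak{A}_H=\{h\in H: h\cdot\mathcal{O}_L\subseteq\mathcal{O}_L\}$. "$\mathcal{O}_L$ is $\mathfrak{A}_H$-free" means free (of rank one) as $\mathfrak{A}_H$-module; an $\mathfrak{A}_H$-generator is a $\beta\in\mathcal{O}_L$ such that $\mathfrak{A}_H\to\mathcal{O}_L$, $h\mapsto h\cdot\beta$, is bijective.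
   Formalization: In Case 5 the printed values are false (e.g. a=-1, b_0=2, c_0=1, solution (x,y)=(-1,0) gives no generator); they are replaced by (β_1,β_2,β_3,β_4)=(-⌈x'/2⌉, 1-y', y, x'), for every solution (x,y) as in 3. -}

module Defs where

open import Algebra.Bundles using (AbelianGroup; CommutativeRing)
import Algebra.Consequences.Setoid as Consequences
import Algebra.Construct.DirectProduct as DirectProduct
open import Data.Integer.Base as ℤ using (ℤ; +_; 1ℤ)
open import Data.Integer.Divisibility.Signed using () renaming (_∣_ to _∣ᶻ_)
open import Data.List.Base using (List; []; _∷_)
open import Data.Nat.Base as ℕ using (ℕ; NonZero)
open import Data.Nat.Divisibility using (_∣_; _∣?_)
open import Data.Product using (Σ; Σ-syntax; ∃; ∃-syntax; _×_; _,_; proj₁)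
open import Data.Rational.Base as ℚ using (ℚ; 0ℚ; 1ℚ; ½; _/_; ceiling)
open import Data.Rational.Properties using () renaming (+-*-commutativeRing to ℚ-ring)
open import Data.Vec.Base using (Vec; []; _∷_; zipWith; foldr′)
open import Function.Definitions using (Bijective)
open import Relation.Binary.PropositionalEquality.Core using (_≡_)
open import Relation.Nullary using (¬_; yes; no)

SquareFree : ℕ → Set
SquareFree n = ∀ k → k ℕ.* k ∣ n → k ≡ 1

infix 4 _≡_[mod_]

_≡_[mod_] : ℤ → ℤ → ℕ → Set
i ≡ j [mod n ] = + n ∣ᶻ i ℤ.- j

-- R[X]/(X² − δ); the pair (p , q) stands for p + q√δ.
module Adjoin√ {c ℓ} (R : CommutativeRing c ℓ) where

  private
    module R = CommutativeRing R
    open R using (_+_; _*_; _≈_; 0#; 1#)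
    open import Algebra.Solver.Ring.NaturalCoefficients.Default R.commutativeSemiring

    assoc₁ : ∀ δ p q r t u v →
      (p * r + δ * (q * t)) * u + δ * ((p * t + q * r) * v) ≈
      p * (r * u + δ * (t * v)) + δ * (q * (r * v + t * u))
    assoc₁ = solve 7 (λ δ p q r t u v →
      (p :* r :+ δ :* (q :* t)) :* u :+ δ :* ((p :* t :+ q :* r) :* v) :=
      p :* (r :* u :+ δ :* (t :* v)) :+ δ :* (q :* (r :* v :+ t :* u))) R.refl

    assoc₂ : ∀ δ p q r t u v →
      (p * r + δ * (q * t)) * v + (p * t + q * r) * u ≈
      p * (r * v + t * u) + q * (r * u + δ * (t * v))
    assoc₂ = solve 7 (λ δ p q r t u v →
      (p :* r :+ δ :* (q :* t)) :* v :+ (p :* t :+ q :* r) :* u :=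
      p :* (r :* v :+ t :* u) :+ q :* (r :* u :+ δ :* (t :* v))) R.refl

    comm₁ : ∀ δ p q r t → p * r + δ * (q * t) ≈ r * p + δ * (t * q)
    comm₁ = solve 5 (λ δ p q r t →
      p :* r :+ δ :* (q :* t) := r :* p :+ δ :* (t :* q)) R.refl

    comm₂ : ∀ p q r t → p * t + q * r ≈ r * q + t * p
    comm₂ = solve 4 (λ p q r t → p :* t :+ q :* r := r :* q :+ t :* p) R.refl

    id₁ : ∀ δ p q → 1# * p + δ * (0# * q) ≈ p
    id₁ = solve 3 (λ δ p q → con 1 :* p :+ δ :* (con 0 :* q) := p) R.refl

    id₂ : ∀ p q → 1# * q + 0# * p ≈ q
    id₂ = solve 2 (λ p q → con 1 :* q :+ con 0 :* p := q) R.refl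

    dist₁ : ∀ δ p q r t u v →
      p * (r + u) + δ * (q * (t + v)) ≈
      (p * r + δ * (q * t)) + (p * u + δ * (q * v))
    dist₁ = solve 7 (λ δ p q r t u v →
      p :* (r :+ u) :+ δ :* (q :* (t :+ v)) :=
      (p :* r :+ δ :* (q :* t)) :+ (p :* u :+ δ :* (q :* v))) R.refl

    dist₂ : ∀ p q r t u v →
      p * (t + v) + q * (r + u) ≈ (p * t + q * r) + (p * v + q * u)
    dist₂ = solve 6 (λ p q r t u v →
      p :* (t :+ v) :+ q :* (r :+ u) :=
      (p :* t :+ q :* r) :+ (p :* v :+ q :* u)) R.refl

  adjoin√ : R.Carrier → CommutativeRing c ℓ
  adjoin√ δ = record
    { Carrier = R.Carrier × R.Carrier
    ; _≈_ = G._≈_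
    ; _+_ = G._∙_
    ; _*_ = mul
    ; -_  = G._⁻¹
    ; 0#  = G.ε
    ; 1#  = 1# , 0#
    ; isCommutativeRing = record
      { isRing = record
        { +-isAbelianGroup = G.isAbelianGroup
        ; *-cong = λ (e , f) (g , h) →
              R.+-cong (R.*-cong e g) (R.*-cong R.refl (R.*-cong f h))
            , R.+-cong (R.*-cong e h) (R.*-cong f g)
        ; *-assoc = λ (p , q) (r , t) (u , v) →
            assoc₁ δ p q r t u v , assoc₂ δ p q r t u v
        ; *-identity = comm∧idˡ⇒id mul-comm (λ (p , q) → id₁ δ p q , id₂ p q)
        ; distrib = comm∧distrˡ⇒distr G.∙-cong mul-comm
            (λ (p , q) (r , t) (u , v) → dist₁ δ p q r t u v , dist₂ p q r t u v)
        }
      ; *-comm = mul-comm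
      }
    }
    where
    module G = AbelianGroup
      (DirectProduct.abelianGroup R.+-abelianGroup R.+-abelianGroup)
    open Consequences G.setoid using (comm∧idˡ⇒id; comm∧distrˡ⇒distr)

    mul : R.Carrier × R.Carrier → R.Carrier × R.Carrier → R.Carrier × R.Carrier
    mul (p , q) (r , t) = p * r + δ * (q * t) , p * t + q * r

    mul-comm : ∀ x y → mul x y G.≈ mul y x
    mul-comm (p , q) (r , t) = comm₁ δ p q r t , comm₂ p q r t

open Adjoin√ public using (adjoin√)

module CyclicQuartic (a : ℤ) (b₀ c₀ : ℕ) .{{_ : NonZero c₀}} where

  d : ℕ
  d = b₀ ℕ.* b₀ ℕ.+ c₀ ℕ.* c₀

  b c : ℕ
  b with 2 ∣? b₀
  ... | yes _ = c₀
  ... | no  _ = b₀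
  c with 2 ∣? b₀
  ... | yes _ = b₀
  ... | no  _ = c₀

  ℚ[√d] : CommutativeRing _ _
  ℚ[√d] = adjoin√ ℚ-ring (+ d / 1)

  -- ℚ(√d)(z) with z² = a(d + b₀√d).
  L : CommutativeRing _ _
  L = adjoin√ ℚ[√d] ((a ℤ.* + d) / 1 , (a ℤ.* + b₀) / 1)

  open CommutativeRing L

  ι : ℚ → Carrier
  ι q = (q , 0ℚ) , (0ℚ , 0ℚ)

  ιᶻ : ℤ → Carrier
  ιᶻ n = ι (n / 1)

  √d z w : Carrier
  √d = (0ℚ , 1ℚ) , (0ℚ , 0ℚ)
  z  = (0ℚ , 0ℚ) , (1ℚ , 0ℚ)
  -- From zw = ac₀√d and z² = a√d(√d + b₀) one gets w = ((√d − b₀)/c₀) z.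
  w  = (0ℚ , 0ℚ) , ((ℤ.- + b₀) / c₀ , 1ℤ / c₀)

  -- The automorphism with √d ↦ −√d and z ↦ w, whence w ↦ −z.
  σ : Carrier → Carrier
  σ ((p , q) , (r , t)) =
    ((p , ℚ.- q) , (0ℚ , 0ℚ)) + ((r , ℚ.- t) , (0ℚ , 0ℚ)) * w

  -- Value at x of the monic polynomial Xⁿ + kₙ₋₁Xⁿ⁻¹ + … + k₀ whose lower
  -- coefficients are listed from k₀ upwards.
  evalMonic : List ℤ → Carrier → Carrier
  evalMonic []       x = 1#
  evalMonic (k ∷ ks) x = ιᶻ k + x * evalMonic ks x

  IsIntegral : Carrier → Set
  IsIntegral x = ∃[ ks ] evalMonic ks x ≈ 0#

  𝒪 : Set
  𝒪 = Σ Carrier IsIntegral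

  _≈𝒪_ : 𝒪 → 𝒪 → Set
  x ≈𝒪 y = proj₁ x ≈ proj₁ y

  -- The non-classical Hopf–Galois structure, identified with its image in
  -- End(L): the ℚ-span of id, σ², σ + σ³ and √d(σ − σ³).
  InH : (Carrier → Carrier) → Set
  InH h = ∃[ p ] ∃[ q ] ∃[ r ] ∃[ t ] ∀ x →
    h x ≈ ι p * x
        + ι q * σ (σ x)
        + ι r * (σ x + σ (σ (σ x)))
        + ι t * (√d * (σ x - σ (σ (σ x))))

  𝔄 : Set
  𝔄 = Σ[ h ∈ (Carrier → Carrier) ] InH h × (∀ x → IsIntegral x → IsIntegral (h x))

  _≈𝔄_ : 𝔄 → 𝔄 → Set
  g ≈𝔄 h = ∀ x → proj₁ g x ≈ proj₁ h x

  _·_ : 𝔄 → 𝒪 → 𝒪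
  (h , _ , h-pres) · (x , x-int) = h x , h-pres x x-int

  IsGenerator : Carrier → Set
  IsGenerator β =
    Σ[ β-int ∈ IsIntegral β ] Bijective _≈𝔄_ _≈𝒪_ (_· (β , β-int))

  𝒪-free : Set
  𝒪-free = ∃ IsGenerator

  data Case : Set where
    case₁ : 2 ∣ d → Case
    case₂ : ¬ 2 ∣ d → ¬ 2 ∣ b₀ → Case
    case₃ : ¬ 2 ∣ d → 2 ∣ b₀ → a ℤ.+ + b₀ ≡ + 3 [mod 4 ] → Case
    case₄ : ¬ 2 ∣ d → 2 ∣ b₀ → a ℤ.+ + b₀ ≡ + 1 [mod 4 ] →
            a ≡ + c₀ [mod 4 ] → Case
    case₅ : ¬ 2 ∣ d → 2 ∣ b₀ → a ℤ.+ + b₀ ≡ + 1 [mod 4 ] →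
            a ≡ ℤ.- + c₀ [mod 4 ] → Case

  half quarter : Carrier → Carrier
  half    x = ι ½ * x
  quarter x = ι (1ℤ / 4) * x

  γ : Case → Vec Carrier 4
  γ (case₁ _)       = 1# ∷ √d ∷ z ∷ w ∷ []
  γ (case₂ _ _)     = 1# ∷ half (1# + √d) ∷ z ∷ w ∷ []
  γ (case₃ _ _ _)   = 1# ∷ half (1# + √d) ∷ half (z + w) ∷ half (z - w) ∷ []
  γ (case₄ _ _ _ _) = 1# ∷ half (1# + √d)
                    ∷ quarter (1# + √d + z + w) ∷ quarter (1# - √d + z - w) ∷ []
  γ (case₅ _ _ _ _) = 1# ∷ half (1# + √d)
                    ∷ quarter (1# + √d + z - w) ∷ quarter (1# - √d + z + w) ∷ []

  -- The coordinates β₁, …, β₄ in terms of x′, y and y′ = (y − x′ + 1)/2.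
  -- The last case is the fourth one for (−c₀ , −w) in place of (c₀ , w); this
  -- exchanges x′ and y, and so turns y′ into (x′ − y + 1)/2 = 1 − y′.
  β-coords : Case → (x′ y y′ : ℤ) → Vec ℤ 4
  β-coords (case₁ _)       x′ y y′ = 1ℤ ∷ 1ℤ ∷ x′ ∷ y ∷ []
  β-coords (case₂ _ _)     x′ y y′ = + 0 ∷ 1ℤ ∷ x′ ∷ y ∷ []
  β-coords (case₃ _ _ _)   x′ y y′ = + 0 ∷ 1ℤ ∷ x′ ∷ y ∷ []
  β-coords (case₄ _ _ _ _) x′ y y′ = ℤ.- ceiling (y / 2) ∷ y′ ∷ x′ ∷ y ∷ []
  β-coords (case₅ _ _ _ _) x′ y y′ =
    ℤ.- ceiling (x′ / 2) ∷ 1ℤ ℤ.- y′ ∷ y ∷ x′ ∷ []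

  combination : Vec ℤ 4 → Vec Carrier 4 → Carrier
  combination ns xs = foldr′ _+_ 0# (zipWith (λ n x → ιᶻ n * x) ns xs)

-- In terms of the coordinates of e + f √d + g z + h w, Galois conjugation and
-- multiplication are explicit, and an element is integral iff its characteristic
-- polynomial is.  Necessity of the latter comes from bounded denominators: x is
-- integral iff D xⁿ lies in ℤ⟨1, √d, z, w⟩ for a fixed D ≠ 0 and all n, a condition
-- inherited by sums, products and conjugates, and met by a rational number only if it
-- is an integer.  With the square-freeness of d and a d this leaves denominators 4,
-- and congruences modulo powers of 2 then give the five integral bases.
--
-- H acts as A on ℚ, as B on ℚ √d and as s + τ J on the plane ⟨z , w⟩, where J² = d.
-- Since b is odd and prime to c, an operator of this kind which preserves 𝒪 has
-- integral s and τ.  Hence (g , h) and J (g , h) span the plane lattice if β with plane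
-- coordinates (g , h) is a generator, and the determinant of these two vectors is
-- ± [b, 2c, −b](g , h).  Conversely, if this determinant is ± 1 then Cramer's rule gives
-- the operator taking β to a prescribed integer.
--
-- Finally, x = b U + c y with y = V turns [b, 2c, −b](U , V) = 1 into x² − d y² = b.
module Submission where

open import Defs
open import Algebra.Bundles using (CommutativeRing)
open import Data.Integer.Base as ℤ using (ℤ; +_; -[1+_]; 0ℤ; 1ℤ)
open import Data.List.Base using (List; []; _∷_; length; map)
import Data.List.Relation.Unary.All as ListAll
open ListAll using ([]; _∷_)
open import Data.Nat.Base as ℕ using (ℕ; zero; suc; NonZero; z≤n; s≤s; _≡ᵇ_)
import Data.Nat.Properties as ℕₚ
open import Data.Product using (Σ-syntax; ∃-syntax; _×_; _,_; proj₁; proj₂)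
open import Data.Sum.Base using (_⊎_; inj₁; inj₂)
open import Level using (0ℓ; _⊔_)
import Relation.Binary.PropositionalEquality.Core as ≡
open import Relation.Nullary using (¬_)

-- Having some monic equation is not visibly stable under sums, and no resultants or determinants
-- are set up to prove it so. Bounded denominators replace them. The way back to a monic polynomial
-- is one explicit quartic: its coefficients are traces and norms, hence rational, and so integers.
--
-- The 2-adic work is uniform. A number with denominator 4 is a quarter of 2s or of 2s + 1. A
-- pattern of parities is excluded by exhibiting a trace or norm which, as a polynomial in the free
-- integers, is ½ plus a polynomial with integer coefficients; normalisation decides this. Only t² ≡
-- t (mod 2) is invisible to it and enters through (t² + t)/2.
--
-- The sign of the determinant is harmless, as Q(V, -U) = -Q(U, V). In case 5 the determinant at the
-- given generator is in fact -1.
--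
-- A generator needs more than its plane coordinates: its coordinates at 1 and √d must allow every
-- integer to be reached. In cases 4 and 5, where ℚ(√d) is glued to the plane, these are ±¼ and ¼,
-- and this is the purpose of the ceiling and of y′ in the coordinates.

module RingLemmas {c ℓ} (R : CommutativeRing c ℓ) where
  open CommutativeRing R
  open import Algebra.Properties.Ring ring using (-‿distribʳ-*)
  open import Algebra.Solver.Ring.NaturalCoefficients.Default commutativeSemiring
  open import Relation.Binary.Reasoning.Setoid setoid

  -- (X² − (x + y) X + x y) (X² − T X + N) vanishes at x.
  quartic-root : ∀ x y T N {c₁ c₂ c₃ c₄ n₁ n₃} →
    c₁ ≈ (x + y) + T → c₂ ≈ (x + y) * T + (x * y + N) → c₃ ≈ (x + y) * N + T * (x * y) → c₄ ≈ (x * y) * N →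
    c₁ + n₁ ≈ 0# → c₃ + n₃ ≈ 0# →
    c₄ + x * (n₃ + x * (c₂ + x * (n₁ + x * 1#))) ≈ 0#
  quartic-root x y T N {c₁} {c₂} {c₃} {c₄} {n₁} {n₃} e₁ e₂ e₃ e₄ z₁ z₃ = begin
    c₄ + x * (n₃ + x * (c₂ + x * (n₁ + x * 1#)))                ≈⟨ lem₁ x c₂ c₄ n₁ n₃ ⟩
    (c₄ + x * x * c₂ + x * x * x * x) + (x * n₃ + x * x * x * n₁)
      ≈⟨ +-congʳ (+-congʳ (+-cong e₄ (*-congˡ e₂))) ⟩
    ((x * y) * N + x * x * ((x + y) * T + (x * y + N)) + x * x * x * x) + (x * n₃ + x * x * x * n₁)
      ≈⟨ lem₂ x y T N n₁ n₃ ⟩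
    x * (((x + y) * N + T * (x * y)) + n₃) + x * x * x * (((x + y) + T) + n₁)
      ≈⟨ +-cong (*-congˡ (+-congʳ e₃)) (*-congˡ (+-congʳ e₁)) ⟨
    -- `n₁` and `n₃` stand for -c₁ and -c₃. With the subtraction kept in the hypotheses, only
    -- identities of commutative semirings are left.
    x * (c₃ + n₃) + x * x * x * (c₁ + n₁)                       ≈⟨ +-cong (*-congˡ z₃) (*-congˡ z₁) ⟩
    x * 0# + x * x * x * 0#                                     ≈⟨ lem₃ x ⟩
    0#                                                          ∎
    where
    lem₁ : ∀ x c₂ c₄ n₁ n₃ → c₄ + x * (n₃ + x * (c₂ + x * (n₁ + x * 1#))) ≈
                             (c₄ + x * x * c₂ + x * x * x * x) + (x * n₃ + x * x * x * n₁)
    lem₁ = solve 5 (λ x c₂ c₄ n₁ n₃ → c₄ :+ x :* (n₃ :+ x :* (c₂ :+ x :* (n₁ :+ x :* con 1))) :=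
             (c₄ :+ x :* x :* c₂ :+ x :* x :* x :* x) :+ (x :* n₃ :+ x :* x :* x :* n₁)) refl
    lem₂ : ∀ x y T N n₁ n₃ →
      ((x * y) * N + x * x * ((x + y) * T + (x * y + N)) + x * x * x * x) + (x * n₃ + x * x * x * n₁) ≈
      x * (((x + y) * N + T * (x * y)) + n₃) + x * x * x * (((x + y) + T) + n₁)
    lem₂ = solve 6 (λ x y T N n₁ n₃ →
      ((x :* y) :* N :+ x :* x :* ((x :+ y) :* T :+ (x :* y :+ N)) :+ x :* x :* x :* x) :+ (x :* n₃ :+ x :* x :* x :* n₁) :=
      x :* (((x :+ y) :* N :+ T :* (x :* y)) :+ n₃) :+ x :* x :* x :* (((x :+ y) :+ T) :+ n₁)) refl
    lem₃ : ∀ x → x * 0# + x * x * x * 0# ≈ 0#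
    lem₃ = solve 1 (λ x → x :* con 0 :+ x :* x :* x :* con 0 := con 0) refl

  -- Almost integral elements over a subring

  module AlmostIntegrality {m n} (M : Carrier → Set m) (M-resp : ∀ {x y} → x ≈ y → M x → M y)
    (M-+ : ∀ {x y} → M x → M y → M (x + y)) (M-* : ∀ {x y} → M x → M y → M (x * y))
    (M-neg : ∀ {x} → M x → M (- x)) (M-1 : M 1#)
    (Denominator : Carrier → Set n) (Den⊆M : ∀ {D} → Denominator D → M D)
    (Den-* : ∀ {D E} → Denominator D → Denominator E → Denominator (D * E))
    (Den-1 : Denominator 1#)
    where

    infixr 8 _^_
    _^_ : Carrier → ℕ → Carrier
    x ^ zero  = 1#
    x ^ suc n = x * x ^ n

    ^-cong : ∀ {x y} n → x ≈ y → x ^ n ≈ y ^ n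
    ^-cong zero    x≈y = refl
    ^-cong (suc n) x≈y = *-cong x≈y (^-cong n x≈y)

    -- The complete integral closure of `M`: one denominator serves all powers of `x`. In the
    -- application `M` is the order spanned by 1, √d, z, w and denominators are the nonzero
    -- integers.
    record AlmostIntegral (x : Carrier) : Set (c ⊔ m ⊔ n) where
      constructor almostIntegral
      field
        {D}     : Carrier
        den     : Denominator D
        powers  : ∀ n → M (D * x ^ n)

    M-^ : ∀ {x} n → M x → M (x ^ n)
    M-^ zero    Mx = M-1
    M-^ (suc n) Mx = M-* Mx (M-^ n Mx)

    M⇒AI : ∀ {x} → M x → AlmostIntegral x
    M⇒AI Mx = almostIntegral Den-1 λ n → M-* M-1 (M-^ n Mx)

    AI-neg : ∀ {x} → AlmostIntegral x → AlmostIntegral (- x)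
    AI-neg {x} (almostIntegral {D} den h) = almostIntegral den λ n → M-resp (lem n) (M-* (M-^ n (M-neg M-1)) (h n))
      where
      lem₁ : ∀ m p D x q → (m * p) * (D * (x * q)) ≈ (x * m) * (p * (D * q))
      lem₁ = solve 5 (λ m p D x q → (m :* p) :* (D :* (x :* q)) := (x :* m) :* (p :* (D :* q))) refl
      lem₂ : ∀ x D q → x * (D * q) ≈ D * (x * q)
      lem₂ = solve 3 (λ x D q → x :* (D :* q) := D :* (x :* q)) refl
      lem : ∀ n → (- 1#) ^ n * (D * x ^ n) ≈ D * (- x) ^ n
      lem zero = *-identityˡ (D * 1#)
      lem (suc n) = begin
        (- 1# * (- 1#) ^ n) * (D * (x * x ^ n))  ≈⟨ lem₁ (- 1#) ((- 1#) ^ n) D x (x ^ n) ⟩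
        (x * - 1#) * ((- 1#) ^ n * (D * x ^ n))  ≈⟨ *-cong (trans (sym (-‿distribʳ-* x 1#)) (-‿cong (*-identityʳ x))) (lem n) ⟩
        - x * (D * (- x) ^ n)                    ≈⟨ lem₂ (- x) D ((- x) ^ n) ⟩
        D * (- x * (- x) ^ n)                    ∎

    AI-+ : ∀ {x y} → AlmostIntegral x → AlmostIntegral y → AlmostIntegral (x + y)
    AI-+ {x} {y} (almostIntegral {D} den h) (almostIntegral {E} den′ h′) =
      almostIntegral (Den-* den den′) λ n → M-resp (lem₂ (D * E) ((x + y) ^ n)) (expand n 0 0)
      where
      lem₀ : ∀ D E p q → (D * p) * (E * q) ≈ D * E * 1# * p * q
      lem₀ = solve 4 (λ D E p q → (D :* p) :* (E :* q) := D :* E :* con 1 :* p :* q) refl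
      lem₁ : ∀ D x y s p q → D * s * (x * p) * q + D * s * p * (y * q) ≈ D * ((x + y) * s) * p * q
      lem₁ = solve 6 (λ D x y s p q → D :* s :* (x :* p) :* q :+ D :* s :* p :* (y :* q) := D :* ((x :+ y) :* s) :* p :* q) refl
      lem₂ : ∀ D s → D * s * 1# * 1# ≈ D * s
      lem₂ = solve 2 (λ D s → D :* s :* con 1 :* con 1 := D :* s) refl
      -- The exponents `i` and `j` are free: one factor x + y raises `i` in one summand and `j` in
      -- the other, so no binomial coefficients appear.
      expand : ∀ n i j → M (D * E * (x + y) ^ n * x ^ i * y ^ j)
      expand zero    i j = M-resp (lem₀ D E (x ^ i) (y ^ j)) (M-* (h i) (h′ j))
      expand (suc n) i j = M-resp (lem₁ (D * E) x y ((x + y) ^ n) (x ^ i) (y ^ j))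
                             (M-+ (expand n (suc i) j) (expand n i (suc j)))

    AI-* : ∀ {x y} → AlmostIntegral x → AlmostIntegral y → AlmostIntegral (x * y)
    AI-* {x} {y} (almostIntegral {D} den h) (almostIntegral {E} den′ h′) =
      almostIntegral (Den-* den den′) λ n → M-resp (lem n) (M-* (h n) (h′ n))
      where
      lem₀ : ∀ D E → (D * 1#) * (E * 1#) ≈ D * E * 1#
      lem₀ = solve 2 (λ D E → (D :* con 1) :* (E :* con 1) := D :* E :* con 1) refl
      lem₁ : ∀ D E x y p q → (D * (x * p)) * (E * (y * q)) ≈ (x * y) * ((D * p) * (E * q))
      lem₁ = solve 6 (λ D E x y p q → (D :* (x :* p)) :* (E :* (y :* q)) := (x :* y) :* ((D :* p) :* (E :* q))) refl
      lem₂ : ∀ D s q → s * (D * q) ≈ D * (s * q)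
      lem₂ = solve 3 (λ D s q → s :* (D :* q) := D :* (s :* q)) refl
      lem : ∀ n → (D * x ^ n) * (E * y ^ n) ≈ D * E * (x * y) ^ n
      lem zero    = lem₀ D E
      lem (suc n) = begin
        (D * (x * x ^ n)) * (E * (y * y ^ n))  ≈⟨ lem₁ D E x y (x ^ n) (y ^ n) ⟩
        (x * y) * ((D * x ^ n) * (E * y ^ n))  ≈⟨ *-congˡ (lem n) ⟩
        (x * y) * (D * E * (x * y) ^ n)        ≈⟨ lem₂ (D * E) (x * y) ((x * y) ^ n) ⟩
        D * E * ((x * y) * (x * y) ^ n)        ∎

    AI-− : ∀ {x y} → AlmostIntegral x → AlmostIntegral y → AlmostIntegral (x - y)
    AI-− p q = AI-+ p (AI-neg q)

    -- A monic equation of degree k for x bounds the denominators of all powers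
    -- of x by those of 1, x, …, xᵏ⁻¹.
    module Monic (x : Carrier) where
      monic : List Carrier → Carrier
      monic []       = 1#
      monic (k ∷ ks) = k + x * monic ks

      -- Coefficients are peeled off one at a time: subtracting k D xⁿ from D xⁿ (k + x s) leaves D
      -- xⁿ⁺¹ s. When none is left, only the leading power remains, so it lies in `M` as soon as the
      -- lower ones do.
      tail-M : ∀ D ks n → ListAll.All M ks → (∀ i → i ℕ.< length ks → M (D * x ^ (i ℕ.+ n))) →
               M (D * x ^ n * monic ks) → M (D * x ^ (length ks ℕ.+ n))
      tail-M D [] n _ _ top = M-resp (*-identityʳ (D * x ^ n)) top
      tail-M D (k ∷ ks) n (Mk ∷ Mks) low top =
        ≡.subst (λ j → M (D * x ^ j)) (ℕₚ.+-suc (length ks) n)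
          (tail-M D ks (suc n) Mks
            (λ i i<k → ≡.subst (λ j → M (D * x ^ j)) (≡.sym (ℕₚ.+-suc i n)) (low (suc i) (ℕ.s≤s i<k)))
            (M-resp (lem D k x (x ^ n) (monic ks)) (M-+ top (M-neg (M-* Mk (low 0 (ℕ.s≤s ℕ.z≤n)))))))
        where
        lem₁ : ∀ D k x p s → D * p * (k + x * s) ≈ D * (x * p) * s + k * (D * p)
        lem₁ = solve 5 (λ D k x p s → D :* p :* (k :+ x :* s) := D :* (x :* p) :* s :+ k :* (D :* p)) refl
        lem : ∀ D k x p s → D * p * (k + x * s) + - (k * (D * p)) ≈ D * (x * p) * s
        lem D k x p s = begin
          D * p * (k + x * s) + - (k * (D * p))                  ≈⟨ +-congʳ (lem₁ D k x p s) ⟩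
          D * (x * p) * s + k * (D * p) + - (k * (D * p))        ≈⟨ +-assoc _ _ _ ⟩
          D * (x * p) * s + (k * (D * p) + - (k * (D * p)))      ≈⟨ +-congˡ (-‿inverseʳ (k * (D * p))) ⟩
          D * (x * p) * s + 0#                                   ≈⟨ +-identityʳ _ ⟩
          D * (x * p) * s                                        ∎

      monic⇒AI : ∀ D → Denominator D → M (D * x) → ∀ ks → ListAll.All M ks → monic ks ≈ 0# → AlmostIntegral x
      monic⇒AI D den MDx ks Mks root = almostIntegral (Den-^ k) λ n → window n 0 ℕ.z≤n
        where
        k = length ks
        Den-^ : ∀ n → Denominator (D ^ n)
        Den-^ zero    = Den-1
        Den-^ (suc n) = Den-* den (Den-^ n)
        lem : ∀ D x p q → (D * x) * (p * q) ≈ (D * p) * (x * q)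
        lem = solve 4 (λ D x p q → (D :* x) :* (p :* q) := (D :* p) :* (x :* q)) refl
        small : ∀ i j → i ℕ.≤ j → M (D ^ j * x ^ i)
        small zero j _ = M-* (M-^ j (Den⊆M den)) M-1
        small (suc i) (suc j) (ℕ.s≤s i≤j) = M-resp (lem D x (D ^ j) (x ^ i)) (M-* MDx (small i j i≤j))
        M-0 : M 0#
        M-0 = M-resp (-‿inverseʳ 1#) (M-+ M-1 (M-neg M-1))
        -- The k + 1 consecutive exponents n, ..., n + k slide upwards. Each step needs only a new
        -- top power, which the equation expresses by the k powers below it. `small` starts the
        -- induction, since Dᵏ clears x⁰, ..., xᵏ.
        window : ∀ n i → i ℕ.≤ k → M (D ^ k * x ^ (i ℕ.+ n))
        window zero i i≤k = ≡.subst (λ j → M (D ^ k * x ^ j)) (≡.sym (ℕₚ.+-identityʳ i)) (small i k i≤k)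
        window (suc n) i i≤k with ℕₚ.m≤n⇒m<n∨m≡n i≤k
        ... | inj₁ i<k    = ≡.subst (λ j → M (D ^ k * x ^ j)) (≡.sym (ℕₚ.+-suc i n)) (window n (suc i) i<k)
        ... | inj₂ ≡.refl = tail-M (D ^ k) ks (suc n) Mks
          (λ i i<k → ≡.subst (λ j → M (D ^ k * x ^ j)) (≡.sym (ℕₚ.+-suc i n)) (window n (suc i) i<k))
          (M-resp (sym (trans (*-congˡ root) (zeroʳ _))) M-0)

open import Data.Bool.Base using (Bool; true; T; _∧_)
open import Data.Bool.Properties using (T-∧)
open import Data.Empty using (⊥; ⊥-elim)
import Data.Integer.DivMod as ℤDM
import Data.Integer.Divisibility.Signed as ℤ∣
import Data.Integer.GCD as ℤGCD
import Data.Integer.Properties as ℤₚ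
import Data.Integer.Tactic.RingSolver as ℤSolver
import Data.Nat.Coprimality as ℕC
import Data.Nat.Divisibility as ℕ∣
open import Data.Nat.GCD using (module Bézout)
open import Data.Nat.Induction using (<-wellFounded; Acc; acc)
open import Data.Rational.Base using (ℚ)
open import Data.Rational.Solver using (module +-*-Solver)
import Data.Rational.Unnormalised.Base as ℚᵘ
import Data.Rational.Unnormalised.Properties as ℚᵘₚ
open import Data.Vec.Base using (Vec; []; _∷_; tabulate)
open import Data.Vec.Relation.Unary.All using (All; []; _∷_)
open import Function.Bundles using (Equivalence; mk⇔)
open import Relation.Binary.PropositionalEquality
open import Relation.Nullary using (yes; no)
open import Relation.Nullary.Decidable using (dec⇒maybe)
open import Tactic.RingSolver using (solve-∀)
import Tactic.RingSolver.Core.AlmostCommutativeRing as ACR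
open import Algebra.Properties.AbelianGroup ℤₚ.+-0-abelianGroup using () renaming (∙-cancelˡ to +-cancelˡ)

-- Integers inside ℚ: denominators, parity and polynomials with integer values

module Integers where
  open import Data.Rational.Base hiding (NonZero)
  open import Data.Rational.Properties
  open +-*-Solver public using (Polynomial; _:+_; _:*_; _:-_; :-_; con; var)
  open +-*-Solver using (HNF; ∅; _*x+_; Normal; ⟦_⟧; ⟦_⟧N; ⟦_⟧H; normalise; correct) renaming (con to conN; poly to polyN)

  ℚ-acr : ACR.AlmostCommutativeRing 0ℓ 0ℓ
  ℚ-acr = ACR.fromCommutativeRing +-*-commutativeRing (λ x → dec⇒maybe (0ℚ ≟ x))

  opaque
    ⟪_⟫ : ℤ → ℚ
    ⟪ n ⟫ = n / 1

    ⟪⟫≡/1 : ∀ n → ⟪ n ⟫ ≡ n / 1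
    ⟪⟫≡/1 n = refl

  2ℚ : ℚ
  2ℚ = + 2 / 1

  toℚᵘ-/ : ∀ i n .{{_ : NonZero n}} → toℚᵘ (i / n) ℚᵘ.≃ (i ℚᵘ./ n)
  toℚᵘ-/ i (suc n) = toℚᵘ-fromℚᵘ (ℚᵘ.mkℚᵘ i n)

  opaque
    unfolding ⟪_⟫

    ⟪⟫-+ : ∀ i j → ⟪ i ℤ.+ j ⟫ ≡ ⟪ i ⟫ + ⟪ j ⟫
    ⟪⟫-+ i j = toℚᵘ-injective (begin
      toℚᵘ ⟪ i ℤ.+ j ⟫                ≈⟨ toℚᵘ-/ (i ℤ.+ j) 1 ⟩
      (i ℤ.+ j) ℚᵘ./ 1                ≈⟨ ℚᵘ.*≡* (lem i j) ⟩
      (i ℚᵘ./ 1) ℚᵘ.+ (j ℚᵘ./ 1)      ≈⟨ ℚᵘₚ.+-cong (toℚᵘ-/ i 1) (toℚᵘ-/ j 1) ⟨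
      toℚᵘ ⟪ i ⟫ ℚᵘ.+ toℚᵘ ⟪ j ⟫      ≈⟨ toℚᵘ-homo-+ ⟪ i ⟫ ⟪ j ⟫ ⟨
      toℚᵘ (⟪ i ⟫ + ⟪ j ⟫)            ∎)
      where
      open import Relation.Binary.Reasoning.Setoid ℚᵘₚ.≃-setoid
      lem : ∀ i j → (i ℤ.+ j) ℤ.* 1ℤ ≡ (i ℤ.* 1ℤ ℤ.+ j ℤ.* 1ℤ) ℤ.* 1ℤ
      lem = ℤSolver.solve-∀

    ⟪⟫-* : ∀ i j → ⟪ i ℤ.* j ⟫ ≡ ⟪ i ⟫ * ⟪ j ⟫
    ⟪⟫-* i j = toℚᵘ-injective (begin
      toℚᵘ ⟪ i ℤ.* j ⟫                ≈⟨ toℚᵘ-/ (i ℤ.* j) 1 ⟩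
      (i ℤ.* j) ℚᵘ./ 1                ≈⟨ ℚᵘ.*≡* refl ⟩
      (i ℚᵘ./ 1) ℚᵘ.* (j ℚᵘ./ 1)      ≈⟨ ℚᵘₚ.*-cong (toℚᵘ-/ i 1) (toℚᵘ-/ j 1) ⟨
      toℚᵘ ⟪ i ⟫ ℚᵘ.* toℚᵘ ⟪ j ⟫      ≈⟨ toℚᵘ-homo-* ⟪ i ⟫ ⟪ j ⟫ ⟨
      toℚᵘ (⟪ i ⟫ * ⟪ j ⟫)            ∎)
      where
      open import Relation.Binary.Reasoning.Setoid ℚᵘₚ.≃-setoid

    ⟪⟫-neg : ∀ i → ⟪ ℤ.- i ⟫ ≡ - ⟪ i ⟫
    ⟪⟫-neg (+ zero)  = refl
    ⟪⟫-neg (+ suc n) = refl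
    ⟪⟫-neg -[1+ n ]  = lem _
      where
      lem : ∀ p → p ≡ - (- p)
      lem = solve-∀ ℚ-acr

  ⟪⟫-minus : ∀ i j → ⟪ i ℤ.- j ⟫ ≡ ⟪ i ⟫ - ⟪ j ⟫
  ⟪⟫-minus i j = trans (⟪⟫-+ i (ℤ.- j)) (cong (λ t → ⟪ i ⟫ + t) (⟪⟫-neg j))

  opaque
    unfolding ⟪_⟫

    ⟪⟫-injective : ∀ {i j} → ⟪ i ⟫ ≡ ⟪ j ⟫ → i ≡ j
    ⟪⟫-injective {i} {j} eq with /-injective-≃ (ℚᵘ.mkℚᵘ i 0) (ℚᵘ.mkℚᵘ j 0) eq
    ... | ℚᵘ.*≡* e = ℤₚ.*-cancelʳ-≡ i j 1ℤ e

    /-* : ∀ i n .{{_ : NonZero n}} → (i / n) * ⟪ + n ⟫ ≡ ⟪ i ⟫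
    /-* i (suc n) = toℚᵘ-injective (begin
      toℚᵘ ((i / suc n) * ⟪ + suc n ⟫)               ≈⟨ toℚᵘ-homo-* (i / suc n) ⟪ + suc n ⟫ ⟩
      toℚᵘ (i / suc n) ℚᵘ.* toℚᵘ ⟪ + suc n ⟫         ≈⟨ ℚᵘₚ.*-cong (toℚᵘ-/ i (suc n)) (toℚᵘ-/ (+ suc n) 1) ⟩
      (i ℚᵘ./ suc n) ℚᵘ.* (+ suc n ℚᵘ./ 1)           ≈⟨ ℚᵘ.*≡* (lem i (+ suc n) _ (cong +_ (ℕₚ.*-identityʳ (suc n)))) ⟩
      i ℚᵘ./ 1                                       ≈⟨ toℚᵘ-/ i 1 ⟨
      toℚᵘ ⟪ i ⟫                                     ∎)
      where
      open import Relation.Binary.Reasoning.Setoid ℚᵘₚ.≃-setoid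
      lem₀ : ∀ i m → (i ℤ.* m) ℤ.* 1ℤ ≡ i ℤ.* m
      lem₀ = ℤSolver.solve-∀
      lem : ∀ i m k → k ≡ m → (i ℤ.* m) ℤ.* 1ℤ ≡ i ℤ.* k
      lem i m _ refl = lem₀ i m

  record Z (r : ℚ) : Set where
    constructor _,_
    field
      value    : ℤ
      equality : r ≡ ⟪ value ⟫

  ⟪⟫∈Z : ∀ n → Z ⟪ n ⟫
  ⟪⟫∈Z n = n , refl

  opaque
    unfolding ⟪_⟫

    ⟪0⟫≡0 : ⟪ 0ℤ ⟫ ≡ 0ℚ
    ⟪0⟫≡0 = refl

    ⟪1⟫≡1 : ⟪ 1ℤ ⟫ ≡ 1ℚ
    ⟪1⟫≡1 = refl

    ⟪2⟫≡2 : ⟪ + 2 ⟫ ≡ 2ℚ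
    ⟪2⟫≡2 = refl

  1∈Z : Z 1ℚ
  1∈Z = 1ℤ , sym ⟪1⟫≡1

  2∈Z : Z 2ℚ
  2∈Z = + 2 , sym ⟪2⟫≡2

  infixl 6 _⊕_ _⊖_
  infixl 7 _⊗_

  _⊕_ : ∀ {r s} → Z r → Z s → Z (r + s)
  (m , refl) ⊕ (n , refl) = m ℤ.+ n , sym (⟪⟫-+ m n)

  _⊗_ : ∀ {r s} → Z r → Z s → Z (r * s)
  (m , refl) ⊗ (n , refl) = m ℤ.* n , sym (⟪⟫-* m n)

  ⊝_ : ∀ {r} → Z r → Z (- r)
  ⊝ (m , refl) = ℤ.- m , sym (⟪⟫-neg m)

  _⊖_ : ∀ {r s} → Z r → Z s → Z (r - s)
  r ⊖ s = r ⊕ (⊝ s)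

  ½∉Z : ¬ Z ½
  ½∉Z (n , eq) with ⟪⟫-injective {1ℤ} {+ 2 ℤ.* n} (trans ⟪1⟫≡1 (trans (cong (2ℚ *_) eq)
                  (trans (cong (_* ⟪ n ⟫) (sym ⟪2⟫≡2)) (sym (⟪⟫-* (+ 2) n)))))
  ... | e = ℕₚ.1+n≢n {1} ((ℕ∣.∣1⇒≡1 (ℕ∣.divides ℤ.∣ n ∣
            (trans (cong ℤ.∣_∣ e) (trans (ℤₚ.abs-* (+ 2) n) (ℕₚ.*-comm 2 ℤ.∣ n ∣))))))

  -- Matching on this view replaces a number by 2s or 2s + 1 throughout the goal, so that a
  -- congruence becomes a statement about a polynomial in the free integer s.
  data Parity : ℚ → Set where
    even : ∀ {s} → Z s → Parity (2ℚ * s)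
    odd  : ∀ {s} → Z s → Parity (2ℚ * s + 1ℚ)

  parity : ∀ {r} → Z r → Parity r
  parity (n , refl) with n ℤDM.%ℕ 2 in e | ℤDM.a≡a%ℕn+[a/ℕn]*n n 2 | ℤDM.n%ℕd<d n 2
  ... | 0 | eq | _ = subst Parity (trans (lem ⟪ q ⟫) (sym (eqℚ 0 ⟪0⟫≡0 eq))) (even (⟪⟫∈Z q))
    where
    q = n ℤDM./ℕ 2
    eqℚ : ∀ k {r} → ⟪ + k ⟫ ≡ r → n ≡ + k ℤ.+ q ℤ.* + 2 → ⟪ n ⟫ ≡ r + ⟪ q ⟫ * 2ℚ
    eqℚ k e₀ e = trans (cong ⟪_⟫ e) (trans (⟪⟫-+ (+ k) (q ℤ.* + 2)) (cong₂ _+_ e₀ (trans (⟪⟫-* q (+ 2)) (cong (⟪ q ⟫ *_) ⟪2⟫≡2))))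
    lem : ∀ s → 2ℚ * s ≡ 0ℚ + s * 2ℚ
    lem = solve-∀ ℚ-acr
  ... | 1 | eq | _ = subst Parity (trans (lem ⟪ q ⟫) (sym (eqℚ 1 ⟪1⟫≡1 eq))) (odd (⟪⟫∈Z q))
    where
    q = n ℤDM./ℕ 2
    eqℚ : ∀ k {r} → ⟪ + k ⟫ ≡ r → n ≡ + k ℤ.+ q ℤ.* + 2 → ⟪ n ⟫ ≡ r + ⟪ q ⟫ * 2ℚ
    eqℚ k e₀ e = trans (cong ⟪_⟫ e) (trans (⟪⟫-+ (+ k) (q ℤ.* + 2)) (cong₂ _+_ e₀ (trans (⟪⟫-* q (+ 2)) (cong (⟪ q ⟫ *_) ⟪2⟫≡2))))
    lem : ∀ s → 2ℚ * s + 1ℚ ≡ 1ℚ + s * 2ℚ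
    lem = solve-∀ ℚ-acr
  ... | suc (suc _) | _ | s≤s (s≤s ())

  -- Integer valued although its coefficients are halves. These triangular numbers correct
  -- expressions whose integrality does not show in their coefficients.
  tri∈Z : ∀ {r} → Z r → Z (½ * (r * r + r))
  tri∈Z z with parity z
  ... | even {s} p = subst Z (lem s) (p ⊗ (2∈Z ⊗ p ⊕ 1∈Z))
    where
    lem : ∀ s → s * (2ℚ * s + 1ℚ) ≡ ½ * ((2ℚ * s) * (2ℚ * s) + 2ℚ * s)
    lem = solve-∀ ℚ-acr
  ... | odd {s} p = subst Z (lem s) ((2∈Z ⊗ p ⊕ 1∈Z) ⊗ (p ⊕ 1∈Z))
    where
    lem : ∀ s → (2ℚ * s + 1ℚ) * (s + 1ℚ) ≡ ½ * ((2ℚ * s + 1ℚ) * (2ℚ * s + 1ℚ) + (2ℚ * s + 1ℚ))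
    lem = solve-∀ ℚ-acr

  den-* : ∀ r → r * ⟪ ↧ r ⟫ ≡ ⟪ ↥ r ⟫
  den-* r = trans (cong (_* ⟪ ↧ r ⟫) (sym (↥p/↧p≡p r))) (/-* (↥ r) (↧ₙ r))

  bezout : ∀ i j → ℕC.Coprime ℤ.∣ i ∣ ℤ.∣ j ∣ → ∃[ u ] ∃[ v ] u ℤ.* i ℤ.+ v ℤ.* j ≡ 1ℤ
  bezout i j coprime = signed (ℕC.coprime-Bézout coprime)
    where
    unit : ∀ i → ∃[ ε ] + ℤ.∣ i ∣ ≡ ε ℤ.* i
    unit (+ n)    = 1ℤ , sym (ℤₚ.*-identityˡ (+ n))
    unit -[1+ n ] = -[1+ 0 ] , sym (ℤₚ.-1*i≡-i -[1+ n ])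
    cast : ∀ x y k l → 1 ℕ.+ y ℕ.* l ≡ x ℕ.* k → 1ℤ ℤ.+ + y ℤ.* + l ≡ + x ℤ.* + k
    cast x y k l eq = trans (cong (λ t → 1ℤ ℤ.+ t) (sym (ℤₚ.pos-* y l))) (trans (cong +_ eq) (ℤₚ.pos-* x k))
    lem : ∀ x y i j k l → 1ℤ ℤ.+ y ℤ.* (l ℤ.* j) ≡ x ℤ.* (k ℤ.* i) → (x ℤ.* k) ℤ.* i ℤ.+ (ℤ.- (y ℤ.* l)) ℤ.* j ≡ 1ℤ
    lem x y i j k l eq = trans (lem₁ x y i j k l) (trans (cong (ℤ._- y ℤ.* (l ℤ.* j)) (sym eq)) (lem₂ (y ℤ.* (l ℤ.* j))))
      where
      lem₁ : ∀ x y i j k l → (x ℤ.* k) ℤ.* i ℤ.+ (ℤ.- (y ℤ.* l)) ℤ.* j ≡ x ℤ.* (k ℤ.* i) ℤ.- y ℤ.* (l ℤ.* j)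
      lem₁ = ℤSolver.solve-∀
      lem₂ : ∀ t → 1ℤ ℤ.+ t ℤ.- t ≡ 1ℤ
      lem₂ = ℤSolver.solve-∀
    signed : Bézout.Identity 1 ℤ.∣ i ∣ ℤ.∣ j ∣ → _
    signed (Bézout.+- x y eq) with unit i | unit j
    ... | k , ki | l , lj = + x ℤ.* k , ℤ.- (+ y ℤ.* l) , lem (+ x) (+ y) i j k l
          (trans (cong (λ t → 1ℤ ℤ.+ + y ℤ.* t) (sym lj)) (trans (cast x y _ _ eq) (cong (+ x ℤ.*_) ki)))
    signed (Bézout.-+ x y eq) with unit i | unit j
    ... | k , ki | l , lj = ℤ.- (+ x ℤ.* k) , + y ℤ.* l , trans (ℤₚ.+-comm (ℤ.- (+ x ℤ.* k) ℤ.* i) (+ y ℤ.* l ℤ.* j)) (lem (+ y) (+ x) j i l k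
          (trans (cong (λ t → 1ℤ ℤ.+ + x ℤ.* t) (sym ki)) (trans (cast y x _ _ eq) (cong (+ y ℤ.*_) lj))))

  bezout-ℚ : ∀ i j → ℕC.Coprime ℤ.∣ i ∣ ℤ.∣ j ∣ → ∃[ u ] ∃[ v ] Z u × Z v × u * ⟪ i ⟫ + v * ⟪ j ⟫ ≡ 1ℚ
  bezout-ℚ i j coprime with bezout i j coprime
  ... | u , v , eq = ⟪ u ⟫ , ⟪ v ⟫ , ⟪⟫∈Z u , ⟪⟫∈Z v ,
        trans (cong₂ _+_ (sym (⟪⟫-* u i)) (sym (⟪⟫-* v j))) (trans (sym (⟪⟫-+ (u ℤ.* i) (v ℤ.* j))) (trans (cong ⟪_⟫ eq) ⟪1⟫≡1))

  opaque
    ↥↧-coprime : ∀ r → ℕC.Coprime ℤ.∣ ↥ r ∣ (↧ₙ r)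
    ↥↧-coprime (mkℚ _ _ coprime) = ℕC.recompute coprime

    -- Numerator and denominator q of `r` are coprime, so 1/q = u r + v: whatever multiplies both 1
    -- and `r` into ℤ is divisible by q.
    den-bezout : ∀ r → ∃[ u ] ∃[ v ] Z u × Z v × (u * r + v) * ⟪ ↧ r ⟫ ≡ 1ℚ
    den-bezout r =
      let u , v , zu , zv , eq = bezout-ℚ (↥ r) (↧ r) (↥↧-coprime r) in
      u , v , zu , zv ,
          trans (lem u v r ⟪ ↧ r ⟫) (trans (cong (λ t → u * t + v * ⟪ ↧ r ⟫) (den-* r)) eq)
      where
      lem : ∀ u v r q → (u * r + v) * q ≡ u * (r * q) + v * q
      lem = solve-∀ ℚ-acr

    den≡1⇒Z : ∀ r → ↧ₙ r ≡ 1 → Z r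
    den≡1⇒Z r eq = ↥ r , trans (lem r) (trans (cong (r *_) (sym ⟪1⟫≡1)) (trans (cong (λ n → r * ⟪ + n ⟫) (sym eq)) (den-* r)))
      where
      lem : ∀ r → r ≡ r * 1ℚ
      lem = solve-∀ ℚ-acr

    ∣∣-of-Z* : ∀ m q k → ⟪ m ⟫ ≡ ⟪ k ⟫ * ⟪ + q ⟫ → ℤ.∣ m ∣ ≡ ℤ.∣ k ∣ ℕ.* q
    ∣∣-of-Z* m q k eq = trans (cong ℤ.∣_∣ (⟪⟫-injective {m} {k ℤ.* + q} (trans eq (sym (⟪⟫-* k (+ q)))))) (ℤₚ.abs-* k (+ q))

  infixr 8 _^_
  _^_ : ℚ → ℕ → ℚ
  r ^ zero  = 1ℚ
  r ^ suc n = r * r ^ n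

  -- With (u r + v) q = 1, q the denominator of `r`, first n r is integral because it equals u (n
  -- r²) q + v n (r q). Then expanding n = n ((u r + v) q)² shows that q² divides n, so q = 1.
  squarefree-Z : ∀ n r → (∀ k → k ℕ.* k ℕ∣.∣ ℤ.∣ n ∣ → k ≡ 1) → Z (⟪ n ⟫ * (r * r)) → Z r
  squarefree-Z n r sf zi with den-bezout r
  ... | u , v , zu , zv , eq = den≡1⇒Z r (sf (↧ₙ r) (ℕ∣.divides ℤ.∣ k ∣ (∣∣-of-Z* n (↧ₙ r ℕ.* ↧ₙ r) k
          (trans n≡ (cong₂ _*_ k≡ (trans (sym (⟪⟫-* (↧ r) (↧ r))) (cong ⟪_⟫ (sym (ℤₚ.pos-* (↧ₙ r) (↧ₙ r))))))))))
    where
    q = ⟪ ↧ r ⟫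
    N = ⟪ n ⟫
    zN = ⟪⟫∈Z n
    zq = ⟪⟫∈Z (↧ r)
    lem₁ : ∀ N u v r q → u * (N * (r * r)) * q + v * N * (r * q) ≡ N * r * ((u * r + v) * q)
    lem₁ = solve-∀ ℚ-acr
    zNr : Z (N * r)
    zNr = subst Z (trans (lem₁ N u v r q) (trans (cong (N * r *_) eq) (*-identityʳ (N * r))))
            (zu ⊗ zi ⊗ zq ⊕ zv ⊗ zN ⊗ (↥ r , den-* r))
    lem₂ : ∀ N u v r q → N * (((u * r + v) * q) * ((u * r + v) * q)) ≡
                         (u * u * (N * (r * r)) + u * v * 2ℚ * (N * r) + v * v * N) * (q * q)
    lem₂ = solve-∀ ℚ-acr
    n≡ : N ≡ (u * u * (N * (r * r)) + u * v * 2ℚ * (N * r) + v * v * N) * (q * q)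
    n≡ = trans (trans (sym (*-identityʳ N)) (cong (λ t → N * (t * t)) (sym eq))) (lem₂ N u v r q)
    zk : Z (u * u * (N * (r * r)) + u * v * 2ℚ * (N * r) + v * v * N)
    zk = zu ⊗ zu ⊗ zi ⊕ zu ⊗ zv ⊗ 2∈Z ⊗ zNr ⊕ zv ⊗ zv ⊗ zN
    k = Z.value zk
    k≡ = Z.equality zk

  -- Each step divides m by the denominator of r.
  bounded-powers-Z : ∀ m r → .{{_ : ℤ.NonZero m}} → (∀ n → Z (⟪ m ⟫ * r ^ n)) → Z r
  bounded-powers-Z m r = go m (<-wellFounded ℤ.∣ m ∣)
    where
    go : ∀ m → Acc ℕ._<_ ℤ.∣ m ∣ → .{{_ : ℤ.NonZero m}} → (∀ n → Z (⟪ m ⟫ * r ^ n)) → Z r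
    go m (acc rec) zs with den-bezout r | ↧ₙ r ℕₚ.≟ 1
    ... | _ | yes e = den≡1⇒Z r e
    ... | u , v , zu , zv , eq | no q≢1 = go k (rec k<m) {{k≢0}} zs′
      where
      q = ⟪ ↧ r ⟫
      M = ⟪ m ⟫
      lem₁ : ∀ M u v r q → M * ((u * r + v) * q) ≡ (u * (M * (r * 1ℚ)) + v * (M * 1ℚ)) * q
      lem₁ = solve-∀ ℚ-acr
      zk = zu ⊗ zs 1 ⊕ zv ⊗ zs 0
      k = Z.value zk
      m≡ : M ≡ ⟪ k ⟫ * q
      m≡ = trans (trans (sym (*-identityʳ M)) (cong (M *_) (sym eq)))
             (trans (lem₁ M u v r q) (cong (_* q) (Z.equality zk)))
      ∣m∣≡ : ℤ.∣ m ∣ ≡ ℤ.∣ k ∣ ℕ.* ↧ₙ r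
      ∣m∣≡ = ∣∣-of-Z* m (↧ₙ r) k m≡
      k≢0 : ℤ.NonZero k
      k≢0 = ℕₚ.m*n≢0⇒m≢0 ℤ.∣ k ∣ {{subst ℕ.NonZero ∣m∣≡ (ℕ.≢-nonZero (ℕ.≢-nonZero⁻¹ ℤ.∣ m ∣))}}
      k<m : ℤ.∣ k ∣ ℕ.< ℤ.∣ m ∣
      k<m = subst (ℤ.∣ k ∣ ℕ.<_) (sym ∣m∣≡) (ℕₚ.m<m*n ℤ.∣ k ∣ (↧ₙ r) {{k≢0}} (ℕₚ.≤∧≢⇒< (s≤s z≤n) (λ e → q≢1 (sym e))))
      lem₂ : ∀ k u v r q t → u * ((k * q) * (r * t)) + v * ((k * q) * t) ≡ k * t * ((u * r + v) * q)
      lem₂ = solve-∀ ℚ-acr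
      zs′ : ∀ n → Z (⟪ k ⟫ * r ^ n)
      zs′ n = subst Z (trans (cong (λ x → u * (x * r ^ suc n) + v * (x * r ^ n)) m≡)
                (trans (lem₂ ⟪ k ⟫ u v r q (r ^ n)) (trans (cong (⟪ k ⟫ * r ^ n *_) eq) (*-identityʳ (⟪ k ⟫ * r ^ n)))))
                (zu ⊗ zs (suc n) ⊕ zv ⊗ zs n)

  mutual
    -- Tests whether all coefficients of the Horner normal form are integers, which suffices for
    -- integral values at integral arguments.
    integralᴴ : ∀ {n} → HNF (suc n) → Bool
    integralᴴ ∅         = true
    integralᴴ (p *x+ c) = integralᴴ p ∧ integralᴺ c

    integralᴺ : ∀ {n} → Normal n → Bool
    integralᴺ (conN c)  = ↧ₙ c ≡ᵇ 1
    integralᴺ (polyN p) = integralᴴ p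

  0∈Z : Z 0ℚ
  0∈Z = _ , sym ⟪0⟫≡0

  mutual
    integralᴴ-Z : ∀ {n} (p : HNF (suc n)) → T (integralᴴ p) → ∀ {ρ} → All Z ρ → Z (⟦ p ⟧H ρ)
    integralᴴ-Z ∅         _  _        = 0∈Z
    integralᴴ-Z (p *x+ c) ok (z ∷ zs) =
      let okp , okc = Equivalence.to T-∧ ok in
      integralᴴ-Z p okp (z ∷ zs) ⊗ z ⊕ integralᴺ-Z c okc zs

    integralᴺ-Z : ∀ {n} (p : Normal n) → T (integralᴺ p) → ∀ {ρ} → All Z ρ → Z (⟦ p ⟧N ρ)
    integralᴺ-Z (conN c)  ok _  = den≡1⇒Z c (ℕₚ.≡ᵇ⇒≡ (↧ₙ c) 1 ok)
    integralᴺ-Z (polyN p) ok zs = integralᴴ-Z p ok zs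

  vars : ∀ {n} → Vec (Polynomial n) n
  vars = tabulate var

  opaque
    -- The halves and quarters occurring in the expression f cancel after expansion.
    poly-Z : ∀ {n} (f : Vec (Polynomial n) n → Polynomial n) → {T (integralᴺ (normalise (f vars)))} →
             ∀ {ρ} → All Z ρ → Z (⟦ f vars ⟧ ρ)
    poly-Z f {ok} {ρ} zs = subst Z (correct (f vars) ρ) (integralᴺ-Z (normalise (f vars)) ok zs)

    Z-clash : ∀ {r} → Z r → Z (r - ½) → ⊥
    Z-clash {r} zr zr-½ = ½∉Z (subst Z (lem r) (zr ⊖ zr-½))
      where
      lem : ∀ r → r - (r - ½) ≡ ½
      lem = solve-∀ ℚ-acr

  -- If f - ½ has integer coefficients, f takes values in ½ + ℤ at integers and cannot be integral.
  -- Quantities with a smaller fractional part, such as a quarter or an eighth, are multiplied by a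
  -- power of 2 beforehand.
  clash : ∀ {n a} {A : Set a} (f : Vec (Polynomial n) n → Polynomial n) → {T (integralᴺ (normalise (f vars :- con ½)))} →
          ∀ {ρ} → All Z ρ → Z (⟦ f vars ⟧ ρ) → A
  clash f {ok} zs z = ⊥-elim (Z-clash z (poly-Z (λ xs → f xs :- con ½) {ok} zs))

  ¼ 3ℚ 4ℚ : ℚ
  ¼ = + 1 / 4
  3ℚ = + 3 / 1
  4ℚ = + 4 / 1


open Integers

-- Congruences modulo powers of 2 and the five lattices

module Congruences where
  open import Data.Rational.Base hiding (NonZero)
  open import Data.Rational.Properties using (↥p/↧p≡p)

  -- Instantiated both with rational numbers and with reified polynomials.
  module Forms {A : Set} (_⊞_ _⊠_ : A → A → A) (⊟_ : A → A) (⌜_⌝ : ℚ → A) where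
    infixl 6 _⊞′_ _⊟′_
    infixl 7 _⊠′_
    private
      _⊞′_ _⊟′_ _⊠′_ : A → A → A
      x ⊞′ y = x ⊞ y
      x ⊟′ y = x ⊞ (⊟ y)
      x ⊠′ y = x ⊠ y

    ev od hf qr : A → A
    ev x = ⌜ 2ℚ ⌝ ⊠′ x
    od x = ⌜ 2ℚ ⌝ ⊠′ x ⊞′ ⌜ 1ℚ ⌝
    hf x = ⌜ ½ ⌝ ⊠′ x
    qr x = ⌜ ¼ ⌝ ⊠′ x

    δ : A → A → A
    δ β γ = β ⊠′ β ⊞′ γ ⊠′ γ

    -- The relative norm to ℚ(√d) is N₀ + N₁ √d = N₋ + 2 N₁ ω with ω = (1 + √d)/2. For d ≡ 1 (mod 4)
    -- it is therefore integral exactly when N₋ and 2 N₁ are integers.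
    N₀ N₁ N₋ : A → A → A → (e f g h : A) → A
    N₀ α β γ e f g h = e ⊠′ e ⊞′ δ β γ ⊠′ (f ⊠′ f) ⊟′ α ⊠′ δ β γ ⊠′ (g ⊠′ g ⊞′ h ⊠′ h)
    N₁ α β γ e f g h = ⌜ 2ℚ ⌝ ⊠′ (e ⊠′ f) ⊟′ α ⊠′ (β ⊠′ (g ⊠′ g ⊟′ h ⊠′ h) ⊞′ ⌜ 2ℚ ⌝ ⊠′ γ ⊠′ (g ⊠′ h))
    N₋ α β γ e f g h = N₀ α β γ e f g h ⊟′ N₁ α β γ e f g h

    -- `W` times √d is the product of 2 g z + 2 h w and its image under σ.
    W : A → A → A → (g h : A) → A
    W α β γ g h = α ⊠′ (γ ⊠′ ((⌜ 2ℚ ⌝ ⊠′ g) ⊠′ (⌜ 2ℚ ⌝ ⊠′ g) ⊟′ (⌜ 2ℚ ⌝ ⊠′ h) ⊠′ (⌜ 2ℚ ⌝ ⊠′ h)) ⊟′ ⌜ 2ℚ ⌝ ⊠′ β ⊠′ ((⌜ 2ℚ ⌝ ⊠′ g) ⊠′ (⌜ 2ℚ ⌝ ⊠′ h)))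

    K-norm : A → (p q : A) → A
    K-norm δ p q = hf p ⊠′ hf p ⊟′ δ ⊠′ (hf q ⊠′ hf q)

    tri : A → A
    tri x = ⌜ ½ ⌝ ⊠′ (x ⊠′ x ⊞′ x)

  module F = Forms _+_ _*_ -_ (λ q → q)
  module P {n : ℕ} = Forms {Polynomial n} _:+_ _:*_ :-_ con

  halve : ∀ {s} → Z s → Z (½ * F.ev s)
  halve z = poly-Z (λ { (p ∷ []) → P.hf (P.ev p) }) (z ∷ [])

  Z-via : ∀ {x y} → Z x → Z (y - x) → Z y
  Z-via {x} {y} zx zd = subst Z (lem x y) (zx ⊕ zd)
    where
    lem : ∀ x y → x + (y - x) ≡ y
    lem = solve-∀ ℚ-acr

  opaque
    -- The norm is (P² - δ Q²)/4 with δ ≡ 1 (mod 4); for P and Q of different parity the numerator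
    -- is odd.
    K-integer-odd : ∀ {k P Q} → Z k → Z ((½ * P) * (½ * P) - (4ℚ * k + 1ℚ) * ((½ * Q) * (½ * Q))) →
                    Parity P → Parity Q → Z (½ * P - ½ * Q)
    K-integer-odd zk n (even p) (even q) = poly-Z (λ { (p ∷ q ∷ []) → P.hf (P.ev p) :- P.hf (P.ev q) }) (p ∷ q ∷ [])
    K-integer-odd zk n (odd p)  (odd q)  = poly-Z (λ { (p ∷ q ∷ []) → P.hf (P.od p) :- P.hf (P.od q) }) (p ∷ q ∷ [])
    K-integer-odd zk n (even p) (odd q)  =
      clash (λ { (k ∷ p ∷ q ∷ []) → con 2ℚ :* P.K-norm (con 4ℚ :* k :+ con 1ℚ) (P.ev p) (P.od q) }) (zk ∷ p ∷ q ∷ []) (2∈Z ⊗ n)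
    K-integer-odd zk n (odd p) (even q)  =
      clash (λ { (k ∷ p ∷ q ∷ []) → con 2ℚ :* P.K-norm (con 4ℚ :* k :+ con 1ℚ) (P.od p) (P.ev q) }) (zk ∷ p ∷ q ∷ []) (2∈Z ⊗ n)

    K-integer-even : ∀ {k P Q} → Z k → Z ((½ * P) * (½ * P) - (4ℚ * k + 2ℚ) * ((½ * Q) * (½ * Q))) →
                     Parity P → Parity Q → Z (½ * P) × Z (½ * Q)
    K-integer-even zk n (even p) (even q) = halve p , halve q
    K-integer-even zk n (even p) (odd q)  =
      clash (λ { (k ∷ p ∷ q ∷ []) → P.K-norm (con 4ℚ :* k :+ con 2ℚ) (P.ev p) (P.od q) }) (zk ∷ p ∷ q ∷ []) n
    K-integer-even zk n (odd p) (even q)  =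
      clash (λ { (k ∷ p ∷ q ∷ []) → con 2ℚ :* P.K-norm (con 4ℚ :* k :+ con 2ℚ) (P.od p) (P.ev q) }) (zk ∷ p ∷ q ∷ []) (2∈Z ⊗ n)
    K-integer-even zk n (odd p) (odd q)   =
      clash (λ { (k ∷ p ∷ q ∷ []) → con 2ℚ :* P.K-norm (con 4ℚ :* k :+ con 2ℚ) (P.od p) (P.od q) }) (zk ∷ p ∷ q ∷ []) (2∈Z ⊗ n)

  -- Here a, b₀ and c₀ are odd, so d ≡ 2 (mod 4) and the integers of ℚ(√d) are ℤ[√d]. The
  -- denominator 4 of g and h is removed in two rounds: `plane` leaves 2, and `lattice` treats all
  -- four coordinates with denominator 2.
  module Case₁ {a b c : ℚ} (za : Z a) (zb : Z b) (zc : Z c) where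

    private
      N₀ N₁ : ∀ {n} (a b c e f g h : Polynomial n) → Polynomial n
      N₀ a b c = P.N₀ (P.od a) (P.od b) (P.od c)
      N₁ a b c = P.N₁ (P.od a) (P.od b) (P.od c)

    opaque
      plane : ∀ {G H} → Z (F.N₁ (F.od a) (F.od b) (F.od c) 0ℚ 0ℚ (2ℚ * (¼ * G)) (2ℚ * (¼ * H))) →
              Parity G → Parity H → Z (½ * G) × Z (½ * H)
      plane n (even g) (even h) = halve g , halve h
      plane n (even g) (odd h) = clash
        (λ { (a ∷ b ∷ c ∷ g ∷ h ∷ []) → con 2ℚ :* N₁ a b c (con 0ℚ) (con 0ℚ) (con 2ℚ :* P.qr (P.ev g)) (con 2ℚ :* P.qr (P.od h)) })
        (za ∷ zb ∷ zc ∷ g ∷ h ∷ []) (2∈Z ⊗ n)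
      plane n (odd g) (even h) = clash
        (λ { (a ∷ b ∷ c ∷ g ∷ h ∷ []) → con 2ℚ :* N₁ a b c (con 0ℚ) (con 0ℚ) (con 2ℚ :* P.qr (P.od g)) (con 2ℚ :* P.qr (P.ev h)) })
        (za ∷ zb ∷ zc ∷ g ∷ h ∷ []) (2∈Z ⊗ n)
      plane n (odd g) (odd h) = clash
        (λ { (a ∷ b ∷ c ∷ g ∷ h ∷ []) → N₁ a b c (con 0ℚ) (con 0ℚ) (con 2ℚ :* P.qr (P.od g)) (con 2ℚ :* P.qr (P.od h)) })
        (za ∷ zb ∷ zc ∷ g ∷ h ∷ []) n

      lattice : ∀ {E F G H} → Z E → Z F →
        Z (F.N₀ (F.od a) (F.od b) (F.od c) (½ * E) (½ * F) (½ * G) (½ * H)) →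
        Z (F.N₁ (F.od a) (F.od b) (F.od c) (½ * E) (½ * F) (½ * G) (½ * H)) →
        Parity E → Parity F → Parity G → Parity H → Z (½ * E) × Z (½ * F) × Z (½ * G) × Z (½ * H)
      lattice zE zF n₀ n₁ (even e) (even f) (even g) (even h) = halve e , halve f , halve g , halve h
      lattice zE zF n₀ n₁ _ _ (even g) (odd h) = clash
        (λ { (a ∷ b ∷ c ∷ e ∷ f ∷ g ∷ h ∷ []) → con 2ℚ :* N₁ a b c (P.hf e) (P.hf f) (P.hf (P.ev g)) (P.hf (P.od h)) })
        (za ∷ zb ∷ zc ∷ zE ∷ zF ∷ g ∷ h ∷ []) (2∈Z ⊗ n₁)
      lattice zE zF n₀ n₁ _ _ (odd g) (even h) = clash
        (λ { (a ∷ b ∷ c ∷ e ∷ f ∷ g ∷ h ∷ []) → con 2ℚ :* N₁ a b c (P.hf e) (P.hf f) (P.hf (P.od g)) (P.hf (P.ev h)) })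
        (za ∷ zb ∷ zc ∷ zE ∷ zF ∷ g ∷ h ∷ []) (2∈Z ⊗ n₁)
      lattice zE zF n₀ n₁ (even e) _ (odd g) (odd h) = clash
        (λ { (a ∷ b ∷ c ∷ e ∷ f ∷ g ∷ h ∷ []) → N₁ a b c (P.hf (P.ev e)) (P.hf f) (P.hf (P.od g)) (P.hf (P.od h)) })
        (za ∷ zb ∷ zc ∷ e ∷ zF ∷ g ∷ h ∷ []) n₁
      lattice zE zF n₀ n₁ (odd e) (even f) (odd g) (odd h) = clash
        (λ { (a ∷ b ∷ c ∷ e ∷ f ∷ g ∷ h ∷ []) → N₁ a b c (P.hf (P.od e)) (P.hf (P.ev f)) (P.hf (P.od g)) (P.hf (P.od h)) })
        (za ∷ zb ∷ zc ∷ e ∷ f ∷ g ∷ h ∷ []) n₁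
      lattice zE zF n₀ n₁ (odd e) (odd f) (odd g) (odd h) = clash
        (λ { (a ∷ b ∷ c ∷ e ∷ f ∷ g ∷ h ∷ []) → con 2ℚ :* N₀ a b c (P.hf (P.od e)) (P.hf (P.od f)) (P.hf (P.od g)) (P.hf (P.od h)) })
        (za ∷ zb ∷ zc ∷ e ∷ f ∷ g ∷ h ∷ []) (2∈Z ⊗ n₀)
      lattice zE zF n₀ n₁ (odd e) _ (even g) (even h) = clash
        (λ { (a ∷ b ∷ c ∷ e ∷ f ∷ g ∷ h ∷ []) → con 2ℚ :* N₀ a b c (P.hf (P.od e)) (P.hf f) (P.hf (P.ev g)) (P.hf (P.ev h)) })
        (za ∷ zb ∷ zc ∷ e ∷ zF ∷ g ∷ h ∷ []) (2∈Z ⊗ n₀)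
      lattice zE zF n₀ n₁ (even e) (odd f) (even g) (even h) = clash
        (λ { (a ∷ b ∷ c ∷ e ∷ f ∷ g ∷ h ∷ []) → N₀ a b c (P.hf (P.ev e)) (P.hf (P.od f)) (P.hf (P.ev g)) (P.hf (P.ev h)) })
        (za ∷ zb ∷ zc ∷ e ∷ f ∷ g ∷ h ∷ []) n₀

  module Case₂ {a b c : ℚ} (za : Z a) (zb : Z b) (zc : Z c) where

    private
      W : ∀ {n} (a b c g h : Polynomial n) → Polynomial n
      W a b c g h = P.W (P.od a) (P.od b) (P.ev c) (P.qr g) (P.qr h)

      2N₁ N₋ : ∀ {n} (a b c e k g h : Polynomial n) → Polynomial n
      2N₁ a b c e k g h = con 2ℚ :* P.N₁ (P.od a) (P.od b) (P.ev c) (P.qr e) (P.qr (e :+ P.ev k)) (P.qr g) (P.qr h)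
      N₋ a b c e k g h = P.N₋ (P.od a) (P.od b) (P.ev c) (P.qr e) (P.qr (e :+ P.ev k)) (P.qr g) (P.qr h)

    opaque
      -- The second round: 4 e, 4 g and 4 h are already known to be even, and the parities of their
      -- halves and of k are compared. Only the all-even pattern survives, and the conclusion lists
      -- the coordinates in the basis 1, (1 + √d)/2, z, w.
      both-even : ∀ {e k g h} → Z e →
        Z (2ℚ * F.N₁ (F.od a) (F.od b) (F.ev c) (F.qr (F.ev e)) (F.qr (F.ev e + F.ev k)) (F.qr (F.ev g)) (F.qr (F.ev h))) →
        Z (F.N₋ (F.od a) (F.od b) (F.ev c) (F.qr (F.ev e)) (F.qr (F.ev e + F.ev k)) (F.qr (F.ev g)) (F.qr (F.ev h))) →
        Parity k → Parity g → Parity h →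
        Z (F.qr (F.ev e) - F.qr (F.ev e + F.ev k)) × Z (2ℚ * F.qr (F.ev e + F.ev k)) × Z (F.qr (F.ev g)) × Z (F.qr (F.ev h))
      both-even ze n₁ n₋ (even k) (even g) (odd h) = clash
        (λ { (a ∷ b ∷ c ∷ e ∷ k ∷ g ∷ h ∷ []) → 2N₁ a b c (P.ev e) (P.ev k) (P.ev (P.ev g)) (P.ev (P.od h)) })
        (za ∷ zb ∷ zc ∷ ze ∷ k ∷ g ∷ h ∷ []) n₁
      both-even ze n₁ n₋ (even k) (odd g) (even h) = clash
        (λ { (a ∷ b ∷ c ∷ e ∷ k ∷ g ∷ h ∷ []) → 2N₁ a b c (P.ev e) (P.ev k) (P.ev (P.od g)) (P.ev (P.ev h)) })
        (za ∷ zb ∷ zc ∷ ze ∷ k ∷ g ∷ h ∷ []) n₁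
      both-even ze n₁ n₋ (odd k) (even g) (odd h) = clash
        (λ { (a ∷ b ∷ c ∷ e ∷ k ∷ g ∷ h ∷ []) → 2N₁ a b c (P.ev e) (P.od k) (P.ev (P.ev g)) (P.ev (P.od h)) })
        (za ∷ zb ∷ zc ∷ ze ∷ k ∷ g ∷ h ∷ []) n₁
      both-even ze n₁ n₋ (odd k) (odd g) (even h) = clash
        (λ { (a ∷ b ∷ c ∷ e ∷ k ∷ g ∷ h ∷ []) → 2N₁ a b c (P.ev e) (P.od k) (P.ev (P.od g)) (P.ev (P.ev h)) })
        (za ∷ zb ∷ zc ∷ ze ∷ k ∷ g ∷ h ∷ []) n₁
      both-even ze n₁ n₋ (even k) (odd g) (odd h) = clash
        (λ { (a ∷ b ∷ c ∷ e ∷ k ∷ g ∷ h ∷ []) → N₋ a b c (P.ev e) (P.ev k) (P.ev (P.od g)) (P.ev (P.od h)) })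
        (za ∷ zb ∷ zc ∷ ze ∷ k ∷ g ∷ h ∷ []) n₋
      both-even ze n₁ n₋ (odd k) (odd g) (odd h) = clash
        (λ { (a ∷ b ∷ c ∷ e ∷ k ∷ g ∷ h ∷ []) → con 2ℚ :* N₋ a b c (P.ev e) (P.od k) (P.ev (P.od g)) (P.ev (P.od h)) })
        (za ∷ zb ∷ zc ∷ ze ∷ k ∷ g ∷ h ∷ []) (2∈Z ⊗ n₋)
      both-even ze n₁ n₋ (odd k) (even g) (even h) = clash
        (λ { (a ∷ b ∷ c ∷ e ∷ k ∷ g ∷ h ∷ []) → con 2ℚ :* N₋ a b c (P.ev e) (P.od k) (P.ev (P.ev g)) (P.ev (P.ev h)) })
        (za ∷ zb ∷ zc ∷ ze ∷ k ∷ g ∷ h ∷ []) (2∈Z ⊗ n₋)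
      both-even ze n₁ n₋ (even k) (even g) (even h) =
        poly-Z (λ { (a ∷ b ∷ c ∷ e ∷ k ∷ g ∷ h ∷ []) → P.qr (P.ev e) :- P.qr (P.ev e :+ P.ev (P.ev k)) }) (za ∷ zb ∷ zc ∷ ze ∷ k ∷ g ∷ h ∷ []) ,
        poly-Z (λ { (a ∷ b ∷ c ∷ e ∷ k ∷ g ∷ h ∷ []) → con 2ℚ :* P.qr (P.ev e :+ P.ev (P.ev k)) }) (za ∷ zb ∷ zc ∷ ze ∷ k ∷ g ∷ h ∷ []) ,
        poly-Z (λ { (a ∷ b ∷ c ∷ e ∷ k ∷ g ∷ h ∷ []) → P.qr (P.ev (P.ev g)) }) (za ∷ zb ∷ zc ∷ ze ∷ k ∷ g ∷ h ∷ []) ,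
        poly-Z (λ { (a ∷ b ∷ c ∷ e ∷ k ∷ g ∷ h ∷ []) → P.qr (P.ev (P.ev h)) }) (za ∷ zb ∷ zc ∷ ze ∷ k ∷ g ∷ h ∷ [])

      lattice : ∀ {E k G H} → Z E → Z k →
        Z (F.W (F.od a) (F.od b) (F.ev c) (F.qr G) (F.qr H)) →
        Z (2ℚ * F.N₁ (F.od a) (F.od b) (F.ev c) (F.qr E) (F.qr (E + F.ev k)) (F.qr G) (F.qr H)) →
        Z (F.N₋ (F.od a) (F.od b) (F.ev c) (F.qr E) (F.qr (E + F.ev k)) (F.qr G) (F.qr H)) →
        Parity E → Parity G → Parity H →
        Z (F.qr E - F.qr (E + F.ev k)) × Z (2ℚ * F.qr (E + F.ev k)) × Z (F.qr G) × Z (F.qr H)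
      lattice zE zk w n₁ n₋ _ (even g) (odd h) = clash
        (λ { (a ∷ b ∷ c ∷ e ∷ k ∷ g ∷ h ∷ []) → con 2ℚ :* con 2ℚ :* (2N₁ a b c e k (P.ev g) (P.od h)) })
        (za ∷ zb ∷ zc ∷ zE ∷ zk ∷ g ∷ h ∷ []) (2∈Z ⊗ 2∈Z ⊗ n₁)
      lattice zE zk w n₁ n₋ _ (odd g) (even h) = clash
        (λ { (a ∷ b ∷ c ∷ e ∷ k ∷ g ∷ h ∷ []) → con 2ℚ :* con 2ℚ :* (2N₁ a b c e k (P.od g) (P.ev h)) })
        (za ∷ zb ∷ zc ∷ zE ∷ zk ∷ g ∷ h ∷ []) (2∈Z ⊗ 2∈Z ⊗ n₁)
      lattice zE zk w n₁ n₋ _ (odd g) (odd h) = clash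
        (λ { (a ∷ b ∷ c ∷ g ∷ h ∷ []) → W a b c (P.od g) (P.od h) })
        (za ∷ zb ∷ zc ∷ g ∷ h ∷ []) w
      lattice zE zk w n₁ n₋ (odd e) (even g) (even h) = clash
        (λ { (a ∷ b ∷ c ∷ e ∷ k ∷ g ∷ h ∷ []) → con 2ℚ :* (2N₁ a b c (P.od e) k (P.ev g) (P.ev h)) })
        (za ∷ zb ∷ zc ∷ e ∷ zk ∷ g ∷ h ∷ []) (2∈Z ⊗ n₁)
      lattice zE zk w n₁ n₋ (even e) (even g) (even h) = both-even e n₁ n₋ (parity zk) (parity g) (parity h)

  module Case₃ {m b c : ℚ} (zm : Z m) (zb : Z b) (zc : Z c) where

    private
      zα : Z (3ℚ + 4ℚ * m - F.ev b)
      zα = poly-Z (λ { (m ∷ b ∷ []) → con 3ℚ :+ con 4ℚ :* m :- P.ev b }) (zm ∷ zb ∷ [])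

      zδ : Z (F.δ (F.ev b) (F.od c))
      zδ = poly-Z (λ { (b ∷ c ∷ []) → P.δ (P.ev b) (P.od c) }) (zb ∷ zc ∷ [])

      W : ∀ {n} (m b c g h : Polynomial n) → Polynomial n
      W m b c g h = P.W (con 3ℚ :+ con 4ℚ :* m :- P.ev b) (P.ev b) (P.od c) (P.qr g) (P.qr h)

      2N₁ N₋ : ∀ {n} (m b c e k g h : Polynomial n) → Polynomial n
      2N₁ m b c e k g h = con 2ℚ :* P.N₁ (con 3ℚ :+ con 4ℚ :* m :- P.ev b) (P.ev b) (P.od c) (P.qr e) (P.qr (e :+ P.ev k)) (P.qr g) (P.qr h)
      N₋ m b c e k g h = P.N₋ (con 3ℚ :+ con 4ℚ :* m :- P.ev b) (P.ev b) (P.od c) (P.qr e) (P.qr (e :+ P.ev k)) (P.qr g) (P.qr h)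

    opaque
      -- The plane lattice is now spanned by (z ± w)/2, so the halves of 4 g and 4 h need not be
      -- even themselves. Only the parity of their difference `l` matters.
      both-even : ∀ {e k g l} → Z e → Z g →
        Z (F.N₋ (3ℚ + 4ℚ * m - F.ev b) (F.ev b) (F.od c) (F.qr (F.ev e)) (F.qr (F.ev e + F.ev k)) (F.qr (F.ev g)) (F.qr (F.ev (g + l)))) →
        Parity k → Parity l →
        Z (F.qr (F.ev e) - F.qr (F.ev e + F.ev k)) × Z (2ℚ * F.qr (F.ev e + F.ev k)) × Z (F.qr (F.ev g) + F.qr (F.ev (g + l))) × Z (F.qr (F.ev g) - F.qr (F.ev (g + l)))
      both-even ze zg n₋ (even k) (even l) =
        poly-Z (λ { (m ∷ b ∷ c ∷ e ∷ k ∷ g ∷ l ∷ []) → P.qr (P.ev e) :- P.qr (P.ev e :+ P.ev (P.ev k)) }) (zm ∷ zb ∷ zc ∷ ze ∷ k ∷ zg ∷ l ∷ []) ,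
        poly-Z (λ { (m ∷ b ∷ c ∷ e ∷ k ∷ g ∷ l ∷ []) → con 2ℚ :* P.qr (P.ev e :+ P.ev (P.ev k)) }) (zm ∷ zb ∷ zc ∷ ze ∷ k ∷ zg ∷ l ∷ []) ,
        poly-Z (λ { (m ∷ b ∷ c ∷ e ∷ k ∷ g ∷ l ∷ []) → P.qr (P.ev g) :+ P.qr (P.ev (g :+ P.ev l)) }) (zm ∷ zb ∷ zc ∷ ze ∷ k ∷ zg ∷ l ∷ []) ,
        poly-Z (λ { (m ∷ b ∷ c ∷ e ∷ k ∷ g ∷ l ∷ []) → P.qr (P.ev g) :- P.qr (P.ev (g :+ P.ev l)) }) (zm ∷ zb ∷ zc ∷ ze ∷ k ∷ zg ∷ l ∷ [])
      both-even ze zg n₋ (even k) (odd l) = clash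
        (λ { (m ∷ b ∷ c ∷ e ∷ k ∷ g ∷ l ∷ []) → con 2ℚ :* N₋ m b c (P.ev e) (P.ev k) (P.ev g) (P.ev (g :+ P.od l)) })
        (zm ∷ zb ∷ zc ∷ ze ∷ k ∷ zg ∷ l ∷ []) (2∈Z ⊗ n₋)
      both-even ze zg n₋ (odd k) (even l) = clash
        (λ { (m ∷ b ∷ c ∷ e ∷ k ∷ g ∷ l ∷ []) → con 2ℚ :* N₋ m b c (P.ev e) (P.od k) (P.ev g) (P.ev (g :+ P.ev l)) })
        (zm ∷ zb ∷ zc ∷ ze ∷ k ∷ zg ∷ l ∷ []) (2∈Z ⊗ n₋)
      both-even ze zg n₋ (odd k) (odd l) = clash
        (λ { (m ∷ b ∷ c ∷ e ∷ k ∷ g ∷ l ∷ []) → N₋ m b c (P.ev e) (P.od k) (P.ev g) (P.ev (g :+ P.od l)) })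
        (zm ∷ zb ∷ zc ∷ ze ∷ k ∷ zg ∷ l ∷ []) (n₋)

      lattice : ∀ {E k G H} → Z E → Z k →
        Z (F.W (3ℚ + 4ℚ * m - F.ev b) (F.ev b) (F.od c) (F.qr G) (F.qr H)) →
        Z (2ℚ * F.N₁ (3ℚ + 4ℚ * m - F.ev b) (F.ev b) (F.od c) (F.qr E) (F.qr (E + F.ev k)) (F.qr G) (F.qr H)) →
        Z (F.N₋ (3ℚ + 4ℚ * m - F.ev b) (F.ev b) (F.od c) (F.qr E) (F.qr (E + F.ev k)) (F.qr G) (F.qr H)) →
        Parity E → Parity G → Parity H →
        Z (F.qr E - F.qr (E + F.ev k)) × Z (2ℚ * F.qr (E + F.ev k)) × Z (F.qr G + F.qr H) × Z (F.qr G - F.qr H)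
      lattice zE zk w n₁ n₋ _ (even g) (odd h) = clash
        (λ { (m ∷ b ∷ c ∷ g ∷ h ∷ []) → con 2ℚ :* W m b c (P.ev g) (P.od h) })
        (zm ∷ zb ∷ zc ∷ g ∷ h ∷ []) (2∈Z ⊗ w)
      lattice zE zk w n₁ n₋ _ (odd g) (even h) = clash
        (λ { (m ∷ b ∷ c ∷ g ∷ h ∷ []) → con 2ℚ :* W m b c (P.od g) (P.ev h) })
        (zm ∷ zb ∷ zc ∷ g ∷ h ∷ []) (2∈Z ⊗ w)
      lattice zE zk w n₁ n₋ (even e) (odd g) (odd h) = clash
        (λ { (m ∷ b ∷ c ∷ e ∷ k ∷ g ∷ h ∷ []) → con 2ℚ :* (2N₁ m b c (P.ev e) k (P.od g) (P.od h)) })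
        (zm ∷ zb ∷ zc ∷ e ∷ zk ∷ g ∷ h ∷ []) (2∈Z ⊗ n₁)
      -- The sum 2 N₋ + 2 N₁ is 2 N₀. Squares of odd numbers over 8 contribute triangular numbers,
      -- which the correction removes; what remains is (1 - a - b₀)/4 up to integers, and this is ½
      -- modulo 1 because a + b₀ ≡ 3 (mod 4).
      lattice zE zk w n₁ n₋ (odd e) (odd g) (odd h) = clash
        (λ { (m ∷ b ∷ c ∷ e ∷ k ∷ g ∷ h ∷ []) → con 2ℚ :* N₋ m b c (P.od e) k (P.od g) (P.od h) :+ 2N₁ m b c (P.od e) k (P.od g) (P.od h)
          :- P.tri e :- P.δ (P.ev b) (P.od c) :* P.tri (e :+ k) :+ (con 3ℚ :+ con 4ℚ :* m :- P.ev b) :* P.δ (P.ev b) (P.od c) :* (P.tri g :+ P.tri h) :- P.tri b :- P.tri c })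
        (zm ∷ zb ∷ zc ∷ e ∷ zk ∷ g ∷ h ∷ []) (2∈Z ⊗ n₋ ⊕ n₁ ⊖ tri∈Z e ⊖ zδ ⊗ tri∈Z (e ⊕ zk) ⊕ zα ⊗ zδ ⊗ (tri∈Z g ⊕ tri∈Z h) ⊖ tri∈Z zb ⊖ tri∈Z zc)
      lattice zE zk w n₁ n₋ (odd e) (even g) (even h) = clash
        (λ { (m ∷ b ∷ c ∷ e ∷ k ∷ g ∷ h ∷ []) → con 2ℚ :* (2N₁ m b c (P.od e) k (P.ev g) (P.ev h)) })
        (zm ∷ zb ∷ zc ∷ e ∷ zk ∷ g ∷ h ∷ []) (2∈Z ⊗ n₁)
      lattice {k = k} zE zk w n₁ n₋ (even {e} ze) (even {g} zg) (even {h} zh) =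
        subst (λ h → Z (F.qr (F.ev e) - F.qr (F.ev e + F.ev k)) × Z (2ℚ * F.qr (F.ev e + F.ev k)) × Z (F.qr (F.ev g) + F.qr (F.ev h)) × Z (F.qr (F.ev g) - F.qr (F.ev h)))
          (lem g h) (both-even ze zg (subst (λ h → Z (F.N₋ (3ℚ + 4ℚ * m - F.ev b) (F.ev b) (F.od c) (F.qr (F.ev e)) (F.qr (F.ev e + F.ev k)) (F.qr (F.ev g)) (F.qr (F.ev h)))) (sym (lem g h)) n₋) (parity zk) (parity (zh ⊖ zg)))
        where
        lem : ∀ g h → g + (h - g) ≡ h
        lem = solve-∀ ℚ-acr

  module Case₄ {m b c : ℚ} (zm : Z m) (zb : Z b) (zc : Z c) where

    private
      W : ∀ {n} (m b c g h : Polynomial n) → Polynomial n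
      W m b c g h = P.W (P.od c :+ con 4ℚ :* m) (P.ev b) (P.od c) (P.qr g) (P.qr h)

      2N₁ N₋ : ∀ {n} (m b c e k g h : Polynomial n) → Polynomial n
      2N₁ m b c e k g h = con 2ℚ :* P.N₁ (P.od c :+ con 4ℚ :* m) (P.ev b) (P.od c) (P.qr e) (P.qr (e :+ P.ev k)) (P.qr g) (P.qr h)
      N₋ m b c e k g h = P.N₋ (P.od c :+ con 4ℚ :* m) (P.ev b) (P.od c) (P.qr e) (P.qr (e :+ P.ev k)) (P.qr g) (P.qr h)

    opaque
      lattice : ∀ {E k G H} → Z E → Z k →
        Z (F.W (F.od c + 4ℚ * m) (F.ev b) (F.od c) (F.qr G) (F.qr H)) →
        Z (2ℚ * F.N₁ (F.od c + 4ℚ * m) (F.ev b) (F.od c) (F.qr E) (F.qr (E + F.ev k)) (F.qr G) (F.qr H)) →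
        Z (F.N₋ (F.od c + 4ℚ * m) (F.ev b) (F.od c) (F.qr E) (F.qr (E + F.ev k)) (F.qr G) (F.qr H)) →
        Parity E → Parity G → Parity H →
        Z (F.qr E - F.qr (E + F.ev k) - F.qr G + F.qr H) × Z (2ℚ * F.qr (E + F.ev k) - 2ℚ * F.qr H) × Z (2ℚ * (F.qr G + F.qr H)) × Z (2ℚ * (F.qr G - F.qr H))
      lattice zE zk w n₁ n₋ _ (even g) (odd h) = clash
        (λ { (m ∷ b ∷ c ∷ g ∷ h ∷ []) → con 2ℚ :* W m b c (P.ev g) (P.od h) })
        (zm ∷ zb ∷ zc ∷ g ∷ h ∷ []) (2∈Z ⊗ w)
      lattice zE zk w n₁ n₋ _ (odd g) (even h) = clash
        (λ { (m ∷ b ∷ c ∷ g ∷ h ∷ []) → con 2ℚ :* W m b c (P.od g) (P.ev h) })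
        (zm ∷ zb ∷ zc ∷ g ∷ h ∷ []) (2∈Z ⊗ w)
      lattice zE zk w n₁ n₋ (even e) (odd g) (odd h) = clash
        (λ { (m ∷ b ∷ c ∷ e ∷ k ∷ g ∷ h ∷ []) → con 2ℚ :* (2N₁ m b c (P.ev e) k (P.od g) (P.od h)) })
        (zm ∷ zb ∷ zc ∷ e ∷ zk ∷ g ∷ h ∷ []) (2∈Z ⊗ n₁)
      lattice zE zk w n₁ n₋ (odd e) (even g) (even h) = clash
        (λ { (m ∷ b ∷ c ∷ e ∷ k ∷ g ∷ h ∷ []) → con 2ℚ :* (2N₁ m b c (P.od e) k (P.ev g) (P.ev h)) })
        (zm ∷ zb ∷ zc ∷ e ∷ zk ∷ g ∷ h ∷ []) (2∈Z ⊗ n₁)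
      -- Here odd numerators over 4 do occur. The condition on e - f - g + h comes from its
      -- congruence to 2 N₁ modulo ℤ; in the all-even pattern it is congruent to 2 N₋ corrected by
      -- triangular numbers. The other three coordinates are integral by parity alone.
      lattice zE zk w n₁ n₋ (odd e) (odd g) (odd h) =
        Z-via (n₁)
          (poly-Z (λ { (m ∷ b ∷ c ∷ e ∷ k ∷ g ∷ h ∷ []) → P.qr (P.od e) :- P.qr (P.od e :+ P.ev k) :- P.qr (P.od g) :+ P.qr (P.od h) :- (2N₁ m b c (P.od e) k (P.od g) (P.od h)) }) (zm ∷ zb ∷ zc ∷ e ∷ zk ∷ g ∷ h ∷ [])) ,
        poly-Z (λ { (m ∷ b ∷ c ∷ e ∷ k ∷ g ∷ h ∷ []) → con 2ℚ :* P.qr (P.od e :+ P.ev k) :- con 2ℚ :* P.qr (P.od h) }) (zm ∷ zb ∷ zc ∷ e ∷ zk ∷ g ∷ h ∷ []) ,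
        poly-Z (λ { (m ∷ b ∷ c ∷ e ∷ k ∷ g ∷ h ∷ []) → con 2ℚ :* (P.qr (P.od g) :+ P.qr (P.od h)) }) (zm ∷ zb ∷ zc ∷ e ∷ zk ∷ g ∷ h ∷ []) ,
        poly-Z (λ { (m ∷ b ∷ c ∷ e ∷ k ∷ g ∷ h ∷ []) → con 2ℚ :* (P.qr (P.od g) :- P.qr (P.od h)) }) (zm ∷ zb ∷ zc ∷ e ∷ zk ∷ g ∷ h ∷ [])
      lattice zE zk w n₁ n₋ (even e) (even g) (even h) =
        Z-via (2∈Z ⊗ n₋ ⊖ tri∈Z zk ⊕ tri∈Z g ⊕ tri∈Z h)
          (poly-Z (λ { (m ∷ b ∷ c ∷ e ∷ k ∷ g ∷ h ∷ []) → P.qr (P.ev e) :- P.qr (P.ev e :+ P.ev k) :- P.qr (P.ev g) :+ P.qr (P.ev h) :- (con 2ℚ :* N₋ m b c (P.ev e) k (P.ev g) (P.ev h) :- P.tri k :+ P.tri g :+ P.tri h) }) (zm ∷ zb ∷ zc ∷ e ∷ zk ∷ g ∷ h ∷ [])) ,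
        poly-Z (λ { (m ∷ b ∷ c ∷ e ∷ k ∷ g ∷ h ∷ []) → con 2ℚ :* P.qr (P.ev e :+ P.ev k) :- con 2ℚ :* P.qr (P.ev h) }) (zm ∷ zb ∷ zc ∷ e ∷ zk ∷ g ∷ h ∷ []) ,
        poly-Z (λ { (m ∷ b ∷ c ∷ e ∷ k ∷ g ∷ h ∷ []) → con 2ℚ :* (P.qr (P.ev g) :+ P.qr (P.ev h)) }) (zm ∷ zb ∷ zc ∷ e ∷ zk ∷ g ∷ h ∷ []) ,
        poly-Z (λ { (m ∷ b ∷ c ∷ e ∷ k ∷ g ∷ h ∷ []) → con 2ℚ :* (P.qr (P.ev g) :- P.qr (P.ev h)) }) (zm ∷ zb ∷ zc ∷ e ∷ zk ∷ g ∷ h ∷ [])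

  Even Odd : ℚ → Set
  Even r = ∃[ s ] Z s × r ≡ F.ev s
  Odd  r = ∃[ s ] Z s × r ≡ F.od s

  opaque
    unfolding ⟪_⟫

    ⟪3⟫≡3 : ⟪ + 3 ⟫ ≡ 3ℚ
    ⟪3⟫≡3 = refl

    ⟪4⟫≡4 : ⟪ + 4 ⟫ ≡ 4ℚ
    ⟪4⟫≡4 = refl

  opaque
    Even∧Odd⇒⊥ : ∀ {r} → Even r → Odd r → ⊥
    Even∧Odd⇒⊥ {r} (s , zs , p) (t , zt , q) = ½∉Z (subst Z (trans (cong (λ r → ½ * r - t) (trans (sym p) q)) (lem₂ t)) (subst Z (lem₁ s t) (zs ⊖ zt)))
      where
      lem₁ : ∀ s t → s - t ≡ ½ * (2ℚ * s) - t
      lem₁ = solve-∀ ℚ-acr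
      lem₂ : ∀ t → ½ * (2ℚ * t + 1ℚ) - t ≡ ½
      lem₂ = solve-∀ ℚ-acr

    ∣⇒Even : ∀ {i} → + 2 ℤ∣.∣ i → Even ⟪ i ⟫
    ∣⇒Even {i} (ℤ∣.divides q eq) = ⟪ q ⟫ , ⟪⟫∈Z q ,
      trans (cong ⟪_⟫ eq) (trans (⟪⟫-* q (+ 2)) (trans (cong (⟪ q ⟫ *_) ⟪2⟫≡2) (lem ⟪ q ⟫)))
      where
      lem : ∀ q → q * 2ℚ ≡ 2ℚ * q
      lem = solve-∀ ℚ-acr

    Even⇒∣ : ∀ {i} → Even ⟪ i ⟫ → + 2 ℤ∣.∣ i
    Even⇒∣ {i} (s , (k , eqs) , eq) = ℤ∣.divides k (⟪⟫-injective (trans eq (trans (cong (2ℚ *_) eqs) (trans (lem ⟪ k ⟫) (trans (cong (⟪ k ⟫ *_) (sym ⟪2⟫≡2)) (sym (⟪⟫-* k (+ 2))))))))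
      where
      lem : ∀ q → 2ℚ * q ≡ q * 2ℚ
      lem = solve-∀ ℚ-acr

    ¬∣⇒Odd : ∀ {i} → ¬ + 2 ℤ∣.∣ i → Odd ⟪ i ⟫
    ¬∣⇒Odd {i} ¬2∣i = view (parity (⟪⟫∈Z i)) refl
      where
      view : ∀ {r} → Parity r → r ≡ ⟪ i ⟫ → Odd ⟪ i ⟫
      view (even zs) eq = ⊥-elim (¬2∣i (Even⇒∣ (_ , zs , sym eq)))
      view (odd zs)  eq = _ , zs , sym eq

    Odd⇒¬∣ : ∀ {i} → Odd ⟪ i ⟫ → ¬ + 2 ℤ∣.∣ i
    Odd⇒¬∣ o 2∣i = Even∧Odd⇒⊥ (∣⇒Even 2∣i) o

    congruence : ∀ {i j} → i ≡ j [mod 4 ] → ∃[ m ] Z m × ⟪ i ⟫ ≡ ⟪ j ⟫ + 4ℚ * m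
    congruence {i} {j} (ℤ∣.divides q eq) = ⟪ q ⟫ , ⟪⟫∈Z q ,
      trans (lem ⟪ i ⟫ ⟪ j ⟫) (cong (λ t → ⟪ j ⟫ + t) (trans (sym (⟪⟫-minus i j)) (trans (cong ⟪_⟫ eq) (trans (⟪⟫-* q (+ 4)) (trans (cong (⟪ q ⟫ *_) ⟪4⟫≡4) (lem′ ⟪ q ⟫))))))
      where
      lem : ∀ i j → i ≡ j + (i - j)
      lem = solve-∀ ℚ-acr
      lem′ : ∀ q → q * 4ℚ ≡ 4ℚ * q
      lem′ = solve-∀ ℚ-acr

    od-δ : ∀ {β γ} → Even β → Odd γ → Odd (F.δ β γ)
    od-δ (b , zb , refl) (c , zc , refl) = _ , zb ⊗ (2∈Z ⊗ zb) ⊕ (zc ⊗ (2∈Z ⊗ zc ⊕ 2∈Z)) , lem b c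
      where
      lem : ∀ b c → (2ℚ * b) * (2ℚ * b) + (2ℚ * c + 1ℚ) * (2ℚ * c + 1ℚ) ≡ 2ℚ * (b * (2ℚ * b) + (c * (2ℚ * c + 2ℚ))) + 1ℚ
      lem = solve-∀ ℚ-acr

    od-δ′ : ∀ {β γ} → Odd β → Even γ → Odd (F.δ β γ)
    od-δ′ {β} {γ} ob eg = subst Odd (lem γ β) (od-δ eg ob)
      where
      lem : ∀ b c → b * b + c * c ≡ c * c + b * b
      lem = solve-∀ ℚ-acr

    od-od-δ : ∀ {β γ} → Odd β → Odd γ → Even (F.δ β γ)
    od-od-δ (b , zb , refl) (c , zc , refl) = _ , zb ⊗ (2∈Z ⊗ zb ⊕ 2∈Z) ⊕ (zc ⊗ (2∈Z ⊗ zc ⊕ 2∈Z)) ⊕ 1∈Z , lem b c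
      where
      lem : ∀ b c → (2ℚ * b + 1ℚ) * (2ℚ * b + 1ℚ) + (2ℚ * c + 1ℚ) * (2ℚ * c + 1ℚ) ≡ 2ℚ * (b * (2ℚ * b + 2ℚ) + (c * (2ℚ * c + 2ℚ)) + 1ℚ)
      lem = solve-∀ ℚ-acr

  neg-mkℚ : ∀ i n .(c : ℕC.Coprime ℤ.∣ i ∣ (suc n)) .(c′ : ℕC.Coprime ℤ.∣ ℤ.- i ∣ (suc n)) → - mkℚ i n c ≡ mkℚ (ℤ.- i) n c′
  neg-mkℚ (+ zero)  n c c′ = refl
  neg-mkℚ (+ suc _) n c c′ = refl
  neg-mkℚ -[1+ _ ]  n c c′ = refl

  -- The ceiling is the negative of the floor of the negated fraction; its numerator has to be
  -- exposed, since negation splits on the sign.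
  ceiling-mkℚ : ∀ i n .(c : ℕC.Coprime ℤ.∣ i ∣ (suc n)) → ceiling (mkℚ i n c) ≡ ℤ.- ((ℤ.- i) ℤDM./ (+ suc n))
  ceiling-mkℚ i n c = cong (λ p → ℤ.- floor p) (neg-mkℚ i n c (subst (λ j → ℕC.Coprime j (suc n)) (sym (ℤₚ.∣-i∣≡∣i∣ i)) (ℕC.recompute c)))

  /1≡ : ∀ i → i ℤDM./ (+ 1) ≡ i
  /1≡ i with i ℤDM.% (+ 1) | ℤDM.a≡a%n+[a/n]*n i (+ 1) | ℤDM.n%d<d i (+ 1)
  ... | zero | eq | _ = sym (trans eq (lem (i ℤDM./ (+ 1))))
    where
    lem : ∀ q → 0ℤ ℤ.+ q ℤ.* 1ℤ ≡ q
    lem = ℤSolver.solve-∀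
  ... | suc _ | _ | s≤s ()

  odd/2≡ : ∀ i q → i ≡ 1ℤ ℤ.+ q ℤ.* + 2 → i ℤDM./ (+ 2) ≡ q
  odd/2≡ i q i≡ with i ℤDM.% (+ 2) | ℤDM.a≡a%n+[a/n]*n i (+ 2) | ℤDM.n%d<d i (+ 2)
  ... | 0 | eq | _ = ⊥-elim (Odd⇒¬∣ {1ℤ} (0ℚ , 0∈Z , ⟪1⟫≡1)
        (ℤ∣.divides (i ℤDM./ (+ 2) ℤ.- q) (trans (lem q) (trans (cong (ℤ._- q ℤ.* + 2) (trans (sym i≡) eq)) (lem′ (i ℤDM./ (+ 2)) q)))))
    where
    lem : ∀ q → 1ℤ ≡ 1ℤ ℤ.+ q ℤ.* + 2 ℤ.- q ℤ.* + 2
    lem = ℤSolver.solve-∀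
    lem′ : ∀ p q → 0ℤ ℤ.+ p ℤ.* + 2 ℤ.- q ℤ.* + 2 ≡ (p ℤ.- q) ℤ.* + 2
    lem′ = ℤSolver.solve-∀
  ... | 1 | eq | _ = ℤₚ.*-cancelʳ-≡ (i ℤDM./ (+ 2)) q (+ 2) (+-cancelˡ 1ℤ _ _ (trans (sym eq) i≡))
  ... | suc (suc _) | _ | s≤s (s≤s ())

  -- Prepares the coordinate -⌈h/2⌉ of the generators: twice the ceiling is h or h + 1 according to
  -- parity.
  data Ceiling (i : ℤ) : Set where
    ceiling-even : ∀ m → ⟪ i ⟫ ≡ 2ℚ * ⟪ m ⟫ → ceiling (i / 2) ≡ m → Ceiling i
    ceiling-odd  : ∀ m → ⟪ i ⟫ ≡ 2ℚ * ⟪ m ⟫ - 1ℚ → ceiling (i / 2) ≡ m → Ceiling i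

  ½-of : ∀ i → i / 2 ≡ ½ * ⟪ i ⟫
  ½-of i = trans (lem (i / 2)) (cong (½ *_) (trans (cong (i / 2 *_) (sym ⟪2⟫≡2)) (/-* i 2)))
    where
    lem : ∀ r → r ≡ ½ * (r * 2ℚ)
    lem = solve-∀ ℚ-acr

  ceiling-half : ∀ i → Ceiling i
  ceiling-half i = view (parity (⟪⟫∈Z i)) refl
    where
    view : ∀ {r} → Parity r → r ≡ ⟪ i ⟫ → Ceiling i
    view (even {s} (m , s≡)) eq = ceiling-even m i≡ (trans (cong ceiling i/2≡) (trans (ceiling-mkℚ m 0 c) (trans (cong ℤ.-_ (/1≡ (ℤ.- m))) (ℤₚ.neg-involutive m))))
      where
      i≡ : ⟪ i ⟫ ≡ 2ℚ * ⟪ m ⟫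
      i≡ = trans (sym eq) (cong (2ℚ *_) s≡)
      c : ℕC.Coprime ℤ.∣ m ∣ 1
      c = ℕC.sym (ℕC.1-coprimeTo ℤ.∣ m ∣)
      lem : ∀ m → ½ * (2ℚ * m) ≡ m
      lem = solve-∀ ℚ-acr
      i/2≡ : i / 2 ≡ mkℚ m 0 c
      i/2≡ = trans (½-of i) (trans (cong (½ *_) i≡) (trans (lem ⟪ m ⟫) (trans (⟪⟫≡/1 m) (↥p/↧p≡p (mkℚ m 0 c)))))
    view (odd {s} (n , s≡)) eq = ceiling-odd (n ℤ.+ 1ℤ) i≡ (trans (cong ceiling (↥p/↧p≡p (mkℚ i 1 c))) (trans (ceiling-mkℚ i 1 c)
        (trans (cong ℤ.-_ (odd/2≡ (ℤ.- i) (ℤ.- (n ℤ.+ 1ℤ)) -i≡)) (ℤₚ.neg-involutive (n ℤ.+ 1ℤ)))))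
      where
      i≡′ : ⟪ i ⟫ ≡ ⟪ + 2 ℤ.* n ℤ.+ 1ℤ ⟫
      i≡′ = trans (sym eq) (trans (cong (λ s → 2ℚ * s + 1ℚ) s≡) (sym (trans (⟪⟫-+ (+ 2 ℤ.* n) 1ℤ)
              (cong₂ _+_ (trans (⟪⟫-* (+ 2) n) (cong (_* ⟪ n ⟫) ⟪2⟫≡2)) ⟪1⟫≡1))))
      -i≡ : ℤ.- i ≡ 1ℤ ℤ.+ (ℤ.- (n ℤ.+ 1ℤ)) ℤ.* + 2
      -i≡ = trans (cong ℤ.-_ (⟪⟫-injective i≡′)) (lem n)
        where
        lem : ∀ n → ℤ.- (+ 2 ℤ.* n ℤ.+ 1ℤ) ≡ 1ℤ ℤ.+ (ℤ.- (n ℤ.+ 1ℤ)) ℤ.* + 2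
        lem = ℤSolver.solve-∀
      i≡ : ⟪ i ⟫ ≡ 2ℚ * ⟪ n ℤ.+ 1ℤ ⟫ - 1ℚ
      i≡ = trans (sym eq) (trans (trans (cong (λ s → 2ℚ * s + 1ℚ) s≡) (lem ⟪ n ⟫)) (cong (λ t → 2ℚ * t - 1ℚ) (sym (trans (⟪⟫-+ n 1ℤ) (cong (λ t → ⟪ n ⟫ + t) ⟪1⟫≡1)))))
        where
        lem : ∀ n → 2ℚ * n + 1ℚ ≡ 2ℚ * (n + 1ℚ) - 1ℚ
        lem = solve-∀ ℚ-acr
      ¬2∣i : ¬ 2 ℕ∣.∣ ℤ.∣ i ∣
      ¬2∣i p = Odd⇒¬∣ {i} (s , (n , s≡) , sym eq) (ℤ∣.∣ᵤ⇒∣ p)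
      c : ℕC.Coprime ℤ.∣ i ∣ 2
      c {zero} (_ , 0∣2) with ℕ∣.0∣⇒≡0 0∣2
      ... | ()
      c {1} _ = refl
      c {2} (2∣i , _) = ⊥-elim (¬2∣i 2∣i)
      c {suc (suc (suc _))} (_ , d∣2) with ℕ∣.∣⇒≤ d∣2
      ... | s≤s (s≤s ())

  -- p + q √δ is an algebraic integer.
  record KIntegral (δ p q : ℚ) : Set where
    constructor kIntegral
    field
      2p∈Z   : Z (2ℚ * p)
      2q∈Z   : Z (2ℚ * q)
      norm∈Z : Z (p * p - δ * (q * q))

  half-double : ∀ p → ½ * (2ℚ * p) ≡ p
  half-double = solve-∀ ℚ-acr

  opaque
    KIntegral-odd : ∀ {δ k p q} → Z k → δ ≡ 4ℚ * k + 1ℚ → KIntegral δ p q → Z (p - q)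
    KIntegral-odd {δ} {k} {p} {q} zk eq (kIntegral zp zq n) = subst Z (cong₂ _-_ (half-double p) (half-double q))
      (K-integer-odd zk (subst Z (cong₂ _-_ (cong₂ _*_ hp hp) (cong₂ _*_ eq (cong₂ _*_ hq hq))) n) (parity zp) (parity zq))
      where
      hp : p ≡ ½ * (2ℚ * p)
      hp = sym (half-double p)
      hq : q ≡ ½ * (2ℚ * q)
      hq = sym (half-double q)

    KIntegral-even : ∀ {δ k p q} → Z k → δ ≡ 4ℚ * k + 2ℚ → KIntegral δ p q → Z p × Z q
    KIntegral-even {δ} {k} {p} {q} zk eq (kIntegral zp zq n) =
      let zp′ , zq′ = K-integer-even zk (subst Z (cong₂ _-_ (cong₂ _*_ hp hp) (cong₂ _*_ eq (cong₂ _*_ hq hq))) n) (parity zp) (parity zq)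
      in subst Z (half-double p) zp′ , subst Z (half-double q) zq′
      where
      hp : p ≡ ½ * (2ℚ * p)
      hp = sym (half-double p)
      hq : q ≡ ½ * (2ℚ * q)
      hq = sym (half-double q)

  -- Consequences of the integrality of e + f √d + g z + h w.
  record Facts (α β γ e f g h : ℚ) : Set where
    field
      4e∈Z  : Z (4ℚ * e)
      4f∈Z  : Z (4ℚ * f)
      4g∈Z  : Z (4ℚ * g)
      4h∈Z  : Z (4ℚ * h)
      trace : KIntegral (F.δ β γ) (2ℚ * e) (2ℚ * f)
      norm  : KIntegral (F.δ β γ) (F.N₀ α β γ e f g h) (F.N₁ α β γ e f g h)
      plane : KIntegral (F.δ β γ) (F.N₀ α β γ 0ℚ 0ℚ (2ℚ * g) (2ℚ * h)) (F.N₁ α β γ 0ℚ 0ℚ (2ℚ * g) (2ℚ * h))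
      W∈Z   : Z (F.W α β γ g h)

  -- For d ≡ 1 (mod 4), integrality of the relative trace 2 e + 2 f √d forces k = 2 f - 2 e ∈ ℤ.
  -- With e = E/4 this reads f = (E + 2 k)/4, so the parity of 4 f is tied to that of 4 e from the
  -- start.
  data OddFacts (α β γ : ℚ) : (e f g h : ℚ) → Set where
    oddFacts : ∀ {E k G H} → Z E → Z k → Z G → Z H →
      Z (F.W α β γ (F.qr G) (F.qr H)) →
      Z (2ℚ * F.N₁ α β γ (F.qr E) (F.qr (E + F.ev k)) (F.qr G) (F.qr H)) →
      Z (F.N₋ α β γ (F.qr E) (F.qr (E + F.ev k)) (F.qr G) (F.qr H)) →
      OddFacts α β γ (F.qr E) (F.qr (E + F.ev k)) (F.qr G) (F.qr H)

  qr-4 : ∀ e → ¼ * (4ℚ * e) ≡ e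
  qr-4 = solve-∀ ℚ-acr

  opaque
    facts⇒odd : ∀ {α β γ e f g h k} → Z k → F.δ β γ ≡ 4ℚ * k + 1ℚ → Facts α β γ e f g h → OddFacts α β γ e f g h
    facts⇒odd {α} {β} {γ} {e} {f} {g} {h} zk eq facts = build (sym (qr-4 e)) f≡ (sym (qr-4 g)) (sym (qr-4 h))
        W∈Z (KIntegral.2q∈Z norm) (KIntegral-odd zk eq norm)
      where
      open Facts facts
      l : ℚ
      l = 2ℚ * f - 2ℚ * e
      zl : Z l
      zl = subst Z (lem e f) (⊝ KIntegral-odd zk eq trace)
        where
        lem : ∀ e f → - (2ℚ * e - 2ℚ * f) ≡ 2ℚ * f - 2ℚ * e
        lem = solve-∀ ℚ-acr
      f≡ : f ≡ F.qr (4ℚ * e + F.ev l)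
      f≡ = lem e f
        where
        lem : ∀ e f → f ≡ ¼ * (4ℚ * e + 2ℚ * (2ℚ * f - 2ℚ * e))
        lem = solve-∀ ℚ-acr
      build : ∀ {e′ f′ g′ h′} → e′ ≡ F.qr (4ℚ * e) → f′ ≡ F.qr (4ℚ * e + F.ev l) → g′ ≡ F.qr (4ℚ * g) → h′ ≡ F.qr (4ℚ * h) →
        Z (F.W α β γ g′ h′) → Z (2ℚ * F.N₁ α β γ e′ f′ g′ h′) → Z (F.N₋ α β γ e′ f′ g′ h′) → OddFacts α β γ e′ f′ g′ h′
      build refl refl refl refl w n₁ n₋ = oddFacts 4e∈Z zl 4g∈Z 4h∈Z w n₁ n₋

    -- Replacing (γ , h) by (- γ , - h) corresponds to replacing (c₀ , w) by (- c₀ , - w).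
    odd-reflect : ∀ {α β γ e f g h} → OddFacts α β γ e f g h → OddFacts α β (- γ) e f g (- h)
    odd-reflect {α} {β} {γ} (oddFacts {E} {k} {G} {H} zE zk zG zH w n₁ n₋) =
      subst (OddFacts α β (- γ) _ _ _) (lem H) (oddFacts zE zk zG (⊝ zH)
        (subst Z (lemW α β γ G H) (⊝ w)) (subst Z (lem₁ α β γ E k G H) n₁) (subst Z (lem₋ α β γ E k G H) n₋))
      where
      lem : ∀ H → ¼ * (- H) ≡ - (¼ * H)
      lem = solve-∀ ℚ-acr
      lemW : ∀ α β γ G H →
        - (α * (γ * ((2ℚ * (¼ * G)) * (2ℚ * (¼ * G)) - (2ℚ * (¼ * H)) * (2ℚ * (¼ * H))) - 2ℚ * β * ((2ℚ * (¼ * G)) * (2ℚ * (¼ * H))))) ≡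
        α * (- γ * ((2ℚ * (¼ * G)) * (2ℚ * (¼ * G)) - (2ℚ * (¼ * - H)) * (2ℚ * (¼ * - H))) - 2ℚ * β * ((2ℚ * (¼ * G)) * (2ℚ * (¼ * - H))))
      lemW = solve-∀ ℚ-acr
      lem₁′ : ∀ α β γ e f g H →
        2ℚ * (2ℚ * (e * f) - α * (β * (g * g - (¼ * H) * (¼ * H)) + 2ℚ * γ * (g * (¼ * H)))) ≡
        2ℚ * (2ℚ * (e * f) - α * (β * (g * g - (¼ * - H) * (¼ * - H)) + 2ℚ * - γ * (g * (¼ * - H))))
      lem₁′ = solve-∀ ℚ-acr
      lem₁ : ∀ α β γ E k G H → 2ℚ * F.N₁ α β γ (F.qr E) (F.qr (E + F.ev k)) (F.qr G) (F.qr H) ≡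
                               2ℚ * F.N₁ α β (- γ) (F.qr E) (F.qr (E + F.ev k)) (F.qr G) (F.qr (- H))
      lem₁ α β γ E k G H = lem₁′ α β γ (F.qr E) (F.qr (E + F.ev k)) (F.qr G) H
      lem₋′ : ∀ α β γ e f g H →
        (e * e + (β * β + γ * γ) * (f * f) - α * (β * β + γ * γ) * (g * g + (¼ * H) * (¼ * H)))
          - (2ℚ * (e * f) - α * (β * (g * g - (¼ * H) * (¼ * H)) + 2ℚ * γ * (g * (¼ * H)))) ≡
        (e * e + (β * β + - γ * - γ) * (f * f) - α * (β * β + - γ * - γ) * (g * g + (¼ * - H) * (¼ * - H)))
          - (2ℚ * (e * f) - α * (β * (g * g - (¼ * - H) * (¼ * - H)) + 2ℚ * - γ * (g * (¼ * - H))))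
      lem₋′ = solve-∀ ℚ-acr
      lem₋ : ∀ α β γ E k G H → F.N₋ α β γ (F.qr E) (F.qr (E + F.ev k)) (F.qr G) (F.qr H) ≡
                               F.N₋ α β (- γ) (F.qr E) (F.qr (E + F.ev k)) (F.qr G) (F.qr (- H))
      lem₋ α β γ E k G H = lem₋′ α β γ (F.qr E) (F.qr (E + F.ev k)) (F.qr G) H

  opaque
    integers-case₁ : ∀ {a b c e f g h} → Z a → Z b → Z c →
      Facts (F.od a) (F.od b) (F.od c) e f g h → Z e × Z f × Z g × Z h
    integers-case₁ {a} {b} {c} {e} {f} {g} {h} za zb zc facts =
      let ze′ , zf′ , zg′ , zh′ = lattice 2e∈Z 2f∈Z n₀ n₁ (parity 2e∈Z) (parity 2f∈Z) (parity 2g∈Z) (parity 2h∈Z)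
      in subst Z (half-double e) ze′ , subst Z (half-double f) zf′ , subst Z (half-double g) zg′ , subst Z (half-double h) zh′
      where
      open Facts facts renaming (plane to planeNorm)
      open Case₁ za zb zc
      zk : Z (b * b + b + (c * c + c))
      zk = zb ⊗ zb ⊕ zb ⊕ (zc ⊗ zc ⊕ zc)
      δ≡ : F.δ (F.od b) (F.od c) ≡ 4ℚ * (b * b + b + (c * c + c)) + 2ℚ
      δ≡ = lem b c
        where
        lem : ∀ b c → (2ℚ * b + 1ℚ) * (2ℚ * b + 1ℚ) + (2ℚ * c + 1ℚ) * (2ℚ * c + 1ℚ) ≡ 4ℚ * (b * b + b + (c * c + c)) + 2ℚ
        lem = solve-∀ ℚ-acr
      2e∈Z : Z (2ℚ * e)
      2e∈Z = proj₁ (KIntegral-even zk δ≡ trace)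
      2f∈Z : Z (2ℚ * f)
      2f∈Z = proj₂ (KIntegral-even zk δ≡ trace)
      half-4 : ∀ g → ½ * (4ℚ * g) ≡ 2ℚ * g
      half-4 = solve-∀ ℚ-acr
      plane-Z : Z (½ * (4ℚ * g)) × Z (½ * (4ℚ * h))
      plane-Z = plane (subst₂ (λ g h → Z (F.N₁ (F.od a) (F.od b) (F.od c) 0ℚ 0ℚ (2ℚ * g) (2ℚ * h))) (sym (qr-4 g)) (sym (qr-4 h))
        (proj₂ (KIntegral-even zk δ≡ planeNorm))) (parity 4g∈Z) (parity 4h∈Z)
      2g∈Z : Z (2ℚ * g)
      2g∈Z = subst Z (half-4 g) (proj₁ plane-Z)
      2h∈Z : Z (2ℚ * h)
      2h∈Z = subst Z (half-4 h) (proj₂ plane-Z)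
      at-halves : (N : (e f g h : ℚ) → ℚ) → Z (N e f g h) → Z (N (½ * (2ℚ * e)) (½ * (2ℚ * f)) (½ * (2ℚ * g)) (½ * (2ℚ * h)))
      at-halves N = subst Z (trans (cong₂ (λ e f → N e f g h) (sym (half-double e)) (sym (half-double f)))
        (cong₂ (N (½ * (2ℚ * e)) (½ * (2ℚ * f))) (sym (half-double g)) (sym (half-double h))))
      n₀ : Z (F.N₀ (F.od a) (F.od b) (F.od c) (½ * (2ℚ * e)) (½ * (2ℚ * f)) (½ * (2ℚ * g)) (½ * (2ℚ * h)))
      n₀ = at-halves (F.N₀ (F.od a) (F.od b) (F.od c)) (proj₁ (KIntegral-even zk δ≡ norm))
      n₁ : Z (F.N₁ (F.od a) (F.od b) (F.od c) (½ * (2ℚ * e)) (½ * (2ℚ * f)) (½ * (2ℚ * g)) (½ * (2ℚ * h)))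
      n₁ = at-halves (F.N₁ (F.od a) (F.od b) (F.od c)) (proj₂ (KIntegral-even zk δ≡ norm))

    integers-case₂ : ∀ {a b c e f g h} → Z a → Z b → Z c →
      Facts (F.od a) (F.od b) (F.ev c) e f g h → Z (e - f) × Z (2ℚ * f) × Z g × Z h
    integers-case₂ {a} {b} {c} za zb zc facts = go (facts⇒odd (zb ⊗ zb ⊕ zb ⊕ zc ⊗ zc) (lem b c) facts)
      where
      lem : ∀ b c → (2ℚ * b + 1ℚ) * (2ℚ * b + 1ℚ) + (2ℚ * c) * (2ℚ * c) ≡ 4ℚ * (b * b + b + c * c) + 1ℚ
      lem = solve-∀ ℚ-acr
      go : ∀ {e f g h} → OddFacts (F.od a) (F.od b) (F.ev c) e f g h → Z (e - f) × Z (2ℚ * f) × Z g × Z h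
      go (oddFacts zE zk zG zH w n₁ n₋) = Case₂.lattice za zb zc zE zk w n₁ n₋ (parity zE) (parity zG) (parity zH)

    δ-ev-od : ∀ b c → F.δ (F.ev b) (F.od c) ≡ 4ℚ * (b * b + (c * c + c)) + 1ℚ
    δ-ev-od b c = lem b c
      where
      lem : ∀ b c → (2ℚ * b) * (2ℚ * b) + (2ℚ * c + 1ℚ) * (2ℚ * c + 1ℚ) ≡ 4ℚ * (b * b + (c * c + c)) + 1ℚ
      lem = solve-∀ ℚ-acr

    integers-case₃ : ∀ {m b c e f g h} → Z m → Z b → Z c →
      Facts (3ℚ + 4ℚ * m - F.ev b) (F.ev b) (F.od c) e f g h → Z (e - f) × Z (2ℚ * f) × Z (g + h) × Z (g - h)
    integers-case₃ {m} {b} {c} zm zb zc facts = go (facts⇒odd (zb ⊗ zb ⊕ (zc ⊗ zc ⊕ zc)) (δ-ev-od b c) facts)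
      where
      go : ∀ {e f g h} → OddFacts (3ℚ + 4ℚ * m - F.ev b) (F.ev b) (F.od c) e f g h → Z (e - f) × Z (2ℚ * f) × Z (g + h) × Z (g - h)
      go (oddFacts zE zk zG zH w n₁ n₋) = Case₃.lattice zm zb zc zE zk w n₁ n₋ (parity zE) (parity zG) (parity zH)

    integers-odd₄ : ∀ {m b c e f g h} → Z m → Z b → Z c →
      OddFacts (F.od c + 4ℚ * m) (F.ev b) (F.od c) e f g h →
      Z (e - f - g + h) × Z (2ℚ * f - 2ℚ * h) × Z (2ℚ * (g + h)) × Z (2ℚ * (g - h))
    integers-odd₄ zm zb zc (oddFacts zE zk zG zH w n₁ n₋) = Case₄.lattice zm zb zc zE zk w n₁ n₋ (parity zE) (parity zG) (parity zH)

    integers-case₄ : ∀ {m b c e f g h} → Z m → Z b → Z c →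
      Facts (F.od c + 4ℚ * m) (F.ev b) (F.od c) e f g h →
      Z (e - f - g + h) × Z (2ℚ * f - 2ℚ * h) × Z (2ℚ * (g + h)) × Z (2ℚ * (g - h))
    integers-case₄ {m} {b} {c} zm zb zc facts = integers-odd₄ zm zb zc (facts⇒odd (zb ⊗ zb ⊕ (zc ⊗ zc ⊕ zc)) (δ-ev-od b c) facts)

    integers-case₅ : ∀ {m b c γ e f g h} → Z m → Z b → Z c → - γ ≡ F.od c →
      Facts (F.od c + 4ℚ * m) (F.ev b) γ e f g h →
      Z (e - f - g + - h) × Z (2ℚ * f - 2ℚ * - h) × Z (2ℚ * (g + - h)) × Z (2ℚ * (g - - h))
    integers-case₅ {m} {b} {c} {γ} {e} {f} {g} {h} zm zb zc eq facts = integers-odd₄ zm zb zc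
      (subst (λ γ′ → OddFacts (F.od c + 4ℚ * m) (F.ev b) γ′ e f g (- h)) eq
        (odd-reflect (facts⇒odd (zb ⊗ zb ⊕ (zc ⊗ zc ⊕ zc)) δ≡ facts)))
      where
      lem : ∀ β γ → β * β + γ * γ ≡ β * β + - γ * - γ
      lem = solve-∀ ℚ-acr
      δ≡ : F.δ (F.ev b) γ ≡ 4ℚ * (b * b + (c * c + c)) + 1ℚ
      δ≡ = trans (lem (F.ev b) γ) (trans (cong (λ g → (F.ev b) * (F.ev b) + g * g) eq) (δ-ev-od b c))

  -- The congruences on (a , b₀ , c₀) in the five cases.
  data Params₁ : (α β γ : ℚ) → Set where
    params₁ : ∀ {a b c} → Z a → Z b → Z c → Params₁ (F.od a) (F.od b) (F.od c)

  data Params₂ : (α β γ : ℚ) → Set where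
    params₂ : ∀ {a b c} → Z a → Z b → Z c → Params₂ (F.od a) (F.od b) (F.ev c)

  data Params₃ : (α β γ : ℚ) → Set where
    params₃ : ∀ {m b c} → Z m → Z b → Z c → Params₃ (3ℚ + 4ℚ * m - F.ev b) (F.ev b) (F.od c)

  -- From a + b₀ ≡ 1 and a ≡ c₀ one gets c₀ ≡ 1 - b₀ (mod 4). For b₀ = 2 b this is c₀ = 2 (2 n - b)
  -- + 1, and both congruences hold identically in m, n and b.
  data Params₄ : (α β γ : ℚ) → Set where
    params₄ : ∀ {m n b} → Z m → Z n → Z b → Params₄ (F.od (2ℚ * n - b) + 4ℚ * m) (F.ev b) (F.od (2ℚ * n - b))

  data Params₅ : (α β γ : ℚ) → Set where
    params₅ : ∀ {m n b} → Z m → Z n → Z b → Params₅ (F.od (2ℚ * n - b) + 4ℚ * m) (F.ev b) (- F.od (2ℚ * n - b))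

  OddDiscriminant : (β γ : ℚ) → Set
  OddDiscriminant β γ = ∃[ k ] Z k × F.δ β γ ≡ 4ℚ * k + 1ℚ

  oddDiscriminant-ev-od : ∀ {b c} → Z b → Z c → OddDiscriminant (F.ev b) (F.od c)
  oddDiscriminant-ev-od {b} {c} zb zc = _ , zb ⊗ zb ⊕ (zc ⊗ zc ⊕ zc) , δ-ev-od b c

  odd₂ : ∀ {α β γ} → Params₂ α β γ → OddDiscriminant β γ
  odd₂ (params₂ {_} {b} {c} _ zb zc) = _ , zb ⊗ zb ⊕ zb ⊕ zc ⊗ zc , lem b c
    where
    lem : ∀ b c → (2ℚ * b + 1ℚ) * (2ℚ * b + 1ℚ) + (2ℚ * c) * (2ℚ * c) ≡ 4ℚ * (b * b + b + c * c) + 1ℚ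
    lem = solve-∀ ℚ-acr

  odd₃ : ∀ {α β γ} → Params₃ α β γ → OddDiscriminant β γ
  odd₃ (params₃ _ zb zc) = oddDiscriminant-ev-od zb zc

  odd₄ : ∀ {α β γ} → Params₄ α β γ → OddDiscriminant β γ
  odd₄ (params₄ _ zn zb) = oddDiscriminant-ev-od zb (2∈Z ⊗ zn ⊖ zb)

  odd₅ : ∀ {α β γ} → Params₅ α β γ → OddDiscriminant β γ
  odd₅ (params₅ {_} {n} {b} _ zn zb) =
    let k , zk , eq = oddDiscriminant-ev-od zb (2∈Z ⊗ zn ⊖ zb) in
    k , zk , trans (lem (F.ev b) (F.od (2ℚ * n - b))) eq
    where
    lem : ∀ β γ → β * β + - γ * - γ ≡ β * β + γ * γ
    lem = solve-∀ ℚ-acr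

  integers₁ : ∀ {α β γ e f g h} → Params₁ α β γ → Facts α β γ e f g h → Z e × Z f × Z g × Z h
  integers₁ (params₁ za zb zc) = integers-case₁ za zb zc

  integers₂ : ∀ {α β γ e f g h} → Params₂ α β γ → Facts α β γ e f g h → Z (e - f) × Z (2ℚ * f) × Z g × Z h
  integers₂ (params₂ za zb zc) = integers-case₂ za zb zc

  integers₃ : ∀ {α β γ e f g h} → Params₃ α β γ → Facts α β γ e f g h →
              Z (e - f) × Z (2ℚ * f) × Z (g + h) × Z (g - h)
  integers₃ (params₃ zm zb zc) = integers-case₃ zm zb zc

  integers₄ : ∀ {α β γ e f g h} → Params₄ α β γ → Facts α β γ e f g h →
              Z (e - f - g + h) × Z (2ℚ * f - 2ℚ * h) × Z (2ℚ * (g + h)) × Z (2ℚ * (g - h))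
  integers₄ (params₄ zm zn zb) = integers-case₄ zm zb (2∈Z ⊗ zn ⊖ zb)

  integers₅ : ∀ {α β γ e f g h} → Params₅ α β γ → Facts α β γ e f g h →
              Z (e - f - g + - h) × Z (2ℚ * f - 2ℚ * - h) × Z (2ℚ * (g + - h)) × Z (2ℚ * (g - - h))
  integers₅ (params₅ {_} {n} {b} zm zn zb) = integers-case₅ zm zb (2∈Z ⊗ zn ⊖ zb) (lem (F.od (2ℚ * n - b)))
    where
    lem : ∀ γ → - - γ ≡ γ
    lem = solve-∀ ℚ-acr

  -- The relative trace and norm of e + f √d + g z + h w lie in ℤ[(1 + √d) / 2].
  record RelativelyIntegral (α β γ e f g h : ℚ) : Set where
    constructor relativelyIntegral
    field
      s∈Z : Z (2ℚ * e - 2ℚ * f)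
      t∈Z : Z (4ℚ * f)
      u∈Z : Z (2ℚ * F.N₁ α β γ e f g h)
      r∈Z : Z (F.N₋ α β γ e f g h)

  -¼ : ℚ
  -¼ = - ¼

  private
    2N₁-poly₃ N₋-poly₃ 2N₁-poly₄ N₋-poly₄ 2N₁-poly₅ N₋-poly₅ : (e f g h : ℚ) → Vec (Polynomial 3) 3 → Polynomial 3
    2N₁-poly₃ e f g h (m ∷ b ∷ c ∷ []) = con 2ℚ :* P.N₁ (con 3ℚ :+ con 4ℚ :* m :- P.ev b) (P.ev b) (P.od c) (con e) (con f) (con g) (con h)
    N₋-poly₃ e f g h (m ∷ b ∷ c ∷ []) = P.N₋ (con 3ℚ :+ con 4ℚ :* m :- P.ev b) (P.ev b) (P.od c) (con e) (con f) (con g) (con h)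
    2N₁-poly₄ e f g h (m ∷ n ∷ b ∷ []) = con 2ℚ :* P.N₁ (P.od (con 2ℚ :* n :- b) :+ con 4ℚ :* m) (P.ev b) (P.od (con 2ℚ :* n :- b)) (con e) (con f) (con g) (con h)
    N₋-poly₄ e f g h (m ∷ n ∷ b ∷ []) = P.N₋ (P.od (con 2ℚ :* n :- b) :+ con 4ℚ :* m) (P.ev b) (P.od (con 2ℚ :* n :- b)) (con e) (con f) (con g) (con h)
    2N₁-poly₅ e f g h (m ∷ n ∷ b ∷ []) = con 2ℚ :* P.N₁ (P.od (con 2ℚ :* n :- b) :+ con 4ℚ :* m) (P.ev b) (:- P.od (con 2ℚ :* n :- b)) (con e) (con f) (con g) (con h)
    N₋-poly₅ e f g h (m ∷ n ∷ b ∷ []) = P.N₋ (P.od (con 2ℚ :* n :- b) :+ con 4ℚ :* m) (P.ev b) (:- P.od (con 2ℚ :* n :- b)) (con e) (con f) (con g) (con h)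

  opaque
    -- For ω = (1 + √d)/2 and d = 4 k + 1 the relative trace is 2 ω and the relative norm is ω² = k
    -- + ω, whence the values 0, 2, 1 and k.
    half-1+√d : ∀ {α β γ} → OddDiscriminant β γ → RelativelyIntegral α β γ ½ ½ 0ℚ 0ℚ
    half-1+√d {α} {β} {γ} (k , zk , eq) = relativelyIntegral 0∈Z 2∈Z (subst Z (lem₁ α β γ) 1∈Z) (subst Z (trans (lem₂ k) (trans (cong (λ δ → ½ * ½ + δ * (½ * ½) - ½) (sym eq)) (lem₃ α β γ))) zk)
      where
      lem₁ : ∀ α β γ → 1ℚ ≡ 2ℚ * (2ℚ * (½ * ½) - α * (β * (0ℚ * 0ℚ - 0ℚ * 0ℚ) + 2ℚ * γ * (0ℚ * 0ℚ)))
      lem₁ = solve-∀ ℚ-acr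
      lem₂ : ∀ k → k ≡ ½ * ½ + (4ℚ * k + 1ℚ) * (½ * ½) - ½
      lem₂ = solve-∀ ℚ-acr
      lem₃ : ∀ α β γ → ½ * ½ + (β * β + γ * γ) * (½ * ½) - ½ ≡
        (½ * ½ + (β * β + γ * γ) * (½ * ½) - α * (β * β + γ * γ) * (0ℚ * 0ℚ + 0ℚ * 0ℚ)) - (2ℚ * (½ * ½) - α * (β * (0ℚ * 0ℚ - 0ℚ * 0ℚ) + 2ℚ * γ * (0ℚ * 0ℚ)))
      lem₃ = solve-∀ ℚ-acr

    half-z+w : ∀ {α β γ} → Params₃ α β γ → RelativelyIntegral α β γ 0ℚ 0ℚ ½ ½
    half-z+w (params₃ zm zb zc) = relativelyIntegral 0∈Z 0∈Z
      (poly-Z (2N₁-poly₃ 0ℚ 0ℚ ½ ½) (zm ∷ zb ∷ zc ∷ [])) (poly-Z (N₋-poly₃ 0ℚ 0ℚ ½ ½) (zm ∷ zb ∷ zc ∷ []))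

    half-z-w : ∀ {α β γ} → Params₃ α β γ → RelativelyIntegral α β γ 0ℚ 0ℚ ½ -½
    half-z-w (params₃ zm zb zc) = relativelyIntegral 0∈Z 0∈Z
      (poly-Z (2N₁-poly₃ 0ℚ 0ℚ ½ -½) (zm ∷ zb ∷ zc ∷ [])) (poly-Z (N₋-poly₃ 0ℚ 0ℚ ½ -½) (zm ∷ zb ∷ zc ∷ []))

    quarter₄-+ : ∀ {α β γ} → Params₄ α β γ → RelativelyIntegral α β γ ¼ ¼ ¼ ¼
    quarter₄-+ (params₄ zm zn zb) = relativelyIntegral 0∈Z 1∈Z
      (poly-Z (2N₁-poly₄ ¼ ¼ ¼ ¼) (zm ∷ zn ∷ zb ∷ [])) (poly-Z (N₋-poly₄ ¼ ¼ ¼ ¼) (zm ∷ zn ∷ zb ∷ []))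

    quarter₄-- : ∀ {α β γ} → Params₄ α β γ → RelativelyIntegral α β γ ¼ -¼ ¼ -¼
    quarter₄-- (params₄ zm zn zb) = relativelyIntegral 1∈Z (⊝ 1∈Z)
      (poly-Z (2N₁-poly₄ ¼ -¼ ¼ -¼) (zm ∷ zn ∷ zb ∷ [])) (poly-Z (N₋-poly₄ ¼ -¼ ¼ -¼) (zm ∷ zn ∷ zb ∷ []))

    quarter₅-+ : ∀ {α β γ} → Params₅ α β γ → RelativelyIntegral α β γ ¼ ¼ ¼ -¼
    quarter₅-+ (params₅ zm zn zb) = relativelyIntegral 0∈Z 1∈Z
      (poly-Z (2N₁-poly₅ ¼ ¼ ¼ -¼) (zm ∷ zn ∷ zb ∷ [])) (poly-Z (N₋-poly₅ ¼ ¼ ¼ -¼) (zm ∷ zn ∷ zb ∷ []))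

    quarter₅-- : ∀ {α β γ} → Params₅ α β γ → RelativelyIntegral α β γ ¼ -¼ ¼ ¼
    quarter₅-- (params₅ zm zn zb) = relativelyIntegral 1∈Z (⊝ 1∈Z)
      (poly-Z (2N₁-poly₅ ¼ -¼ ¼ ¼) (zm ∷ zn ∷ zb ∷ [])) (poly-Z (N₋-poly₅ ¼ -¼ ¼ ¼) (zm ∷ zn ∷ zb ∷ []))

  opaque
    toParams₁ : ∀ {α β γ} → Odd α → Odd β → Odd γ → Params₁ α β γ
    toParams₁ (_ , za , refl) (_ , zb , refl) (_ , zc , refl) = params₁ za zb zc

    toParams₂ : ∀ {α β γ} → Odd α → Odd β → Even γ → Params₂ α β γ
    toParams₂ (_ , za , refl) (_ , zb , refl) (_ , zc , refl) = params₂ za zb zc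

    toParams₃ : ∀ {α β γ} → (∃[ m ] Z m × α + β ≡ 3ℚ + 4ℚ * m) → Even β → Odd γ → Params₃ α β γ
    toParams₃ {α} (m , zm , eq) (b , zb , refl) (c , zc , refl) = subst (λ α → Params₃ α (F.ev b) (F.od c)) (sym α≡) (params₃ zm zb zc)
      where
      lem : ∀ α β → α ≡ (α + β) - β
      lem = solve-∀ ℚ-acr
      α≡ : α ≡ 3ℚ + 4ℚ * m - F.ev b
      α≡ = trans (lem α (F.ev b)) (cong (_- F.ev b) eq)

    toParams₄ : ∀ {α β γ} → (∃[ m ] Z m × α + β ≡ 1ℚ + 4ℚ * m) → (∃[ m ] Z m × α ≡ γ + 4ℚ * m) → Even β → Params₄ α β γ
    toParams₄ {γ = γ} (m , zm , eq) (n , zn , refl) (b , zb , refl) =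
      subst (λ γ → Params₄ (γ + 4ℚ * n) (F.ev b) γ) (sym γ≡) (params₄ zn (zm ⊖ zn) zb)
      where
      lem : ∀ γ β n → γ ≡ ((γ + 4ℚ * n) + β) - β - 4ℚ * n
      lem = solve-∀ ℚ-acr
      lem′ : ∀ b m n → (1ℚ + 4ℚ * m) - (2ℚ * b) - 4ℚ * n ≡ 2ℚ * (2ℚ * (m - n) - b) + 1ℚ
      lem′ = solve-∀ ℚ-acr
      γ≡ : γ ≡ F.od (2ℚ * (m - n) - b)
      γ≡ = trans (lem γ (F.ev b) n) (trans (cong (λ t → t - F.ev b - 4ℚ * n) eq) (lem′ b m n))

    toParams₅ : ∀ {α β γ} → (∃[ m ] Z m × α + β ≡ 1ℚ + 4ℚ * m) → (∃[ m ] Z m × α ≡ - γ + 4ℚ * m) → Even β → Params₅ α β γ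
    toParams₅ {α} {β} {γ} e₁ e₂ e₃ = negate (toParams₄ {α} {β} { - γ} e₁ e₂ e₃) (lem γ)
      where
      lem : ∀ γ → γ ≡ - - γ
      lem = solve-∀ ℚ-acr
      negate : ∀ {γ′} → Params₄ α β γ′ → γ ≡ - γ′ → Params₅ α β γ
      negate (params₄ zm zn zb) refl = params₅ zm zn zb

open Congruences

-- Multiplication and conjugation in the basis 1, √d, z, w

module QuarticField where
  open import Data.Rational.Base hiding (NonZero)

  record V : Set where
    constructor v
    field e f g h : ℚ

  -- Coordinates of e + f x + g y + h z, given those of x, y, z.
  span : (x y z : V) (e f g h : ℚ) → V
  span (v p₁ p₂ p₃ p₄) (v q₁ q₂ q₃ q₄) (v r₁ r₂ r₃ r₄) e f g h =
    v (e * 1ℚ + f * p₁ + g * q₁ + h * r₁) (e * 0ℚ + f * p₂ + g * q₂ + h * r₂)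
      (e * 0ℚ + f * p₃ + g * q₃ + h * r₃) (e * 0ℚ + f * p₄ + g * q₄ + h * r₄)

  opaque
    -- In the nested pairs g z + h w is (g - b₀ k + k √d) z with k = h/c₀. The four identities
    -- rewrite their product by the rules z² = a (d + b₀ √d), w² = a (d - b₀ √d), z w = a c₀ √d, √d
    -- z = b₀ z + c₀ w and √d w = c₀ z - b₀ w.
    mul₁ : ∀ α β γ {δ ζ₁ ζ₂} e f g {h} k e′ f′ g′ {h′} k′ →
      δ ≡ β * β + γ * γ → ζ₁ ≡ α * δ → ζ₂ ≡ α * β → h ≡ γ * k → h′ ≡ γ * k′ →
      (e * e′ + δ * (f * f′)) + (ζ₁ * ((g - β * k) * (g′ - β * k′) + δ * (k * k′)) + δ * (ζ₂ * ((g - β * k) * k′ + k * (g′ - β * k′))))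
      ≡ e * e′ + (β * β + γ * γ) * (f * f′) + α * (β * β + γ * γ) * (g * g′ + h * h′)
    mul₁ α β γ e f g k e′ f′ g′ k′ refl refl refl refl refl = lem α β γ e f g k e′ f′ g′ k′
      where
      lem : ∀ α β γ e f g k e′ f′ g′ k′ →
        (e * e′ + (β * β + γ * γ) * (f * f′)) + ((α * (β * β + γ * γ)) * ((g - β * k) * (g′ - β * k′) + (β * β + γ * γ) * (k * k′)) + (β * β + γ * γ) * ((α * β) * ((g - β * k) * k′ + k * (g′ - β * k′))))
        ≡ e * e′ + (β * β + γ * γ) * (f * f′) + α * (β * β + γ * γ) * (g * g′ + (γ * k) * (γ * k′))
      lem = solve-∀ ℚ-acr

    mul₂ : ∀ α β γ {δ ζ₁ ζ₂} e f g {h} k e′ f′ g′ {h′} k′ →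
      δ ≡ β * β + γ * γ → ζ₁ ≡ α * δ → ζ₂ ≡ α * β → h ≡ γ * k → h′ ≡ γ * k′ →
      (e * f′ + f * e′) + (ζ₁ * ((g - β * k) * k′ + k * (g′ - β * k′)) + ζ₂ * ((g - β * k) * (g′ - β * k′) + δ * (k * k′)))
      ≡ e * f′ + f * e′ + α * (β * (g * g′ - h * h′) + γ * (g * h′ + h * g′))
    mul₂ α β γ e f g k e′ f′ g′ k′ refl refl refl refl refl = lem α β γ e f g k e′ f′ g′ k′
      where
      lem : ∀ α β γ e f g k e′ f′ g′ k′ →
        (e * f′ + f * e′) + ((α * (β * β + γ * γ)) * ((g - β * k) * k′ + k * (g′ - β * k′)) + (α * β) * ((g - β * k) * (g′ - β * k′) + (β * β + γ * γ) * (k * k′)))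
        ≡ e * f′ + f * e′ + α * (β * (g * g′ - (γ * k) * (γ * k′)) + γ * (g * (γ * k′) + (γ * k) * g′))
      lem = solve-∀ ℚ-acr

    mul₃ : ∀ β γ κ {δ} e f g {h} k e′ f′ g′ {h′} k′ →
      δ ≡ β * β + γ * γ → κ * γ ≡ 1ℚ → h ≡ γ * k → h′ ≡ γ * k′ →
      (e * (g′ - β * k′) + δ * (f * k′)) + ((g - β * k) * e′ + δ * (k * f′))
      ≡ (e * g′ + g * e′ + f * (β * g′ + γ * h′) + f′ * (β * g + γ * h)) - β * (κ * (e * h′ + h * e′ + f * (γ * g′ - β * h′) + f′ * (γ * g - β * h)))
    mul₃ β γ κ e f g k e′ f′ g′ k′ refl κγ refl refl =
      trans (lem β γ e f g k e′ f′ g′ k′) (trans (cong rest (sym κγ)) (lem′ β γ e f g k e′ f′ g′ k′ κ))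
      where
      rest : ℚ → ℚ
      rest t = (e * g′ + g * e′ + f * (β * g′ + γ * (γ * k′)) + f′ * (β * g + γ * (γ * k))) - β * (t * (e * k′ + k * e′ + f * (g′ - β * k′) + f′ * (g - β * k)))
      lem : ∀ β γ e f g k e′ f′ g′ k′ →
        (e * (g′ - β * k′) + (β * β + γ * γ) * (f * k′)) + ((g - β * k) * e′ + (β * β + γ * γ) * (k * f′))
        ≡ (e * g′ + g * e′ + f * (β * g′ + γ * (γ * k′)) + f′ * (β * g + γ * (γ * k))) - β * (1ℚ * (e * k′ + k * e′ + f * (g′ - β * k′) + f′ * (g - β * k)))
      lem = solve-∀ ℚ-acr
      lem′ : ∀ β γ e f g k e′ f′ g′ k′ κ →
        (e * g′ + g * e′ + f * (β * g′ + γ * (γ * k′)) + f′ * (β * g + γ * (γ * k))) - β * ((κ * γ) * (e * k′ + k * e′ + f * (g′ - β * k′) + f′ * (g - β * k)))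
        ≡ (e * g′ + g * e′ + f * (β * g′ + γ * (γ * k′)) + f′ * (β * g + γ * (γ * k))) - β * (κ * (e * (γ * k′) + (γ * k) * e′ + f * (γ * g′ - β * (γ * k′)) + f′ * (γ * g - β * (γ * k))))
      lem′ = solve-∀ ℚ-acr

    mul₄ : ∀ β γ κ e f g {h} k e′ f′ g′ {h′} k′ →
      κ * γ ≡ 1ℚ → h ≡ γ * k → h′ ≡ γ * k′ →
      (e * k′ + f * (g′ - β * k′)) + ((g - β * k) * f′ + k * e′)
      ≡ κ * (e * h′ + h * e′ + f * (γ * g′ - β * h′) + f′ * (γ * g - β * h))
    mul₄ β γ κ e f g k e′ f′ g′ k′ κγ refl refl =
      trans (lem₀ β e f g k e′ f′ g′ k′) (trans (cong (_* _) (sym κγ)) (lem₁ β γ κ e f g k e′ f′ g′ k′))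
      where
      lem₀ : ∀ β e f g k e′ f′ g′ k′ →
        (e * k′ + f * (g′ - β * k′)) + ((g - β * k) * f′ + k * e′) ≡ 1ℚ * (e * k′ + k * e′ + f * (g′ - β * k′) + f′ * (g - β * k))
      lem₀ = solve-∀ ℚ-acr
      lem₁ : ∀ β γ κ e f g k e′ f′ g′ k′ →
        (κ * γ) * (e * k′ + k * e′ + f * (g′ - β * k′) + f′ * (g - β * k))
        ≡ κ * (e * (γ * k′) + (γ * k) * e′ + f * (γ * g′ - β * (γ * k′)) + f′ * (γ * g - β * (γ * k)))
      lem₁ = solve-∀ ℚ-acr

    σ₁ : ∀ κ δ ζ₁ ζ₂ e R S ω →
      e + ((R * 0ℚ + δ * (- S * 0ℚ)) + (ζ₁ * (0ℚ * ω + δ * (0ℚ * κ)) + δ * (ζ₂ * (0ℚ * κ + 0ℚ * ω)))) ≡ e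
    σ₁ = solve-∀ ℚ-acr

    σ₂ : ∀ κ δ ζ₁ ζ₂ f R S ω →
      f + ((R * 0ℚ + - S * 0ℚ) + (ζ₁ * (0ℚ * κ + 0ℚ * ω) + ζ₂ * (0ℚ * ω + δ * (0ℚ * κ)))) ≡ f
    σ₂ = solve-∀ ℚ-acr

    σ₃ : ∀ β γ κ {δ ω} g h → δ ≡ β * β + γ * γ → ω ≡ - (β * κ) → κ * γ ≡ 1ℚ →
      0ℚ + (((g - β * (κ * h)) * ω + δ * (- (κ * h) * κ)) + (0ℚ * 0ℚ + δ * (0ℚ * 0ℚ))) ≡ - h - β * (κ * g)
    σ₃ β γ κ g h refl refl κγ = trans (lem₀ β γ κ g h) (trans (cong (λ t → - (t * t * h) - β * (κ * g)) κγ) (lem₁ β κ g h))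
      where
      lem₀ : ∀ β γ κ g h → 0ℚ + (((g - β * (κ * h)) * (- (β * κ)) + (β * β + γ * γ) * (- (κ * h) * κ)) + (0ℚ * 0ℚ + (β * β + γ * γ) * (0ℚ * 0ℚ)))
        ≡ - ((κ * γ) * (κ * γ) * h) - β * (κ * g)
      lem₀ = solve-∀ ℚ-acr
      lem₁ : ∀ β κ g h → - (1ℚ * 1ℚ * h) - β * (κ * g) ≡ - h - β * (κ * g)
      lem₁ = solve-∀ ℚ-acr

    σ₄ : ∀ β κ {ω} g h → ω ≡ - (β * κ) →
      0ℚ + (((g - β * (κ * h)) * κ + - (κ * h) * ω) + (0ℚ * 0ℚ + 0ℚ * 0ℚ)) ≡ κ * g
    σ₄ β κ g h refl = lem β κ g h
      where
      lem : ∀ β κ g h → 0ℚ + (((g - β * (κ * h)) * κ + - (κ * h) * (- (β * κ))) + (0ℚ * 0ℚ + 0ℚ * 0ℚ)) ≡ κ * g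
      lem = solve-∀ ℚ-acr

    ratio : ∀ ω β κ γ → ω * γ ≡ - β → κ * γ ≡ 1ℚ → ω ≡ - (β * κ)
    ratio ω β κ γ ωγ κγ = trans (lem₁ ω) (trans (cong (ω *_) (sym κγ))
      (trans (lem₂ ω κ γ) (trans (cong (κ *_) ωγ) (lem₃ κ β))))
      where
      lem₁ : ∀ x → x ≡ x * 1ℚ
      lem₁ = solve-∀ ℚ-acr
      lem₂ : ∀ x k g → x * (k * g) ≡ k * (x * g)
      lem₂ = solve-∀ ℚ-acr
      lem₃ : ∀ k b → k * - b ≡ - (b * k)
      lem₃ = solve-∀ ℚ-acr

  module Coordinates (a : ℤ) (b₀ c₀ : ℕ) .{{_ : NonZero c₀}} where
    open CyclicQuartic a b₀ c₀ using (d)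

    α β γ′ κ δ ω : ℚ
    α = ⟪ a ⟫
    β = ⟪ + b₀ ⟫
    γ′ = ⟪ + c₀ ⟫
    κ = 1ℤ / c₀
    δ = β * β + γ′ * γ′
    ω = (ℤ.- + b₀) / c₀

    opaque
      unfolding ⟪_⟫
      κγ : κ * γ′ ≡ 1ℚ
      κγ = /-* 1ℤ c₀

      d≡δ : + d / 1 ≡ δ
      d≡δ = trans (cong ⟪_⟫ (trans (ℤₚ.pos-+ (b₀ ℕ.* b₀) (c₀ ℕ.* c₀)) (cong₂ ℤ._+_ (ℤₚ.pos-* b₀ b₀) (ℤₚ.pos-* c₀ c₀))))
              (trans (⟪⟫-+ (+ b₀ ℤ.* + b₀) (+ c₀ ℤ.* + c₀)) (cong₂ _+_ (⟪⟫-* (+ b₀) (+ b₀)) (⟪⟫-* (+ c₀) (+ c₀))))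

      ad≡ : (a ℤ.* + d) / 1 ≡ α * (+ d / 1)
      ad≡ = ⟪⟫-* a (+ d)

      ab≡ : (a ℤ.* + b₀) / 1 ≡ α * β
      ab≡ = ⟪⟫-* a (+ b₀)

      ω≡ : ω ≡ - (β * κ)
      ω≡ = ratio ω β κ γ′ (trans (/-* (ℤ.- + b₀) c₀) (⟪⟫-neg (+ b₀))) κγ

    h≡γκh : ∀ h → h ≡ γ′ * (κ * h)
    h≡γκh h = trans (lem₁ h) (trans (cong (_* h) (sym κγ)) (lem₂ h κ γ′))
      where
      lem₁ : ∀ x → x ≡ 1ℚ * x
      lem₁ = solve-∀ ℚ-acr
      lem₂ : ∀ h k g → (k * g) * h ≡ g * (k * h)
      lem₂ = solve-∀ ℚ-acr

  -- An opaque copy of L, on which the type checker does not unfold products.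
  module OpaqueRing (a : ℤ) (b₀ c₀ : ℕ) .{{_ : NonZero c₀}} where
    open Coordinates a b₀ c₀
    private
      module C = CyclicQuartic a b₀ c₀
      module L = CommutativeRing C.L

    opaque
      𝕃 : CommutativeRing 0ℓ 0ℓ
      𝕃 = C.L

    private module 𝕃 = CommutativeRing 𝕃

    opaque
      unfolding 𝕃

      to𝕃 : L.Carrier → 𝕃.Carrier
      to𝕃 x = x

      from𝕃 : 𝕃.Carrier → L.Carrier
      from𝕃 x = x

      σ′ : 𝕃.Carrier → 𝕃.Carrier
      σ′ = C.σ

      -- e + f √d + g z + h w, since w = ((√d − b₀)/c₀) z.
      mk : ℚ → ℚ → ℚ → ℚ → 𝕃.Carrier
      mk e f g h = (e , f) , (g - β * (κ * h) , κ * h)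

      ≈⇒≡ : ∀ {x y} → x 𝕃.≈ y → x ≡ y
      ≈⇒≡ ((refl , refl) , (refl , refl)) = refl

      mk-surjective : ∀ x → ∃[ e ] ∃[ f ] ∃[ g ] ∃[ h ] mk e f g h ≡ x
      mk-surjective ((P , Q) , (R , S)) = P , Q , R + β * S , γ′ * S ,
        cong₂ (λ r s → ((P , Q) , (r , s))) (trans (cong (λ t → R + β * S - β * t) κγS) (lem R (β * S))) κγS
        where
        lem : ∀ r t → r + t - t ≡ r
        lem = solve-∀ ℚ-acr
        lem₁ : ∀ k g s → k * (g * s) ≡ (k * g) * s
        lem₁ = solve-∀ ℚ-acr
        lem₂ : ∀ x → 1ℚ * x ≡ x
        lem₂ = solve-∀ ℚ-acr
        κγS : κ * (γ′ * S) ≡ S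
        κγS = trans (lem₁ κ γ′ S) (trans (cong (_* S) κγ) (lem₂ S))

      mk-injective : ∀ {e f g h e′ f′ g′ h′} → mk e f g h ≡ mk e′ f′ g′ h′ →
                     e ≡ e′ × f ≡ f′ × g ≡ g′ × h ≡ h′
      mk-injective {g = g} {h} {g′ = g′} {h′} eq = cong (λ x → proj₁ (proj₁ x)) eq , cong (λ x → proj₂ (proj₁ x)) eq , g≡ , h≡
        where
        r : g - β * (κ * h) ≡ g′ - β * (κ * h′)
        r = cong (λ x → proj₁ (proj₂ x)) eq
        s : κ * h ≡ κ * h′
        s = cong (λ x → proj₂ (proj₂ x)) eq
        h≡ : h ≡ h′
        h≡ = trans (h≡γκh h) (trans (cong (γ′ *_) s) (sym (h≡γκh h′)))
        lem : ∀ g t → g ≡ (g - t) + t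
        lem = solve-∀ ℚ-acr
        g≡ : g ≡ g′
        g≡ = trans (lem g (β * (κ * h))) (trans (cong₂ _+_ r (cong (β *_) s)) (sym (lem g′ (β * (κ * h′)))))

      mk-* : ∀ e f g h e′ f′ g′ h′ → mk e f g h 𝕃.* mk e′ f′ g′ h′ ≡
        mk (e * e′ + δ * (f * f′) + α * δ * (g * g′ + h * h′))
           (e * f′ + f * e′ + α * (β * (g * g′ - h * h′) + γ′ * (g * h′ + h * g′)))
           (e * g′ + g * e′ + f * (β * g′ + γ′ * h′) + f′ * (β * g + γ′ * h))
           (e * h′ + h * e′ + f * (γ′ * g′ - β * h′) + f′ * (γ′ * g - β * h))
      mk-* e f g h e′ f′ g′ h′ = cong₂ _,_
        (cong₂ _,_ (mul₁ α β γ′ e f g (κ * h) e′ f′ g′ (κ * h′) d≡δ ad≡ ab≡ (h≡γκh h) (h≡γκh h′))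
                   (mul₂ α β γ′ e f g (κ * h) e′ f′ g′ (κ * h′) d≡δ ad≡ ab≡ (h≡γκh h) (h≡γκh h′)))
        (cong₂ _,_ (mul₃ β γ′ κ e f g (κ * h) e′ f′ g′ (κ * h′) d≡δ κγ (h≡γκh h) (h≡γκh h′))
                   (mul₄ β γ′ κ e f g (κ * h) e′ f′ g′ (κ * h′) κγ (h≡γκh h) (h≡γκh h′)))

      σ-mk : ∀ e f g h → σ′ (mk e f g h) ≡ mk e (- f) (- h) g
      σ-mk e f g h = cong₂ _,_
        (cong₂ _,_ (σ₁ κ (+ C.d / 1) ((a ℤ.* + C.d) / 1) ((a ℤ.* + b₀) / 1) e (g - β * (κ * h)) (κ * h) ((ℤ.- + b₀) / c₀))
                   (σ₂ κ (+ C.d / 1) ((a ℤ.* + C.d) / 1) ((a ℤ.* + b₀) / 1) (- f) (g - β * (κ * h)) (κ * h) ((ℤ.- + b₀) / c₀)))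
        (cong₂ _,_ (σ₃ β γ′ κ g h d≡δ ω≡ κγ) (σ₄ β κ g h ω≡))

      mk-+ : ∀ e f g h e′ f′ g′ h′ → mk e f g h 𝕃.+ mk e′ f′ g′ h′ ≡ mk (e + e′) (f + f′) (g + g′) (h + h′)
      mk-+ e f g h e′ f′ g′ h′ = cong₂ (λ r s → ((e + e′ , f + f′) , (r , s))) (lem₁ β κ g h g′ h′) (lem₂ κ h h′)
        where
        lem₁ : ∀ β κ g h g′ h′ → (g - β * (κ * h)) + (g′ - β * (κ * h′)) ≡ (g + g′) - β * (κ * (h + h′))
        lem₁ = solve-∀ ℚ-acr
        lem₂ : ∀ κ h h′ → κ * h + κ * h′ ≡ κ * (h + h′)
        lem₂ = solve-∀ ℚ-acr

      mk-neg : ∀ e f g h → 𝕃.- mk e f g h ≡ mk (- e) (- f) (- g) (- h)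
      mk-neg e f g h = cong₂ (λ r s → ((- e , - f) , (r , s))) (lem₁ β κ g h) (lem₂ κ h)
        where
        lem₁ : ∀ β κ g h → - (g - β * (κ * h)) ≡ - g - β * (κ * - h)
        lem₁ = solve-∀ ℚ-acr
        lem₂ : ∀ κ h → - (κ * h) ≡ κ * - h
        lem₂ = solve-∀ ℚ-acr

      to-from : ∀ x → to𝕃 (from𝕃 x) ≡ x
      to-from x = refl

      to-≈ : ∀ {x y} → x L.≈ y → to𝕃 x ≡ to𝕃 y
      to-≈ ((refl , refl) , (refl , refl)) = refl

      to-injective : ∀ {x y} → to𝕃 x ≡ to𝕃 y → x L.≈ y
      to-injective = L.reflexive

      to-+ : ∀ x y → to𝕃 (x L.+ y) ≡ to𝕃 x 𝕃.+ to𝕃 y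
      to-+ x y = refl

      to-* : ∀ x y → to𝕃 (x L.* y) ≡ to𝕃 x 𝕃.* to𝕃 y
      to-* x y = refl

      to-neg : ∀ x → to𝕃 (L.- x) ≡ 𝕃.- to𝕃 x
      to-neg x = refl

      to-ι : ∀ q → to𝕃 (C.ι q) ≡ mk q 0ℚ 0ℚ 0ℚ
      to-ι q = cong₂ (λ r s → ((q , 0ℚ) , (r , s))) (lem₁ β κ) (lem₂ κ)
        where
        lem₁ : ∀ β κ → 0ℚ ≡ 0ℚ - β * (κ * 0ℚ)
        lem₁ = solve-∀ ℚ-acr
        lem₂ : ∀ κ → 0ℚ ≡ κ * 0ℚ
        lem₂ = solve-∀ ℚ-acr

      to-1 : to𝕃 L.1# ≡ mk 1ℚ 0ℚ 0ℚ 0ℚ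
      to-1 = to-ι 1ℚ

      to-0 : to𝕃 L.0# ≡ mk 0ℚ 0ℚ 0ℚ 0ℚ
      to-0 = to-ι 0ℚ

      1-mk : 𝕃.1# ≡ mk 1ℚ 0ℚ 0ℚ 0ℚ
      1-mk = to-ι 1ℚ

      0-mk : 𝕃.0# ≡ mk 0ℚ 0ℚ 0ℚ 0ℚ
      0-mk = to-ι 0ℚ

      to-√d : to𝕃 C.√d ≡ mk 0ℚ 1ℚ 0ℚ 0ℚ
      to-√d = cong₂ (λ r s → ((0ℚ , 1ℚ) , (r , s))) (lem₁ β κ) (lem₂ κ)
        where
        lem₁ : ∀ β κ → 0ℚ ≡ 0ℚ - β * (κ * 0ℚ)
        lem₁ = solve-∀ ℚ-acr
        lem₂ : ∀ κ → 0ℚ ≡ κ * 0ℚ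
        lem₂ = solve-∀ ℚ-acr

      to-z : to𝕃 C.z ≡ mk 0ℚ 0ℚ 1ℚ 0ℚ
      to-z = cong₂ (λ r s → ((0ℚ , 0ℚ) , (r , s))) (lem₁ β κ) (lem₂ κ)
        where
        lem₁ : ∀ β κ → 1ℚ ≡ 1ℚ - β * (κ * 0ℚ)
        lem₁ = solve-∀ ℚ-acr
        lem₂ : ∀ κ → 0ℚ ≡ κ * 0ℚ
        lem₂ = solve-∀ ℚ-acr

      to-w : to𝕃 C.w ≡ mk 0ℚ 0ℚ 0ℚ 1ℚ
      to-w = cong₂ (λ r s → ((0ℚ , 0ℚ) , (r , s))) (trans ω≡ (lem₁ β κ)) (lem₂ κ)
        where
        lem₁ : ∀ β κ → - (β * κ) ≡ 0ℚ - β * (κ * 1ℚ)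
        lem₁ = solve-∀ ℚ-acr
        lem₂ : ∀ κ → κ ≡ κ * 1ℚ
        lem₂ = solve-∀ ℚ-acr

    mkⱽ : V → 𝕃.Carrier
    mkⱽ (v e f g h) = mk e f g h

    evalMonic′ : List ℤ → 𝕃.Carrier → 𝕃.Carrier
    evalMonic′ []       x = 𝕃.1#
    evalMonic′ (k ∷ ks) x = mk ⟪ k ⟫ 0ℚ 0ℚ 0ℚ 𝕃.+ x 𝕃.* evalMonic′ ks x

    IsIntegral′ : 𝕃.Carrier → Set
    IsIntegral′ x = ∃[ ks ] evalMonic′ ks x ≡ 𝕃.0#

    to-evalMonic : ∀ ks x → to𝕃 (C.evalMonic ks x) ≡ evalMonic′ ks (to𝕃 x)
    to-evalMonic []       x = trans to-1 (sym 1-mk)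
    to-evalMonic (k ∷ ks) x = trans (to-+ (C.ιᶻ k) (x L.* C.evalMonic ks x)) (cong₂ 𝕃._+_
      (trans (to-ι (k / 1)) (cong (λ r → mk r 0ℚ 0ℚ 0ℚ) (sym (⟪⟫≡/1 k))))
      (trans (to-* x (C.evalMonic ks x)) (cong (to𝕃 x 𝕃.*_) (to-evalMonic ks x))))

    integral-to : ∀ {x} → C.IsIntegral x → IsIntegral′ (to𝕃 x)
    integral-to {x} (ks , root) = ks , trans (sym (to-evalMonic ks x)) (trans (to-≈ root) (trans to-0 (sym 0-mk)))

    integral-from : ∀ {x} → IsIntegral′ (to𝕃 x) → C.IsIntegral x
    integral-from {x} (ks , root) = ks , to-injective (trans (to-evalMonic ks x) (trans root (trans 0-mk (sym to-0))))

    hopf : (p q r t : ℚ) → 𝕃.Carrier → 𝕃.Carrier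
    hopf p q r t x = to𝕃 (C.ι p) 𝕃.* x
               𝕃.+ to𝕃 (C.ι q) 𝕃.* σ′ (σ′ x)
               𝕃.+ to𝕃 (C.ι r) 𝕃.* (σ′ x 𝕃.+ σ′ (σ′ (σ′ x)))
               𝕃.+ to𝕃 (C.ι t) 𝕃.* (to𝕃 C.√d 𝕃.* (σ′ x 𝕃.- σ′ (σ′ (σ′ x))))

    hopfᴸ : (p q r t : ℚ) → L.Carrier → L.Carrier
    hopfᴸ p q r t x = C.ι p L.* x
                L.+ C.ι q L.* C.σ (C.σ x)
                L.+ C.ι r L.* (C.σ x L.+ C.σ (C.σ (C.σ x)))
                L.+ C.ι t L.* (C.√d L.* (C.σ x L.- C.σ (C.σ (C.σ x))))

    opaque
      unfolding 𝕃 to𝕃 σ′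

      to-hopf : ∀ p q r t x → to𝕃 (hopfᴸ p q r t x) ≡ hopf p q r t (to𝕃 x)
      to-hopf p q r t x = refl

    InH⇒hopf : ∀ {h} → ((p , q , r , t , _) : C.InH h) → ∀ x → to𝕃 (h x) ≡ hopf p q r t (to𝕃 x)
    InH⇒hopf (p , q , r , t , eq) x = trans (to-≈ (eq x)) (to-hopf p q r t x)

    hopf-InH : ∀ p q r t → C.InH (hopfᴸ p q r t)
    hopf-InH p q r t = p , q , r , t , λ x → L.refl

open QuarticField

-- Integral elements have bounded denominators

module Integrality (a : ℤ) (b₀ c₀ : ℕ) .{{_ : NonZero c₀}} where
  open import Data.Rational.Base hiding (NonZero)
  open Coordinates a b₀ c₀ using (α; β; γ′; δ)
  open OpaqueRing a b₀ c₀
  private module L = CommutativeRing 𝕃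

  mk-cong : ∀ {e f g h e′ f′ g′ h′} → e ≡ e′ → f ≡ f′ → g ≡ g′ → h ≡ h′ → mk e f g h ≡ mk e′ f′ g′ h′
  mk-cong refl refl refl refl = refl

  -- The relative norm to ℚ(√d) of mk e f g h is N₀ + N₁ √d.
  N₀ N₁ : (e f g h : ℚ) → ℚ
  N₀ e f g h = e * e + δ * (f * f) - α * δ * (g * g + h * h)
  N₁ e f g h = 2ℚ * (e * f) - α * (β * (g * g - h * h) + 2ℚ * γ′ * (g * h))

  opaque
    scale : ∀ q e f g h → mk q 0ℚ 0ℚ 0ℚ L.* mk e f g h ≡ mk (q * e) (q * f) (q * g) (q * h)
    scale q e f g h = trans (mk-* q 0ℚ 0ℚ 0ℚ e f g h)
      (mk-cong (lem₁ q e f g h δ α) (lem₂ q e f g h α β γ′) (lem₃ q e f g h β γ′) (lem₄ q e f g h β γ′))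
      where
      lem₁ : ∀ q e f g h δ α → q * e + δ * (0ℚ * f) + α * δ * (0ℚ * g + 0ℚ * h) ≡ q * e
      lem₁ = solve-∀ ℚ-acr
      lem₂ : ∀ q e f g h α β γ → q * f + 0ℚ * e + α * (β * (0ℚ * g - 0ℚ * h) + γ * (0ℚ * h + 0ℚ * g)) ≡ q * f
      lem₂ = solve-∀ ℚ-acr
      lem₃ : ∀ q e f g h β γ → q * g + 0ℚ * e + 0ℚ * (β * g + γ * h) + f * (β * 0ℚ + γ * 0ℚ) ≡ q * g
      lem₃ = solve-∀ ℚ-acr
      lem₄ : ∀ q e f g h β γ → q * h + 0ℚ * e + 0ℚ * (γ * g - β * h) + f * (γ * 0ℚ - β * 0ℚ) ≡ q * h
      lem₄ = solve-∀ ℚ-acr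

    σ-*-mk : ∀ e f g h e′ f′ g′ h′ → σ′ (mk e f g h L.* mk e′ f′ g′ h′) ≡ σ′ (mk e f g h) L.* σ′ (mk e′ f′ g′ h′)
    σ-*-mk e f g h e′ f′ g′ h′ = trans (cong σ′ (mk-* e f g h e′ f′ g′ h′))
      (trans (σ-mk (e * e′ + δ * (f * f′) + α * δ * (g * g′ + h * h′))
                   (e * f′ + f * e′ + α * (β * (g * g′ - h * h′) + γ′ * (g * h′ + h * g′)))
                   (e * g′ + g * e′ + f * (β * g′ + γ′ * h′) + f′ * (β * g + γ′ * h))
                   (e * h′ + h * e′ + f * (γ′ * g′ - β * h′) + f′ * (γ′ * g - β * h)))
      (trans (mk-cong (lem₁ e f g h e′ f′ g′ h′ δ α) (lem₂ e f g h e′ f′ g′ h′ α β γ′)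
                      (lem₃ e f g h e′ f′ g′ h′ β γ′) (lem₄ e f g h e′ f′ g′ h′ β γ′))
      (sym (trans (cong₂ L._*_ (σ-mk e f g h) (σ-mk e′ f′ g′ h′)) (mk-* e (- f) (- h) g e′ (- f′) (- h′) g′)))))
      where
      lem₁ : ∀ e f g h e′ f′ g′ h′ δ α →
        e * e′ + δ * (f * f′) + α * δ * (g * g′ + h * h′) ≡
        e * e′ + δ * (- f * - f′) + α * δ * (- h * - h′ + g * g′)
      lem₁ = solve-∀ ℚ-acr
      lem₂ : ∀ e f g h e′ f′ g′ h′ α β γ →
        - (e * f′ + f * e′ + α * (β * (g * g′ - h * h′) + γ * (g * h′ + h * g′))) ≡
        e * - f′ + - f * e′ + α * (β * (- h * - h′ - g * g′) + γ * (- h * g′ + g * - h′))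
      lem₂ = solve-∀ ℚ-acr
      lem₃ : ∀ e f g h e′ f′ g′ h′ β γ →
        - (e * h′ + h * e′ + f * (γ * g′ - β * h′) + f′ * (γ * g - β * h)) ≡
        e * - h′ + - h * e′ + - f * (β * - h′ + γ * g′) + - f′ * (β * - h + γ * g)
      lem₃ = solve-∀ ℚ-acr
      lem₄ : ∀ e f g h e′ f′ g′ h′ β γ →
        e * g′ + g * e′ + f * (β * g′ + γ * h′) + f′ * (β * g + γ * h) ≡
        e * g′ + g * e′ + - f * (γ * - h′ - β * g′) + - f′ * (γ * - h - β * g)
      lem₄ = solve-∀ ℚ-acr

    σ-* : ∀ x y → σ′ (x L.* y) ≡ σ′ x L.* σ′ y
    σ-* x y =
      let e , f , g , h , p = mk-surjective x
          e′ , f′ , g′ , h′ , q = mk-surjective y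
      in subst₂ (λ x y → σ′ (x L.* y) ≡ σ′ x L.* σ′ y) p q (σ-*-mk e f g h e′ f′ g′ h′)

    σ²-mk : ∀ e f g h → σ′ (σ′ (mk e f g h)) ≡ mk e f (- g) (- h)
    σ²-mk e f g h = trans (cong σ′ (σ-mk e f g h)) (trans (σ-mk e (- f) (- h) g) (mk-cong refl (lem f) refl refl))
      where
      lem : ∀ f → - - f ≡ f
      lem = solve-∀ ℚ-acr

    K-* : ∀ p q r t → mk p q 0ℚ 0ℚ L.* mk r t 0ℚ 0ℚ ≡ mk (p * r + δ * (q * t)) (p * t + q * r) 0ℚ 0ℚ
    K-* p q r t = trans (mk-* p q 0ℚ 0ℚ r t 0ℚ 0ℚ)
      (mk-cong (lem₁ p q r t δ α) (lem₂ p q r t α β γ′) (lem₃ p q r t β γ′) (lem₄ p q r t β γ′))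
      where
      lem₁ : ∀ p q r t δ α → p * r + δ * (q * t) + α * δ * (0ℚ * 0ℚ + 0ℚ * 0ℚ) ≡ p * r + δ * (q * t)
      lem₁ = solve-∀ ℚ-acr
      lem₂ : ∀ p q r t α β γ → p * t + q * r + α * (β * (0ℚ * 0ℚ - 0ℚ * 0ℚ) + γ * (0ℚ * 0ℚ + 0ℚ * 0ℚ)) ≡ p * t + q * r
      lem₂ = solve-∀ ℚ-acr
      lem₃ : ∀ p q r t β γ → p * 0ℚ + 0ℚ * r + q * (β * 0ℚ + γ * 0ℚ) + t * (β * 0ℚ + γ * 0ℚ) ≡ 0ℚ
      lem₃ = solve-∀ ℚ-acr
      lem₄ : ∀ p q r t β γ → p * 0ℚ + 0ℚ * r + q * (γ * 0ℚ - β * 0ℚ) + t * (γ * 0ℚ - β * 0ℚ) ≡ 0ℚ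
      lem₄ = solve-∀ ℚ-acr

    norm-mk : ∀ e f g h → mk e f g h L.* mk e f (- g) (- h) ≡ mk (N₀ e f g h) (N₁ e f g h) 0ℚ 0ℚ
    norm-mk e f g h = trans (mk-* e f g h e f (- g) (- h))
      (mk-cong (lem₁ e f g h δ α) (lem₂ e f g h α β γ′) (lem₃ e f g h β γ′) (lem₄ e f g h β γ′))
      where
      lem₁ : ∀ e f g h δ α → e * e + δ * (f * f) + α * δ * (g * - g + h * - h) ≡
                             e * e + δ * (f * f) - α * δ * (g * g + h * h)
      lem₁ = solve-∀ ℚ-acr
      lem₂ : ∀ e f g h α β γ → e * f + f * e + α * (β * (g * - g - h * - h) + γ * (g * - h + h * - g)) ≡
                               2ℚ * (e * f) - α * (β * (g * g - h * h) + 2ℚ * γ * (g * h))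
      lem₂ = solve-∀ ℚ-acr
      lem₃ : ∀ e f g h β γ → e * - g + g * e + f * (β * - g + γ * - h) + f * (β * g + γ * h) ≡ 0ℚ
      lem₃ = solve-∀ ℚ-acr
      lem₄ : ∀ e f g h β γ → e * - h + h * e + f * (γ * - g - β * - h) + f * (γ * g - β * h) ≡ 0ℚ
      lem₄ = solve-∀ ℚ-acr

    plane-σ : ∀ g h → mk 0ℚ 0ℚ g h L.* mk 0ℚ 0ℚ (- h) g ≡ mk 0ℚ (α * (γ′ * (g * g - h * h) - 2ℚ * β * (g * h))) 0ℚ 0ℚ
    plane-σ g h = trans (mk-* 0ℚ 0ℚ g h 0ℚ 0ℚ (- h) g)
      (mk-cong (lem₁ g h δ α) (lem₂ g h α β γ′) (lem₃ g h β γ′) (lem₄ g h β γ′))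
      where
      lem₁ : ∀ g h δ α → 0ℚ * 0ℚ + δ * (0ℚ * 0ℚ) + α * δ * (g * - h + h * g) ≡ 0ℚ
      lem₁ = solve-∀ ℚ-acr
      lem₂ : ∀ g h α β γ → 0ℚ * 0ℚ + 0ℚ * 0ℚ + α * (β * (g * - h - h * g) + γ * (g * g + h * - h)) ≡
                           α * (γ * (g * g - h * h) - 2ℚ * β * (g * h))
      lem₂ = solve-∀ ℚ-acr
      lem₃ : ∀ g h β γ → 0ℚ * - h + g * 0ℚ + 0ℚ * (β * - h + γ * g) + 0ℚ * (β * g + γ * h) ≡ 0ℚ
      lem₃ = solve-∀ ℚ-acr
      lem₄ : ∀ g h β γ → 0ℚ * g + h * 0ℚ + 0ℚ * (γ * - h - β * g) + 0ℚ * (γ * g - β * h) ≡ 0ℚ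
      lem₄ = solve-∀ ℚ-acr

    mk-+K : ∀ p q r t → mk p q 0ℚ 0ℚ L.+ mk r t 0ℚ 0ℚ ≡ mk (p + r) (q + t) 0ℚ 0ℚ
    mk-+K p q r t = mk-+ p q 0ℚ 0ℚ r t 0ℚ 0ℚ

    relTrace : ∀ e f g h → mk e f g h L.+ mk e f (- g) (- h) ≡ mk (2ℚ * e) (2ℚ * f) 0ℚ 0ℚ
    relTrace e f g h = trans (mk-+ e f g h e f (- g) (- h)) (mk-cong (lem₁ e) (lem₁ f) (lem₂ g) (lem₂ h))
      where
      lem₁ : ∀ e → e + e ≡ 2ℚ * e
      lem₁ = solve-∀ ℚ-acr
      lem₂ : ∀ e → e + - e ≡ 0ℚ
      lem₂ = solve-∀ ℚ-acr

    relAntiTrace : ∀ e f g h → mk e f g h L.- mk e f (- g) (- h) ≡ mk 0ℚ 0ℚ (2ℚ * g) (2ℚ * h)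
    relAntiTrace e f g h = trans (cong (λ t → mk e f g h L.+ t) (mk-neg e f (- g) (- h)))
      (trans (mk-+ e f g h (- e) (- f) (- - g) (- - h)) (mk-cong (lem₂ e) (lem₂ f) (lem₁ g) (lem₁ h)))
      where
      lem₁ : ∀ e → e + - - e ≡ 2ℚ * e
      lem₁ = solve-∀ ℚ-acr
      lem₂ : ∀ e → e + - e ≡ 0ℚ
      lem₂ = solve-∀ ℚ-acr

  -- An order: the structure constants for 1, √d, z, w are integers. It is stable under σ, which
  -- permutes these elements up to sign, and so almost integrality over it passes to conjugates.
  record M (x : L.Carrier) : Set where
    constructor inM
    field
      {e f g h} : ℚ
      e∈Z : Z e
      f∈Z : Z f
      g∈Z : Z g
      h∈Z : Z h
      coords : mk e f g h ≡ x

  record Denominator (D : L.Carrier) : Set where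
    constructor denominator
    field
      m : ℤ
      m≢0 : ℤ.NonZero m
      coords : mk ⟪ m ⟫ 0ℚ 0ℚ 0ℚ ≡ D

  zα : Z α
  zα = ⟪⟫∈Z a
  zβ : Z β
  zβ = ⟪⟫∈Z (+ b₀)
  zγ : Z γ′
  zγ = ⟪⟫∈Z (+ c₀)
  zδ : Z δ
  zδ = zβ ⊗ zβ ⊕ zγ ⊗ zγ

  M-resp : ∀ {x y} → x L.≈ y → M x → M y
  M-resp x≈y = subst M (≈⇒≡ x≈y)

  M-+ : ∀ {x y} → M x → M y → M (x L.+ y)
  M-+ (inM {e} {f} {g} {h} ze zf zg zh refl) (inM {e′} {f′} {g′} {h′} ze′ zf′ zg′ zh′ refl) =
    inM (ze ⊕ ze′) (zf ⊕ zf′) (zg ⊕ zg′) (zh ⊕ zh′) (sym (mk-+ e f g h e′ f′ g′ h′))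

  M-neg : ∀ {x} → M x → M (L.- x)
  M-neg (inM {e} {f} {g} {h} ze zf zg zh refl) =
    inM (⊝ ze) (⊝ zf) (⊝ zg) (⊝ zh) (sym (mk-neg e f g h))

  M-* : ∀ {x y} → M x → M y → M (x L.* y)
  M-* (inM {e} {f} {g} {h} ze zf zg zh refl) (inM {e′} {f′} {g′} {h′} ze′ zf′ zg′ zh′ refl) =
    inM (ze ⊗ ze′ ⊕ zδ ⊗ (zf ⊗ zf′) ⊕ zα ⊗ zδ ⊗ (zg ⊗ zg′ ⊕ zh ⊗ zh′))
    (ze ⊗ zf′ ⊕ zf ⊗ ze′ ⊕ zα ⊗ (zβ ⊗ (zg ⊗ zg′ ⊖ zh ⊗ zh′) ⊕ zγ ⊗ (zg ⊗ zh′ ⊕ zh ⊗ zg′)))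
    (ze ⊗ zg′ ⊕ zg ⊗ ze′ ⊕ zf ⊗ (zβ ⊗ zg′ ⊕ zγ ⊗ zh′) ⊕ zf′ ⊗ (zβ ⊗ zg ⊕ zγ ⊗ zh))
    (ze ⊗ zh′ ⊕ zh ⊗ ze′ ⊕ zf ⊗ (zγ ⊗ zg′ ⊖ zβ ⊗ zh′) ⊕ zf′ ⊗ (zγ ⊗ zg ⊖ zβ ⊗ zh))
    (sym (mk-* e f g h e′ f′ g′ h′))

  M-1 : M L.1#
  M-1 = inM 1∈Z 0∈Z 0∈Z 0∈Z (sym 1-mk)

  Den⊆M : ∀ {D} → Denominator D → M D
  Den⊆M (denominator m _ eq) = inM (⟪⟫∈Z m) 0∈Z 0∈Z 0∈Z eq

  *0 : ∀ x → x * 0ℚ ≡ 0ℚ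
  *0 = solve-∀ ℚ-acr

  Den-* : ∀ {D E} → Denominator D → Denominator E → Denominator (D L.* E)
  Den-* (denominator m m≢0 refl) (denominator n n≢0 refl) = denominator (m ℤ.* n) (ℤₚ.i*j≢0 m n {{m≢0}} {{n≢0}})
    (trans (mk-cong (⟪⟫-* m n) (sym (*0 ⟪ m ⟫)) (sym (*0 ⟪ m ⟫)) (sym (*0 ⟪ m ⟫))) (sym (scale ⟪ m ⟫ ⟪ n ⟫ 0ℚ 0ℚ 0ℚ)))

  Den-1 : Denominator L.1#
  Den-1 = denominator 1ℤ _ (trans (mk-cong ⟪1⟫≡1 refl refl refl) (sym 1-mk))

  open RingLemmas.AlmostIntegrality 𝕃 M M-resp M-+ M-* M-neg M-1 Denominator Den⊆M Den-* Den-1 public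
    renaming (_^_ to _^ᴸ_)

  rational : ℤ → L.Carrier
  rational k = mk ⟪ k ⟫ 0ℚ 0ℚ 0ℚ

  integral⇒AI-mk : ∀ e f g h → IsIntegral′ (mk e f g h) → AlmostIntegral (mk e f g h)
  integral⇒AI-mk e f g h (ks , root) =
    monic⇒AI (mk ⟪ D ⟫ 0ℚ 0ℚ 0ℚ) (denominator D D≢0 refl)
      (inM zDe zDf zDg zDh (sym (scale ⟪ D ⟫ e f g h)))
      (map rational ks) (coeffs ks) (L.reflexive (trans (monic≡ ks) root))
    where
    open Monic (mk e f g h)
    monic≡ : ∀ ks → monic (map rational ks) ≡ evalMonic′ ks (mk e f g h)
    monic≡ []       = refl
    monic≡ (k ∷ ks) = cong (λ t → rational k L.+ mk e f g h L.* t) (monic≡ ks)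
    coeffs : ∀ ks → ListAll.All M (map rational ks)
    coeffs []       = []
    coeffs (k ∷ ks) = inM (⟪⟫∈Z k) 0∈Z 0∈Z 0∈Z refl ∷ coeffs ks
    D : ℤ
    D = ↧ e ℤ.* ↧ f ℤ.* (↧ g ℤ.* ↧ h)
    D≢0 : ℤ.NonZero D
    D≢0 = ℤₚ.i*j≢0 (↧ e ℤ.* ↧ f) (↧ g ℤ.* ↧ h) {{ℤₚ.i*j≢0 (↧ e) (↧ f)}} {{ℤₚ.i*j≢0 (↧ g) (↧ h)}}
    D≡ : ⟪ D ⟫ ≡ ⟪ ↧ e ⟫ * ⟪ ↧ f ⟫ * (⟪ ↧ g ⟫ * ⟪ ↧ h ⟫)
    D≡ = trans (⟪⟫-* (↧ e ℤ.* ↧ f) (↧ g ℤ.* ↧ h)) (cong₂ _*_ (⟪⟫-* (↧ e) (↧ f)) (⟪⟫-* (↧ g) (↧ h)))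
    num : ∀ r → Z (r * ⟪ ↧ r ⟫)
    num r = ↥ r , den-* r
    zDe : Z (⟪ D ⟫ * e)
    zDe = subst Z (trans (lem e ⟪ ↧ e ⟫ ⟪ ↧ f ⟫ ⟪ ↧ g ⟫ ⟪ ↧ h ⟫) (cong (_* e) (sym D≡)))
            (num e ⊗ (⟪⟫∈Z (↧ f) ⊗ ⟪⟫∈Z (↧ g) ⊗ ⟪⟫∈Z (↧ h)))
      where
      lem : ∀ r e f g h → (r * e) * (f * g * h) ≡ e * f * (g * h) * r
      lem = solve-∀ ℚ-acr
    zDf : Z (⟪ D ⟫ * f)
    zDf = subst Z (trans (lem f ⟪ ↧ e ⟫ ⟪ ↧ f ⟫ ⟪ ↧ g ⟫ ⟪ ↧ h ⟫) (cong (_* f) (sym D≡)))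
            (num f ⊗ (⟪⟫∈Z (↧ e) ⊗ ⟪⟫∈Z (↧ g) ⊗ ⟪⟫∈Z (↧ h)))
      where
      lem : ∀ r e f g h → (r * f) * (e * g * h) ≡ e * f * (g * h) * r
      lem = solve-∀ ℚ-acr
    zDg : Z (⟪ D ⟫ * g)
    zDg = subst Z (trans (lem g ⟪ ↧ e ⟫ ⟪ ↧ f ⟫ ⟪ ↧ g ⟫ ⟪ ↧ h ⟫) (cong (_* g) (sym D≡)))
            (num g ⊗ (⟪⟫∈Z (↧ e) ⊗ ⟪⟫∈Z (↧ f) ⊗ ⟪⟫∈Z (↧ h)))
      where
      lem : ∀ r e f g h → (r * g) * (e * f * h) ≡ e * f * (g * h) * r
      lem = solve-∀ ℚ-acr
    zDh : Z (⟪ D ⟫ * h)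
    zDh = subst Z (trans (lem h ⟪ ↧ e ⟫ ⟪ ↧ f ⟫ ⟪ ↧ g ⟫ ⟪ ↧ h ⟫) (cong (_* h) (sym D≡)))
            (num h ⊗ (⟪⟫∈Z (↧ e) ⊗ ⟪⟫∈Z (↧ f) ⊗ ⟪⟫∈Z (↧ g)))
      where
      lem : ∀ r e f g h → (r * h) * (e * f * g) ≡ e * f * (g * h) * r
      lem = solve-∀ ℚ-acr

  integral⇒AI : ∀ x → IsIntegral′ x → AlmostIntegral x
  integral⇒AI x =
    let e , f , g , h , p = mk-surjective x
    in subst (λ x → IsIntegral′ x → AlmostIntegral x) p (integral⇒AI-mk e f g h)

  rational-^ : ∀ r n → mk r 0ℚ 0ℚ 0ℚ ^ᴸ n ≡ mk (r ^ n) 0ℚ 0ℚ 0ℚ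
  rational-^ r ℕ.zero    = 1-mk
  rational-^ r (ℕ.suc n) = trans (cong (mk r 0ℚ 0ℚ 0ℚ L.*_) (rational-^ r n))
    (trans (scale r (r ^ n) 0ℚ 0ℚ 0ℚ) (mk-cong refl (*0 r) (*0 r) (*0 r)))

  M-ℚ : ∀ r → M (mk r 0ℚ 0ℚ 0ℚ) → Z r
  M-ℚ r (inM ze _ _ _ eq) = subst Z (proj₁ (mk-injective eq)) ze

  rational-power : ∀ m r n → mk ⟪ m ⟫ 0ℚ 0ℚ 0ℚ L.* (mk r 0ℚ 0ℚ 0ℚ ^ᴸ n) ≡ mk (⟪ m ⟫ * r ^ n) 0ℚ 0ℚ 0ℚ
  rational-power m r n = trans (cong (mk ⟪ m ⟫ 0ℚ 0ℚ 0ℚ L.*_) (rational-^ r n))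
    (trans (scale ⟪ m ⟫ (r ^ n) 0ℚ 0ℚ 0ℚ) (mk-cong refl (*0 ⟪ m ⟫) (*0 ⟪ m ⟫) (*0 ⟪ m ⟫)))

  -- ℤ is completely integrally closed; the first coordinates of m rⁿ are the integers to which the
  -- descent on the denominator applies.
  AI-ℚ : ∀ r → AlmostIntegral (mk r 0ℚ 0ℚ 0ℚ) → Z r
  AI-ℚ r (almostIntegral (denominator m m≢0 refl) h) =
    bounded-powers-Z m r {{m≢0}} (λ n → M-ℚ (⟪ m ⟫ * r ^ n) (subst M (rational-power m r n) (h n)))

  σ-1 : σ′ L.1# ≡ L.1#
  σ-1 = trans (cong σ′ (1-mk)) (trans (σ-mk 1ℚ 0ℚ 0ℚ 0ℚ) (sym 1-mk))

  σ-^ : ∀ x n → σ′ (x ^ᴸ n) ≡ σ′ x ^ᴸ n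
  σ-^ x ℕ.zero    = σ-1
  σ-^ x (ℕ.suc n) = trans (σ-* x (x ^ᴸ n)) (cong (σ′ x L.*_) (σ-^ x n))

  M-σ : ∀ {x} → M x → M (σ′ x)
  M-σ (inM {e} {f} {g} {h} ze zf zg zh refl) = inM ze (⊝ zf) (⊝ zh) zg (sym (σ-mk e f g h))

  σ-scaled : ∀ m x n → σ′ (mk ⟪ m ⟫ 0ℚ 0ℚ 0ℚ L.* (x ^ᴸ n)) ≡ mk ⟪ m ⟫ 0ℚ 0ℚ 0ℚ L.* (σ′ x ^ᴸ n)
  σ-scaled m x n = trans (σ-* (mk ⟪ m ⟫ 0ℚ 0ℚ 0ℚ) (x ^ᴸ n)) (cong₂ L._*_ (σ-mk ⟪ m ⟫ 0ℚ 0ℚ 0ℚ) (σ-^ x n))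

  AI-σ : ∀ {x} → AlmostIntegral x → AlmostIntegral (σ′ x)
  AI-σ {x} (almostIntegral (denominator m m≢0 refl) h) = almostIntegral (denominator m m≢0 refl) powers
    where
    powers : ∀ n → M (mk ⟪ m ⟫ 0ℚ 0ℚ 0ℚ L.* (σ′ x ^ᴸ n))
    powers n = subst M (σ-scaled m x n) (M-σ {mk ⟪ m ⟫ 0ℚ 0ℚ 0ℚ L.* (x ^ᴸ n)} (h n))

-- Characteristic polynomials, and denominators bounded by square-freeness

module Invariants (a : ℤ) (b₀ c₀ : ℕ) .{{_ : NonZero c₀}} where
  open import Data.Rational.Base hiding (NonZero)
  open Coordinates a b₀ c₀ using (α; β; γ′; δ; d≡δ)
  open CyclicQuartic a b₀ c₀ using (d)
  open OpaqueRing a b₀ c₀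
  open Integrality a b₀ c₀
  private module L = CommutativeRing 𝕃

  -- The characteristic polynomial of mk e f g h is X⁴ − e₁X³ + e₂X² − e₃X + e₄.
  e₁ e₂ e₃ e₄ : (e f g h : ℚ) → ℚ
  e₁ e f g h = 4ℚ * e
  e₂ e f g h = 4ℚ * (e * e - δ * (f * f)) + 2ℚ * N₀ e f g h
  e₃ e f g h = 4ℚ * (e * N₀ e f g h - δ * (f * N₁ e f g h))
  e₄ e f g h = N₀ e f g h * N₀ e f g h - δ * (N₁ e f g h * N₁ e f g h)

  record CharPoly (e f g h : ℚ) : Set where
    constructor charPoly
    field
      e₁∈Z : Z (e₁ e f g h)
      e₂∈Z : Z (e₂ e f g h)
      e₃∈Z : Z (e₃ e f g h)
      e₄∈Z : Z (e₄ e f g h)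

  opaque
    neg-rational : ∀ r → mk r 0ℚ 0ℚ 0ℚ L.+ mk (- r) 0ℚ 0ℚ 0ℚ ≡ L.0#
    neg-rational r = trans (mk-+K r 0ℚ (- r) 0ℚ) (trans (mk-cong (lem r) refl refl refl) (sym 0-mk))
      where
      lem : ∀ r → r + - r ≡ 0ℚ
      lem = solve-∀ ℚ-acr

    -- Cayley-Hamilton through the tower over ℚ(√d): x is a root of X² - T X + N with T and N its
    -- relative trace and norm. Multiplying by the conjugate polynomial, with coefficients 2 e - 2 f
    -- √d and N₀ - N₁ √d, makes all coefficients rational.
    root : ∀ e f g h → mk (e₄ e f g h) 0ℚ 0ℚ 0ℚ L.+ mk e f g h L.* (mk (- e₃ e f g h) 0ℚ 0ℚ 0ℚ L.+ mk e f g h L.*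
             (mk (e₂ e f g h) 0ℚ 0ℚ 0ℚ L.+ mk e f g h L.* (mk (- e₁ e f g h) 0ℚ 0ℚ 0ℚ L.+ mk e f g h L.* L.1#))) L.≈ L.0#
    root e f g h = RingLemmas.quartic-root 𝕃 (mk e f g h) (mk e f (- g) (- h)) (mk (2ℚ * e) (- (2ℚ * f)) 0ℚ 0ℚ) (mk n₀ (- n₁) 0ℚ 0ℚ)
      (L.reflexive eq₁) (L.reflexive eq₂) (L.reflexive eq₃) (L.reflexive eq₄)
      (L.reflexive (neg-rational (e₁ e f g h))) (L.reflexive (neg-rational (e₃ e f g h)))
      where
      n₀ n₁ : ℚ
      n₀ = N₀ e f g h
      n₁ = N₁ e f g h
      T≡ : mk e f g h L.+ mk e f (- g) (- h) ≡ mk (2ℚ * e) (2ℚ * f) 0ℚ 0ℚ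
      T≡ = relTrace e f g h
      N≡ : mk e f g h L.* mk e f (- g) (- h) ≡ mk n₀ n₁ 0ℚ 0ℚ
      N≡ = norm-mk e f g h
      lem₁ : ∀ e → 4ℚ * e ≡ 2ℚ * e + 2ℚ * e
      lem₁ = solve-∀ ℚ-acr
      lem₁′ : ∀ e → 0ℚ ≡ 2ℚ * e + - (2ℚ * e)
      lem₁′ = solve-∀ ℚ-acr
      eq₁ : mk (e₁ e f g h) 0ℚ 0ℚ 0ℚ ≡ (mk e f g h L.+ mk e f (- g) (- h)) L.+ mk (2ℚ * e) (- (2ℚ * f)) 0ℚ 0ℚ
      eq₁ = sym (trans (cong (L._+ mk (2ℚ * e) (- (2ℚ * f)) 0ℚ 0ℚ) T≡)
        (trans (mk-+K (2ℚ * e) (2ℚ * f) (2ℚ * e) (- (2ℚ * f))) (mk-cong (sym (lem₁ e)) (sym (lem₁′ f)) refl refl)))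
      lem₂ : ∀ e f δ n₀ → ((2ℚ * e) * (2ℚ * e) + δ * ((2ℚ * f) * (- (2ℚ * f)))) + (n₀ + n₀) ≡ 4ℚ * (e * e - δ * (f * f)) + 2ℚ * n₀
      lem₂ = solve-∀ ℚ-acr
      lem₂′ : ∀ e f n₁ → ((2ℚ * e) * (- (2ℚ * f)) + (2ℚ * f) * (2ℚ * e)) + (n₁ + - n₁) ≡ 0ℚ
      lem₂′ = solve-∀ ℚ-acr
      eq₂ : mk (e₂ e f g h) 0ℚ 0ℚ 0ℚ ≡ (mk e f g h L.+ mk e f (- g) (- h)) L.* mk (2ℚ * e) (- (2ℚ * f)) 0ℚ 0ℚ
                                        L.+ (mk e f g h L.* mk e f (- g) (- h) L.+ mk n₀ (- n₁) 0ℚ 0ℚ)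
      eq₂ = sym (trans (cong₂ (λ t n → t L.* mk (2ℚ * e) (- (2ℚ * f)) 0ℚ 0ℚ L.+ (n L.+ mk n₀ (- n₁) 0ℚ 0ℚ)) T≡ N≡)
        (trans (cong₂ L._+_ (K-* (2ℚ * e) (2ℚ * f) (2ℚ * e) (- (2ℚ * f))) (mk-+K n₀ n₁ n₀ (- n₁)))
        (trans (mk-+K _ _ (n₀ + n₀) (n₁ + - n₁)) (mk-cong (lem₂ e f δ n₀) (lem₂′ e f n₁) refl refl))))
      lem₃ : ∀ e f δ n₀ n₁ → ((2ℚ * e) * n₀ + δ * ((2ℚ * f) * (- n₁))) + ((2ℚ * e) * n₀ + δ * ((- (2ℚ * f)) * n₁)) ≡ 4ℚ * (e * n₀ - δ * (f * n₁))
      lem₃ = solve-∀ ℚ-acr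
      lem₃′ : ∀ e f n₀ n₁ → ((2ℚ * e) * (- n₁) + (2ℚ * f) * n₀) + ((2ℚ * e) * n₁ + (- (2ℚ * f)) * n₀) ≡ 0ℚ
      lem₃′ = solve-∀ ℚ-acr
      eq₃ : mk (e₃ e f g h) 0ℚ 0ℚ 0ℚ ≡ (mk e f g h L.+ mk e f (- g) (- h)) L.* mk n₀ (- n₁) 0ℚ 0ℚ
                                        L.+ mk (2ℚ * e) (- (2ℚ * f)) 0ℚ 0ℚ L.* (mk e f g h L.* mk e f (- g) (- h))
      eq₃ = sym (trans (cong₂ (λ t n → t L.* mk n₀ (- n₁) 0ℚ 0ℚ L.+ mk (2ℚ * e) (- (2ℚ * f)) 0ℚ 0ℚ L.* n) T≡ N≡)
        (trans (cong₂ L._+_ (K-* (2ℚ * e) (2ℚ * f) n₀ (- n₁)) (K-* (2ℚ * e) (- (2ℚ * f)) n₀ n₁))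
        (trans (mk-+K _ _ ((2ℚ * e) * n₀ + δ * ((- (2ℚ * f)) * n₁)) _) (mk-cong (lem₃ e f δ n₀ n₁) (lem₃′ e f n₀ n₁) refl refl))))
      lem₄ : ∀ δ n₀ n₁ → n₀ * n₀ + δ * (n₁ * (- n₁)) ≡ n₀ * n₀ - δ * (n₁ * n₁)
      lem₄ = solve-∀ ℚ-acr
      lem₄′ : ∀ n₀ n₁ → n₀ * (- n₁) + n₁ * n₀ ≡ 0ℚ
      lem₄′ = solve-∀ ℚ-acr
      eq₄ : mk (e₄ e f g h) 0ℚ 0ℚ 0ℚ ≡ (mk e f g h L.* mk e f (- g) (- h)) L.* mk n₀ (- n₁) 0ℚ 0ℚ
      eq₄ = sym (trans (cong (L._* mk n₀ (- n₁) 0ℚ 0ℚ) N≡)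
        (trans (K-* n₀ n₁ n₀ (- n₁)) (mk-cong (lem₄ δ n₀ n₁) (lem₄′ n₀ n₁) refl refl)))

  charPoly⇒integral : ∀ e f g h → CharPoly e f g h → IsIntegral′ (mk e f g h)
  charPoly⇒integral e f g h (charPoly (m₁ , p₁) (m₂ , p₂) (m₃ , p₃) (m₄ , p₄)) =
    (m₄ ∷ ℤ.- m₃ ∷ m₂ ∷ ℤ.- m₁ ∷ []) , trans poly≡ (≈⇒≡ (root e f g h))
    where
    x : L.Carrier
    x = mk e f g h
    poly : (r₁ r₂ r₃ r₄ : ℚ) → L.Carrier
    poly r₁ r₂ r₃ r₄ = mk r₄ 0ℚ 0ℚ 0ℚ L.+ x L.* (mk r₃ 0ℚ 0ℚ 0ℚ L.+ x L.* (mk r₂ 0ℚ 0ℚ 0ℚ L.+ x L.* (mk r₁ 0ℚ 0ℚ 0ℚ L.+ x L.* L.1#)))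
    poly-cong : ∀ {r₁ r₂ r₃ r₄ s₁ s₂ s₃ s₄} → r₁ ≡ s₁ → r₂ ≡ s₂ → r₃ ≡ s₃ → r₄ ≡ s₄ → poly r₁ r₂ r₃ r₄ ≡ poly s₁ s₂ s₃ s₄
    poly-cong refl refl refl refl = refl
    poly≡ : poly ⟪ ℤ.- m₁ ⟫ ⟪ m₂ ⟫ ⟪ ℤ.- m₃ ⟫ ⟪ m₄ ⟫ ≡ poly (- e₁ e f g h) (e₂ e f g h) (- e₃ e f g h) (e₄ e f g h)
    poly≡ = poly-cong (trans (⟪⟫-neg m₁) (cong -_ (sym p₁))) (sym p₂) (trans (⟪⟫-neg m₃) (cong -_ (sym p₃))) (sym p₄)

  AI-K-trace : ∀ p q → AlmostIntegral (mk p q 0ℚ 0ℚ) → Z (2ℚ * p)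
  AI-K-trace p q ai = AI-ℚ (2ℚ * p) (subst AlmostIntegral
    (trans (cong (λ t → mk p q 0ℚ 0ℚ L.+ t) (σ-mk p q 0ℚ 0ℚ)) (trans (mk-+K p q p (- q)) (mk-cong (lem p) (lem′ q) refl refl)))
    (AI-+ ai (AI-σ ai)))
    where
    lem : ∀ p → p + p ≡ 2ℚ * p
    lem = solve-∀ ℚ-acr
    lem′ : ∀ p → p + - p ≡ 0ℚ
    lem′ = solve-∀ ℚ-acr

  AI-K-norm : ∀ p q → AlmostIntegral (mk p q 0ℚ 0ℚ) → Z (p * p - δ * (q * q))
  AI-K-norm p q ai = AI-ℚ (p * p - δ * (q * q)) (subst AlmostIntegral
    (trans (cong (λ t → mk p q 0ℚ 0ℚ L.* t) (σ-mk p q 0ℚ 0ℚ)) (trans (K-* p q p (- q)) (mk-cong (lem p q δ) (lem′ p q) refl refl)))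
    (AI-* ai (AI-σ ai)))
    where
    lem : ∀ p q δ → p * p + δ * (q * - q) ≡ p * p - δ * (q * q)
    lem = solve-∀ ℚ-acr
    lem′ : ∀ p q → p * - q + q * p ≡ 0ℚ
    lem′ = solve-∀ ℚ-acr

  module _ {e f g h : ℚ} (ai : AlmostIntegral (mk e f g h)) where

    AI-conj : AlmostIntegral (mk e f (- g) (- h))
    AI-conj = subst AlmostIntegral (σ²-mk e f g h) (AI-σ (AI-σ ai))

    AI-relTrace : AlmostIntegral (mk (2ℚ * e) (2ℚ * f) 0ℚ 0ℚ)
    AI-relTrace = subst AlmostIntegral (relTrace e f g h) (AI-+ ai AI-conj)

    AI-relNorm : AlmostIntegral (mk (N₀ e f g h) (N₁ e f g h) 0ℚ 0ℚ)
    AI-relNorm = subst AlmostIntegral (norm-mk e f g h) (AI-* ai AI-conj)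

    AI-plane : AlmostIntegral (mk 0ℚ 0ℚ (2ℚ * g) (2ℚ * h))
    AI-plane = subst AlmostIntegral (relAntiTrace e f g h) (AI-− ai AI-conj)

    AI⇒charPoly : CharPoly e f g h
    AI⇒charPoly = charPoly
      (subst Z (lem₁ e) (AI-K-trace (2ℚ * e) (2ℚ * f) AI-relTrace))
      (subst Z (lem₂ e f δ (N₀ e f g h)) (AI-K-norm (2ℚ * e) (2ℚ * f) AI-relTrace ⊕ AI-K-trace (N₀ e f g h) (N₁ e f g h) AI-relNorm))
      (subst Z (lem₃ e f δ (N₀ e f g h) (N₁ e f g h)) (AI-K-trace _ _ TσN))
      (AI-K-norm (N₀ e f g h) (N₁ e f g h) AI-relNorm)
      where
      lem₁ : ∀ e → 2ℚ * (2ℚ * e) ≡ 4ℚ * e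
      lem₁ = solve-∀ ℚ-acr
      lem₂ : ∀ e f δ n → ((2ℚ * e) * (2ℚ * e) - δ * ((2ℚ * f) * (2ℚ * f))) + 2ℚ * n ≡ 4ℚ * (e * e - δ * (f * f)) + 2ℚ * n
      lem₂ = solve-∀ ℚ-acr
      lem₃ : ∀ e f δ n m → 2ℚ * ((2ℚ * e) * n + δ * ((2ℚ * f) * - m)) ≡ 4ℚ * (e * n - δ * (f * m))
      lem₃ = solve-∀ ℚ-acr
      -- The coefficient `e₃` is the trace from ℚ(√d) to ℚ of T σ(N), with T and N the relative
      -- trace and norm.
      TσN : AlmostIntegral (mk ((2ℚ * e) * N₀ e f g h + δ * ((2ℚ * f) * - N₁ e f g h)) ((2ℚ * e) * - N₁ e f g h + (2ℚ * f) * N₀ e f g h) 0ℚ 0ℚ)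
      TσN = subst AlmostIntegral (trans (cong (λ t → mk (2ℚ * e) (2ℚ * f) 0ℚ 0ℚ L.* t) (σ-mk (N₀ e f g h) (N₁ e f g h) 0ℚ 0ℚ))
        (K-* (2ℚ * e) (2ℚ * f) (N₀ e f g h) (- N₁ e f g h))) (AI-* AI-relTrace (AI-σ AI-relNorm))

    W : ℚ
    W = α * (γ′ * ((2ℚ * g) * (2ℚ * g) - (2ℚ * h) * (2ℚ * h)) - 2ℚ * β * ((2ℚ * g) * (2ℚ * h)))

    AI-W : AlmostIntegral (mk 0ℚ W 0ℚ 0ℚ)
    AI-W = subst AlmostIntegral (trans (cong (λ t → mk 0ℚ 0ℚ (2ℚ * g) (2ℚ * h) L.* t) (σ-mk 0ℚ 0ℚ (2ℚ * g) (2ℚ * h)))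
      (plane-σ (2ℚ * g) (2ℚ * h))) (AI-* AI-plane (AI-σ AI-plane))

    AI-plane-norm : AlmostIntegral (mk (N₀ 0ℚ 0ℚ (2ℚ * g) (2ℚ * h)) (N₁ 0ℚ 0ℚ (2ℚ * g) (2ℚ * h)) 0ℚ 0ℚ)
    AI-plane-norm = subst AlmostIntegral (norm-mk 0ℚ 0ℚ (2ℚ * g) (2ℚ * h))
      (AI-* AI-plane (subst AlmostIntegral (σ²-mk 0ℚ 0ℚ (2ℚ * g) (2ℚ * h)) (AI-σ (AI-σ AI-plane))))

  module SquareFreeParameters (sf-a : SquareFree ℤ.∣ a ∣) (sf-d : SquareFree d) (coprime : ℤGCD.gcd a (+ d) ≡ 1ℤ) where

    δ≡ : ⟪ + d ⟫ ≡ δ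
    δ≡ = trans (⟪⟫≡/1 (+ d)) d≡δ

    squarefree-δ : ∀ r → Z (δ * (r * r)) → Z r
    squarefree-δ r z = squarefree-Z (+ d) r sf-d (subst (λ t → Z (t * (r * r))) (sym δ≡) z)

    -- Multiplying a d r² by a and by d gives d (a r)² and a (d r)², so a r and d r are integral
    -- because d and a are square-free. Then gcd(a, d) = 1 yields r.
    squarefree-αδ : ∀ r → Z (α * δ * (r * r)) → Z r
    squarefree-αδ r z =
      let u , w , zu , zv , eq = bezout-ℚ a (+ d) (ℕC.gcd≡1⇒coprime (ℤₚ.+-injective coprime)) in
      subst Z (trans (lem₃ u w α δ r) (trans (cong (λ t → (u * α + w * t) * r) (sym δ≡))
                (trans (cong (_* r) eq) (lem₄ r))))
        (zu ⊗ αr ⊕ zv ⊗ δr)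
      where
      lem₁ : ∀ α δ r → α * (α * δ * (r * r)) ≡ δ * ((α * r) * (α * r))
      lem₁ = solve-∀ ℚ-acr
      lem₂ : ∀ α δ r → δ * (α * δ * (r * r)) ≡ α * ((δ * r) * (δ * r))
      lem₂ = solve-∀ ℚ-acr
      lem₃ : ∀ u w α δ r → u * (α * r) + w * (δ * r) ≡ (u * α + w * δ) * r
      lem₃ = solve-∀ ℚ-acr
      lem₄ : ∀ r → 1ℚ * r ≡ r
      lem₄ = solve-∀ ℚ-acr
      αr : Z (α * r)
      αr = squarefree-δ (α * r) (subst Z (lem₁ α δ r) (zα ⊗ z))
      δr : Z (δ * r)
      δr = squarefree-Z a (δ * r) sf-a (subst Z (lem₂ α δ r) (zδ ⊗ z))

    -- The discriminant (2 p)² - 4 (p² - d q²) equals d (2 q)², and d is square-free.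
    AI-K-√d : ∀ p q → AlmostIntegral (mk p q 0ℚ 0ℚ) → Z (2ℚ * q)
    AI-K-√d p q ai = squarefree-δ (2ℚ * q) (subst Z (lem p q δ)
      (AI-K-trace p q ai ⊗ AI-K-trace p q ai ⊖ 2∈Z ⊗ 2∈Z ⊗ AI-K-norm p q ai))
      where
      lem : ∀ p q δ → (2ℚ * p) * (2ℚ * p) - 2ℚ * 2ℚ * (p * p - δ * (q * q)) ≡ δ * ((2ℚ * q) * (2ℚ * q))
      lem = solve-∀ ℚ-acr

    module _ {e f g h : ℚ} (ai : AlmostIntegral (mk e f g h)) where

      W∈Z : Z (W ai)
      W∈Z = squarefree-δ (W ai) (subst Z (lem (W ai) δ) (⊝ AI-K-norm 0ℚ (W ai) (AI-W ai)))
        where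
        lem : ∀ w δ → - (0ℚ * 0ℚ - δ * (w * w)) ≡ δ * (w * w)
        lem = solve-∀ ℚ-acr

      4e∈Z : Z (4ℚ * e)
      4e∈Z = CharPoly.e₁∈Z (AI⇒charPoly ai)

      4f∈Z : Z (4ℚ * f)
      4f∈Z = subst Z (lem f) (AI-K-√d (2ℚ * e) (2ℚ * f) (AI-relTrace ai))
        where
        lem : ∀ f → 2ℚ * (2ℚ * f) ≡ 4ℚ * f
        lem = solve-∀ ℚ-acr

      -- With v = g z + h w, the numbers v², σ(v)² and v σ(v) determine a d g² and a d h².
      4g∈Z : Z (4ℚ * g)
      4g∈Z = squarefree-αδ (4ℚ * g) (subst Z (lem α β γ′ g h)
        (⊝ AI-K-trace _ _ (AI-plane-norm ai) ⊖ zβ ⊗ AI-K-√d _ _ (AI-plane-norm ai) ⊕ 2∈Z ⊗ zγ ⊗ W∈Z))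
        where
        lem : ∀ α β γ g h →
          - (2ℚ * (0ℚ * 0ℚ + (β * β + γ * γ) * (0ℚ * 0ℚ) - α * (β * β + γ * γ) * ((2ℚ * g) * (2ℚ * g) + (2ℚ * h) * (2ℚ * h))))
          - β * (2ℚ * (2ℚ * (0ℚ * 0ℚ) - α * (β * ((2ℚ * g) * (2ℚ * g) - (2ℚ * h) * (2ℚ * h)) + 2ℚ * γ * ((2ℚ * g) * (2ℚ * h)))))
          + 2ℚ * γ * (α * (γ * ((2ℚ * g) * (2ℚ * g) - (2ℚ * h) * (2ℚ * h)) - 2ℚ * β * ((2ℚ * g) * (2ℚ * h))))
          ≡ α * (β * β + γ * γ) * ((4ℚ * g) * (4ℚ * g))
        lem = solve-∀ ℚ-acr

      4h∈Z : Z (4ℚ * h)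
      4h∈Z = squarefree-αδ (4ℚ * h) (subst Z (lem α β γ′ g h)
        (⊝ AI-K-trace _ _ (AI-plane-norm ai) ⊕ zβ ⊗ AI-K-√d _ _ (AI-plane-norm ai) ⊖ 2∈Z ⊗ zγ ⊗ W∈Z))
        where
        lem : ∀ α β γ g h →
          - (2ℚ * (0ℚ * 0ℚ + (β * β + γ * γ) * (0ℚ * 0ℚ) - α * (β * β + γ * γ) * ((2ℚ * g) * (2ℚ * g) + (2ℚ * h) * (2ℚ * h))))
          + β * (2ℚ * (2ℚ * (0ℚ * 0ℚ) - α * (β * ((2ℚ * g) * (2ℚ * g) - (2ℚ * h) * (2ℚ * h)) + 2ℚ * γ * ((2ℚ * g) * (2ℚ * h)))))
          - 2ℚ * γ * (α * (γ * ((2ℚ * g) * (2ℚ * g) - (2ℚ * h) * (2ℚ * h)) - 2ℚ * β * ((2ℚ * g) * (2ℚ * h))))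
          ≡ α * (β * β + γ * γ) * ((4ℚ * h) * (4ℚ * h))
        lem = solve-∀ ℚ-acr

-- Operators in coordinates, generators and the binary quadratic form

module AssociatedOrder where
  open import Data.Rational.Base hiding (NonZero)
  open import Data.Rational.Properties using (*-identityˡ)

  -- How the lattice meets ℚ(√d): spanned by 1 and √d (split), by 1 and (1 + √d)/2
  -- (halved), or by the latter and glued to the plane spanned by z and w (glued).
  data Kind : Set where
    split halved glued : Kind

  -- Acts as A on ℚ, as B on ℚ√d and as s + τ J on the plane, where J² = d.
  record Op : Set where
    constructor op
    field A B s τ : ℚ

  ZV : V → Set
  ZV (v e f g h) = Z e × Z f × Z g × Z h

  V≡ : ∀ {e f g h e′ f′ g′ h′} → e ≡ e′ → f ≡ f′ → g ≡ g′ → h ≡ h′ → v e f g h ≡ v e′ f′ g′ h′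
  V≡ refl refl refl refl = refl

  Op≡ : ∀ {A B s τ A′ B′ s′ τ′} → A ≡ A′ → B ≡ B′ → s ≡ s′ → τ ≡ τ′ → op A B s τ ≡ op A′ B′ s′ τ′
  Op≡ refl refl refl refl = refl

  -- J has the symmetric matrix with rows (-c, b) and (b, c), of trace 0 and determinant -(b² + c²),
  -- whence J² = b² + c². The form `Q` below is the determinant of (g , h) and J (g , h).
  plane₁ plane₂ : (b c s τ g h : ℚ) → ℚ
  plane₁ b c s τ g h = s * g + τ * (b * h - c * g)
  plane₂ b c s τ g h = s * h + τ * (b * g + c * h)

  Q : (b c g h : ℚ) → ℚ
  Q b c g h = b * (g * g) + 2ℚ * c * (g * h) - b * (h * h)

  -- Coordinates at 1 and at √d.
  K₁ K₂ : Kind → V → ℚ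
  K₁ split   (v e f g h) = e
  K₁ halved    (v e f g h) = e + ½ * f
  K₁ glued (v e f g h) = e + ½ * f + ¼ * (g + h)
  K₂ split   (v e f g h) = f
  K₂ halved    (v e f g h) = ½ * f
  K₂ glued (v e f g h) = ½ * f + ¼ * (g - h)

  -- Inverse of (K₁ , K₂) for given plane coordinates.
  assemble : Kind → (p q g h : ℚ) → V
  assemble split   p q g h = v p q g h
  assemble halved    p q g h = v (p - q) (2ℚ * q) g h
  assemble glued p q g h = v (p - q - ½ * h) (2ℚ * q - ½ * (g - h)) g h

  K₁-assemble : ∀ κ p q g h → K₁ κ (assemble κ p q g h) ≡ p
  K₁-assemble split   p q g h = refl
  K₁-assemble halved    p q g h = lem p q
    where
    lem : ∀ p q → (p - q) + ½ * (2ℚ * q) ≡ p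
    lem = solve-∀ ℚ-acr
  K₁-assemble glued p q g h = lem p q g h
    where
    lem : ∀ p q g h → (p - q - ½ * h) + ½ * (2ℚ * q - ½ * (g - h)) + ¼ * (g + h) ≡ p
    lem = solve-∀ ℚ-acr

  K₂-assemble : ∀ κ p q g h → K₂ κ (assemble κ p q g h) ≡ q
  K₂-assemble split   p q g h = refl
  K₂-assemble halved    p q g h = lem q
    where
    lem : ∀ q → ½ * (2ℚ * q) ≡ q
    lem = solve-∀ ℚ-acr
  K₂-assemble glued p q g h = lem q g h
    where
    lem : ∀ q g h → ½ * (2ℚ * q - ½ * (g - h)) + ¼ * (g - h) ≡ q
    lem = solve-∀ ℚ-acr

  assemble-K : ∀ κ x → assemble κ (K₁ κ x) (K₂ κ x) (V.g x) (V.h x) ≡ x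
  assemble-K split   x = refl
  assemble-K halved    (v e f g h) = V≡ (lem₁ e f) (lem₂ f) refl refl
    where
    lem₁ : ∀ e f → e + ½ * f - ½ * f ≡ e
    lem₁ = solve-∀ ℚ-acr
    lem₂ : ∀ f → 2ℚ * (½ * f) ≡ f
    lem₂ = solve-∀ ℚ-acr
  assemble-K glued (v e f g h) = V≡ (lem₁ e f g h) (lem₂ f g h) refl refl
    where
    lem₁ : ∀ e f g h → (e + ½ * f + ¼ * (g + h)) - (½ * f + ¼ * (g - h)) - ½ * h ≡ e
    lem₁ = solve-∀ ℚ-acr
    lem₂ : ∀ f g h → 2ℚ * (½ * f + ¼ * (g - h)) - ½ * (g - h) ≡ f
    lem₂ = solve-∀ ℚ-acr

  act : Kind → (b c : ℚ) → Op → V → V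
  act κ b c (op A B s τ) x =
    assemble κ (A * K₁ κ x) (B * K₂ κ x) (plane₁ b c s τ (V.g x) (V.h x)) (plane₂ b c s τ (V.g x) (V.h x))

  g-assemble : ∀ κ p q g h → V.g (assemble κ p q g h) ≡ g
  g-assemble split   p q g h = refl
  g-assemble halved    p q g h = refl
  g-assemble glued p q g h = refl

  h-assemble : ∀ κ p q g h → V.h (assemble κ p q g h) ≡ h
  h-assemble split   p q g h = refl
  h-assemble halved    p q g h = refl
  h-assemble glued p q g h = refl

  -- The operator taking an element with K₁ = 1/p, K₂ = 1/q and Q(g , h) = δ = ±1 to y.
  recover : Kind → (b c p q δ g h : ℚ) → V → Op
  recover κ b c p q δ g h y = op (p * K₁ κ y) (q * K₂ κ y)
    (δ * (V.g y * (b * g + c * h) - V.h y * (b * h - c * g)))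
    (δ * (g * V.h y - h * V.g y))

  record Invertible (κ : Kind) (b c : ℚ) (β : V) (p q δ : ℚ) : Set where
    constructor invertible
    field
      p≡ : p * K₁ κ β ≡ 1ℚ
      q≡ : q * K₂ κ β ≡ 1ℚ
      δ≡ : δ * Q b c (V.g β) (V.h β) ≡ 1ℚ

  opaque
    cancel : ∀ p k y → p * k ≡ 1ℚ → (p * y) * k ≡ y
    cancel p k y e = trans (lem p k y) (trans (cong (_* y) e) (*-identityˡ y))
      where
      lem : ∀ p k y → (p * y) * k ≡ (p * k) * y
      lem = solve-∀ ℚ-acr

    cancel′ : ∀ p k a → p * k ≡ 1ℚ → p * (a * k) ≡ a
    cancel′ p k a e = trans (lem p k a) (trans (cong (_* a) e) (*-identityˡ a))
      where
      lem : ∀ p k y → p * (y * k) ≡ (p * k) * y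
      lem = solve-∀ ℚ-acr

    act-recover : ∀ κ {b c β p q δ} → Invertible κ b c β p q δ → ∀ y →
                  act κ b c (recover κ b c p q δ (V.g β) (V.h β) y) β ≡ y
    act-recover κ {b} {c} {β} {p} {q} {δ} (invertible p≡ q≡ δ≡) y =
      trans (cong₂ (λ p q → assemble κ p q _ _) (cancel p (K₁ κ β) (K₁ κ y) p≡) (cancel q (K₂ κ β) (K₂ κ y) q≡))
        (trans (cong₂ (assemble κ (K₁ κ y) (K₂ κ y))
          (trans (lem₁ b c δ (V.g β) (V.h β) (V.g y) (V.h y)) (trans (cong (_* V.g y) δ≡) (*-identityˡ (V.g y))))
          (trans (lem₂ b c δ (V.g β) (V.h β) (V.g y) (V.h y)) (trans (cong (_* V.h y) δ≡) (*-identityˡ (V.h y)))))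
        (assemble-K κ y))
      where
      lem₁ : ∀ b c δ g h g′ h′ → δ * (g′ * (b * g + c * h) - h′ * (b * h - c * g)) * g + δ * (g * h′ - h * g′) * (b * h - c * g) ≡
                                  δ * (b * (g * g) + 2ℚ * c * (g * h) - b * (h * h)) * g′
      lem₁ = solve-∀ ℚ-acr
      lem₂ : ∀ b c δ g h g′ h′ → δ * (g′ * (b * g + c * h) - h′ * (b * h - c * g)) * h + δ * (g * h′ - h * g′) * (b * g + c * h) ≡
                                  δ * (b * (g * g) + 2ℚ * c * (g * h) - b * (h * h)) * h′
      lem₂ = solve-∀ ℚ-acr

    recover-act : ∀ κ {b c β p q δ} → Invertible κ b c β p q δ → ∀ o →
                  recover κ b c p q δ (V.g β) (V.h β) (act κ b c o β) ≡ o
    recover-act κ {b} {c} {β} {p} {q} {δ} (invertible p≡ q≡ δ≡) (op A B s τ) = Op≡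
      (trans (cong (p *_) (K₁-assemble κ _ _ g₁ h₁)) (cancel′ p (K₁ κ β) A p≡))
      (trans (cong (q *_) (K₂-assemble κ _ _ g₁ h₁)) (cancel′ q (K₂ κ β) B q≡))
      (trans (cong₂ (λ g h → δ * (g * (b * V.g β + c * V.h β) - h * (b * V.h β - c * V.g β))) (g-assemble κ _ _ g₁ h₁) (h-assemble κ _ _ g₁ h₁))
        (trans (lem₁ b c δ (V.g β) (V.h β) s τ) (trans (cong (_* s) δ≡) (*-identityˡ s))))
      (trans (cong₂ (λ g h → δ * (V.g β * h - V.h β * g)) (g-assemble κ _ _ g₁ h₁) (h-assemble κ _ _ g₁ h₁))
        (trans (lem₂ b c δ (V.g β) (V.h β) s τ) (trans (cong (_* τ) δ≡) (*-identityˡ τ))))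
      where
      g₁ h₁ : ℚ
      g₁ = plane₁ b c s τ (V.g β) (V.h β)
      h₁ = plane₂ b c s τ (V.g β) (V.h β)
      lem₁ : ∀ b c δ g h s τ → δ * ((s * g + τ * (b * h - c * g)) * (b * g + c * h) - (s * h + τ * (b * g + c * h)) * (b * h - c * g)) ≡
                                δ * (b * (g * g) + 2ℚ * c * (g * h) - b * (h * h)) * s
      lem₁ = solve-∀ ℚ-acr
      lem₂ : ∀ b c δ g h s τ → δ * (g * (s * h + τ * (b * g + c * h)) - h * (s * g + τ * (b * h - c * g))) ≡
                                δ * (b * (g * g) + 2ℚ * c * (g * h) - b * (h * h)) * τ
      lem₂ = solve-∀ ℚ-acr

  -- The coordinates of the generators in the theorem.
  data Generator (b c : ℚ) : Kind → V → Set where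
    gen-split    : ∀ {g h} → Z g → Z h → Generator b c split (v 1ℚ 1ℚ g h)
    gen-halved     : ∀ {g h} → Z g → Z h → Generator b c halved (v 0ℚ 1ℚ g h)
    gen-glued⁺ : ∀ {e f b′ c′} → b ≡ F.od b′ → c ≡ F.ev c′ → Z b′ → Z c′ → Z e → Z f →
                   Generator b c glued (v e f (1ℚ - 2ℚ * e - 2ℚ * f) (- (2ℚ * e)))
    gen-glued⁻ : ∀ {e f b′ c′} → b ≡ F.od b′ → c ≡ F.ev c′ → Z b′ → Z c′ → Z e → Z f →
                   Generator b c glued (v e f (- (2ℚ * e) - 2ℚ * f) (- (2ℚ * e) - 1ℚ))

  -- The inverses of `K₁` and `K₂` at the generator. In the glued case 4 K₁ = 4 e + 2 f + g + h and
  -- 4 K₂ = 2 f + g - h; the two families, for even and odd h, have 4 K₁ = 1 and 4 K₁ = -1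
  -- respectively, and 4 K₂ = 1 in both.
  k₁ k₂ : ∀ {b c κ β} → Generator b c κ β → ℚ
  k₁ (gen-split _ _)              = 1ℚ
  k₁ (gen-halved _ _)               = 2ℚ
  k₁ (gen-glued⁺ _ _ _ _ _ _)   = 4ℚ
  k₁ (gen-glued⁻ _ _ _ _ _ _)   = - 4ℚ
  k₂ (gen-split _ _)              = 1ℚ
  k₂ (gen-halved _ _)               = 2ℚ
  k₂ (gen-glued⁺ _ _ _ _ _ _)   = 4ℚ
  k₂ (gen-glued⁻ _ _ _ _ _ _)   = 4ℚ

  opaque
    generator-invertible : ∀ {b c κ β δ} (γ : Generator b c κ β) → δ * Q b c (V.g β) (V.h β) ≡ 1ℚ →
                           Invertible κ b c β (k₁ γ) (k₂ γ) δ
    generator-invertible (gen-split _ _) δ≡ = invertible refl refl δ≡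
    generator-invertible (gen-halved _ _)  δ≡ = invertible refl refl δ≡
    generator-invertible (gen-glued⁺ {e} {f} _ _ _ _ _ _) δ≡ = invertible (lem₁ e f) (lem₂ e f) δ≡
      where
      lem₁ : ∀ e f → 4ℚ * (e + ½ * f + ¼ * ((1ℚ - 2ℚ * e - 2ℚ * f) + - (2ℚ * e))) ≡ 1ℚ
      lem₁ = solve-∀ ℚ-acr
      lem₂ : ∀ e f → 4ℚ * (½ * f + ¼ * ((1ℚ - 2ℚ * e - 2ℚ * f) - - (2ℚ * e))) ≡ 1ℚ
      lem₂ = solve-∀ ℚ-acr
    generator-invertible (gen-glued⁻ {e} {f} _ _ _ _ _ _) δ≡ = invertible (lem₁ e f) (lem₂ e f) δ≡
      where
      lem₁ : ∀ e f → (- 4ℚ) * (e + ½ * f + ¼ * ((- (2ℚ * e) - 2ℚ * f) + (- (2ℚ * e) - 1ℚ))) ≡ 1ℚ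
      lem₁ = solve-∀ ℚ-acr
      lem₂ : ∀ e f → 4ℚ * (½ * f + ¼ * ((- (2ℚ * e) - 2ℚ * f) - (- (2ℚ * e) - 1ℚ))) ≡ 1ℚ
      lem₂ = solve-∀ ℚ-acr

  private
    module _ {n : ℕ} where
      s-poly τ-poly : (b c δ g h g′ h′ : Polynomial n) → Polynomial n
      s-poly b c δ g h g′ h′ = δ :* (g′ :* (b :* g :+ c :* h) :- h′ :* (b :* h :- c :* g))
      τ-poly b c δ g h g′ h′ = δ :* (g :* h′ :- h :* g′)

      plane₁-poly plane₂-poly : (b c s τ g h : Polynomial n) → Polynomial n
      plane₁-poly b c s τ g h = s :* g :+ τ :* (b :* h :- c :* g)
      plane₂-poly b c s τ g h = s :* h :+ τ :* (b :* g :+ c :* h)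

    -- The coordinates at 1 and (1 + √d)/2 of the image of (e₀ , f₀ , g₀ , h₀) under the
    -- operator taking a generator with plane coordinates G, H and K₁ = 1/k to (e , f , g , h).
    module _ (k : ℚ) (G H : (i j : Polynomial 13) → Polynomial 13) where
      s′ τ′ A′ B′ image-e image-f : Vec (Polynomial 13) 13 → Polynomial 13
      s′ (b ∷ c ∷ δ ∷ i ∷ j ∷ e ∷ f ∷ g ∷ h ∷ _) = s-poly (P.od b) (P.ev c) (P.od δ) (G i j) (H i j) g h
      τ′ (b ∷ c ∷ δ ∷ i ∷ j ∷ e ∷ f ∷ g ∷ h ∷ _) = τ-poly (P.od b) (P.ev c) (P.od δ) (G i j) (H i j) g h
      A′ (b ∷ c ∷ δ ∷ i ∷ j ∷ e ∷ f ∷ g ∷ h ∷ _) = con k :* (e :+ con ½ :* f :+ con ¼ :* (g :+ h))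
      B′ (b ∷ c ∷ δ ∷ i ∷ j ∷ e ∷ f ∷ g ∷ h ∷ _) = con 4ℚ :* (con ½ :* f :+ con ¼ :* (g :- h))
      image-e xs@(b ∷ c ∷ δ ∷ i ∷ j ∷ e ∷ f ∷ g ∷ h ∷ e₀ ∷ f₀ ∷ g₀ ∷ h₀ ∷ []) =
        A′ xs :* (e₀ :+ con ½ :* f₀ :+ con ¼ :* (g₀ :+ h₀)) :- B′ xs :* (con ½ :* f₀ :+ con ¼ :* (g₀ :- h₀))
          :- con ½ :* plane₂-poly (P.od b) (P.ev c) (s′ xs) (τ′ xs) g₀ h₀
      image-f xs@(b ∷ c ∷ δ ∷ i ∷ j ∷ e ∷ f ∷ g ∷ h ∷ e₀ ∷ f₀ ∷ g₀ ∷ h₀ ∷ []) =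
        con 2ℚ :* (B′ xs :* (con ½ :* f₀ :+ con ¼ :* (g₀ :- h₀)))
          :- con ½ :* (plane₁-poly (P.od b) (P.ev c) (s′ xs) (τ′ xs) g₀ h₀ :- plane₂-poly (P.od b) (P.ev c) (s′ xs) (τ′ xs) g₀ h₀)

    G⁺ H⁺ G⁻ H⁻ : (i j : Polynomial 13) → Polynomial 13
    G⁺ i j = con 1ℚ :- con 2ℚ :* i :- con 2ℚ :* j
    H⁺ i j = :- (con 2ℚ :* i)
    G⁻ i j = :- (con 2ℚ :* i) :- con 2ℚ :* j
    H⁻ i j = :- (con 2ℚ :* i) :- con 1ℚ

  opaque
    plane-integral : ∀ {b c δ g h y x} → Z b → Z c → Z δ → Z g → Z h → ZV y → ZV x →
      let s = δ * (V.g y * (b * g + c * h) - V.h y * (b * h - c * g))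
          τ = δ * (g * V.h y - h * V.g y)
      in Z (plane₁ b c s τ (V.g x) (V.h x)) × Z (plane₂ b c s τ (V.g x) (V.h x))
    plane-integral {b} {c} {δ} {g} {h} {y} zb zc zδ zg zh (_ , _ , zg′ , zh′) (_ , _ , zg₀ , zh₀) =
      zs ⊗ zg₀ ⊕ zτ ⊗ (zb ⊗ zh₀ ⊖ zc ⊗ zg₀) , zs ⊗ zh₀ ⊕ zτ ⊗ (zb ⊗ zg₀ ⊕ zc ⊗ zh₀)
      where
      zs : Z (δ * (V.g y * (b * g + c * h) - V.h y * (b * h - c * g)))
      zs = zδ ⊗ (zg′ ⊗ (zb ⊗ zg ⊕ zc ⊗ zh) ⊖ zh′ ⊗ (zb ⊗ zh ⊖ zc ⊗ zg))
      zτ : Z (δ * (g * V.h y - h * V.g y))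
      zτ = zδ ⊗ (zg ⊗ zh′ ⊖ zh ⊗ zg′)

    -- For kind glued this uses that δ is odd.
    recover-integral : ∀ {b c κ β δ δ′ y x} (γ : Generator b c κ β) → Z b → Z c → Z δ′ → δ ≡ F.od δ′ →
      ZV y → ZV x → ZV (act κ b c (recover κ b c (k₁ γ) (k₂ γ) δ (V.g β) (V.h β) y) x)
    recover-integral {y = v e f g h} {x = v e₀ f₀ g₀ h₀} (gen-split zg zh) zb zc zδ refl zy@(ze , zf , _) zx@(ze₀ , zf₀ , _) =
      let z₁ , z₂ = plane-integral {y = v e f g h} {x = v e₀ f₀ g₀ h₀} zb zc (2∈Z ⊗ zδ ⊕ 1∈Z) zg zh zy zx
      in 1∈Z ⊗ ze ⊗ ze₀ , 1∈Z ⊗ zf ⊗ zf₀ , z₁ , z₂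
    recover-integral {y = v e f g h} {x = v e₀ f₀ g₀ h₀} (gen-halved zg zh) zb zc zδ refl zy@(ze , zf , _) zx@(ze₀ , zf₀ , _) =
      let z₁ , z₂ = plane-integral {y = v e f g h} {x = v e₀ f₀ g₀ h₀} zb zc (2∈Z ⊗ zδ ⊕ 1∈Z) zg zh zy zx
      in poly-Z (λ { (e ∷ f ∷ e₀ ∷ f₀ ∷ []) → (con 2ℚ :* (e :+ con ½ :* f)) :* (e₀ :+ con ½ :* f₀) :- (con 2ℚ :* (con ½ :* f)) :* (con ½ :* f₀) })
           (ze ∷ zf ∷ ze₀ ∷ zf₀ ∷ [])
       , poly-Z (λ { (f ∷ f₀ ∷ []) → con 2ℚ :* ((con 2ℚ :* (con ½ :* f)) :* (con ½ :* f₀)) }) (zf ∷ zf₀ ∷ []) , z₁ , z₂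
    -- After the substitutions b = 2 b′ + 1, c = 2 c′ and δ = 2 δ′ + 1 the first two coordinates of
    -- the image are polynomials with integer coefficients in thirteen integers; the plane
    -- coordinates are integral without any parity condition.
    recover-integral {y = v e f g h} {x = v e₀ f₀ g₀ h₀} (gen-glued⁺ refl refl zb′ zc′ zi zj) zb zc zδ refl zy@(ze , zf , zg , zh) zx@(ze₀ , zf₀ , zg₀ , zh₀) =
      let z₁ , z₂ = plane-integral {y = v e f g h} {x = v e₀ f₀ g₀ h₀} zb zc (2∈Z ⊗ zδ ⊕ 1∈Z) (1∈Z ⊖ 2∈Z ⊗ zi ⊖ 2∈Z ⊗ zj) (⊝ (2∈Z ⊗ zi)) zy zx
          zs = zb′ ∷ zc′ ∷ zδ ∷ zi ∷ zj ∷ ze ∷ zf ∷ zg ∷ zh ∷ ze₀ ∷ zf₀ ∷ zg₀ ∷ zh₀ ∷ []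
      in poly-Z (image-e 4ℚ G⁺ H⁺) zs , poly-Z (image-f 4ℚ G⁺ H⁺) zs , z₁ , z₂
    recover-integral {y = v e f g h} {x = v e₀ f₀ g₀ h₀} (gen-glued⁻ refl refl zb′ zc′ zi zj) zb zc zδ refl zy@(ze , zf , zg , zh) zx@(ze₀ , zf₀ , zg₀ , zh₀) =
      let z₁ , z₂ = plane-integral {y = v e f g h} {x = v e₀ f₀ g₀ h₀} zb zc (2∈Z ⊗ zδ ⊕ 1∈Z) (⊝ (2∈Z ⊗ zi) ⊖ 2∈Z ⊗ zj) (⊝ (2∈Z ⊗ zi) ⊖ 1∈Z) zy zx
          zs = zb′ ∷ zc′ ∷ zδ ∷ zi ∷ zj ∷ ze ∷ zf ∷ zg ∷ zh ∷ ze₀ ∷ zf₀ ∷ zg₀ ∷ zh₀ ∷ []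
      in poly-Z (image-e (- 4ℚ) G⁻ H⁻) zs , poly-Z (image-f (- 4ℚ) G⁻ H⁻) zs , z₁ , z₂

  generator-Z : ∀ {b c κ x} → Generator b c κ x → ZV x
  generator-Z (gen-split zg zh) = 1∈Z , 1∈Z , zg , zh
  generator-Z (gen-halved zg zh) = 0∈Z , 1∈Z , zg , zh
  generator-Z (gen-glued⁺ _ _ _ _ ze zf) = ze , zf , 1∈Z ⊖ 2∈Z ⊗ ze ⊖ 2∈Z ⊗ zf , ⊝ (2∈Z ⊗ ze)
  generator-Z (gen-glued⁻ _ _ _ _ ze zf) = ze , zf , ⊝ (2∈Z ⊗ ze) ⊖ 2∈Z ⊗ zf , ⊝ (2∈Z ⊗ ze) ⊖ 1∈Z

  opaque
    -- As b is odd and coprime to c, integrality of τ b and 2 τ c forces that of τ.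
    op-integral : ∀ κ (o : Op) {b c b′ u w} → b ≡ F.od b′ → Z b′ → Z u → Z w → u * b + w * c ≡ 1ℚ → Z c →
      ZV (act κ b c o (v 0ℚ 0ℚ 1ℚ 0ℚ)) → ZV (act κ b c o (v 0ℚ 0ℚ 0ℚ 1ℚ)) → Z (Op.s o) × Z (Op.τ o)
    op-integral κ (op A B s τ) {b} {c} {b′} {u} {w} b≡ zb′ zu zw bez zc (_ , _ , zg , zh) (_ , _ , zg′ , zh′) = zs , zτ
      where
      z₁ : Z (plane₁ b c s τ 1ℚ 0ℚ)
      z₁ = subst Z (g-assemble κ (A * K₁ κ (v 0ℚ 0ℚ 1ℚ 0ℚ)) (B * K₂ κ (v 0ℚ 0ℚ 1ℚ 0ℚ)) (plane₁ b c s τ 1ℚ 0ℚ) (plane₂ b c s τ 1ℚ 0ℚ)) zg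
      z₂ : Z (plane₂ b c s τ 1ℚ 0ℚ)
      z₂ = subst Z (h-assemble κ (A * K₁ κ (v 0ℚ 0ℚ 1ℚ 0ℚ)) (B * K₂ κ (v 0ℚ 0ℚ 1ℚ 0ℚ)) (plane₁ b c s τ 1ℚ 0ℚ) (plane₂ b c s τ 1ℚ 0ℚ)) zh
      z₃ : Z (plane₂ b c s τ 0ℚ 1ℚ)
      z₃ = subst Z (h-assemble κ (A * K₁ κ (v 0ℚ 0ℚ 0ℚ 1ℚ)) (B * K₂ κ (v 0ℚ 0ℚ 0ℚ 1ℚ)) (plane₁ b c s τ 0ℚ 1ℚ) (plane₂ b c s τ 0ℚ 1ℚ)) zh′
      z2τ : Z (2ℚ * τ)
      z2τ = subst Z (trans (lem u w b c s τ) (trans (cong (_* (2ℚ * τ)) bez) (lem′ (2ℚ * τ))))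
        (2∈Z ⊗ zu ⊗ z₂ ⊕ zw ⊗ (z₃ ⊖ z₁))
        where
        lem : ∀ u w b c s τ → 2ℚ * u * (s * 0ℚ + τ * (b * 1ℚ + c * 0ℚ)) + w * ((s * 1ℚ + τ * (b * 0ℚ + c * 1ℚ)) - (s * 1ℚ + τ * (b * 0ℚ - c * 1ℚ))) ≡ (u * b + w * c) * (2ℚ * τ)
        lem = solve-∀ ℚ-acr
        lem′ : ∀ r → 1ℚ * r ≡ r
        lem′ = solve-∀ ℚ-acr
      zτ : Z τ
      zτ = subst Z (trans (cong (λ b → (s * 0ℚ + τ * (b * 1ℚ + c * 0ℚ)) - b′ * (2ℚ * τ)) b≡) (lem b′ c s τ)) (z₂ ⊖ zb′ ⊗ z2τ)
        where
        lem : ∀ b c s τ → (s * 0ℚ + τ * ((2ℚ * b + 1ℚ) * 1ℚ + c * 0ℚ)) - b * (2ℚ * τ) ≡ τ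
        lem = solve-∀ ℚ-acr
      zs : Z s
      zs = subst Z (lem b c s τ) (z₁ ⊕ zτ ⊗ zc)
        where
        lem : ∀ b c s τ → (s * 1ℚ + τ * (b * 0ℚ - c * 1ℚ)) + τ * c ≡ s
        lem = solve-∀ ℚ-acr

    -- Both unit vectors of the plane are combinations s x + τ J x of the plane part of x and its
    -- image. Multiplicativity of determinants makes the product of the coefficient determinant and
    -- det(x, J x) = Q equal to 1.
    plane-determinant : ∀ κ b c {o₁ o₂} x → act κ b c o₁ x ≡ v 0ℚ 0ℚ 1ℚ 0ℚ → act κ b c o₂ x ≡ v 0ℚ 0ℚ 0ℚ 1ℚ →
      (Op.s o₁ * Op.τ o₂ - Op.τ o₁ * Op.s o₂) * Q b c (V.g x) (V.h x) ≡ 1ℚ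
    plane-determinant κ b c {op A₁ B₁ s₁ τ₁} {op A₂ B₂ s₂ τ₂} x e₁ e₂ =
      trans (lem b c (V.g x) (V.h x) s₁ τ₁ s₂ τ₂)
        (trans (cong₂ _-_ (cong₂ _*_ g₁ h₂) (cong₂ _*_ g₂ h₁)) refl)
      where
      lem : ∀ b c g h s₁ τ₁ s₂ τ₂ → (s₁ * τ₂ - τ₁ * s₂) * (b * (g * g) + 2ℚ * c * (g * h) - b * (h * h)) ≡
        (s₁ * g + τ₁ * (b * h - c * g)) * (s₂ * h + τ₂ * (b * g + c * h)) - (s₂ * g + τ₂ * (b * h - c * g)) * (s₁ * h + τ₁ * (b * g + c * h))
      lem = solve-∀ ℚ-acr
      g₁ : plane₁ b c s₁ τ₁ (V.g x) (V.h x) ≡ 1ℚ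
      g₁ = trans (sym (g-assemble κ (A₁ * K₁ κ x) (B₁ * K₂ κ x) _ _)) (cong V.g e₁)
      h₁ : plane₂ b c s₁ τ₁ (V.g x) (V.h x) ≡ 0ℚ
      h₁ = trans (sym (h-assemble κ (A₁ * K₁ κ x) (B₁ * K₂ κ x) (plane₁ b c s₁ τ₁ (V.g x) (V.h x)) _)) (cong V.h e₁)
      g₂ : plane₁ b c s₂ τ₂ (V.g x) (V.h x) ≡ 0ℚ
      g₂ = trans (sym (g-assemble κ (A₂ * K₁ κ x) (B₂ * K₂ κ x) _ _)) (cong V.g e₂)
      h₂ : plane₂ b c s₂ τ₂ (V.g x) (V.h x) ≡ 1ℚ
      h₂ = trans (sym (h-assemble κ (A₂ * K₁ κ x) (B₂ * K₂ κ x) (plane₁ b c s₂ τ₂ (V.g x) (V.h x)) _)) (cong V.h e₂)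

    unit : ∀ {r s} → Z r → Z s → r * s ≡ 1ℚ → s ≡ 1ℚ ⊎ s ≡ - 1ℚ
    unit (m , refl) (n , refl) eq = cases n (ℕₚ.m*n≡1⇒n≡1 ℤ.∣ m ∣ ℤ.∣ n ∣
        (trans (sym (ℤₚ.abs-* m n)) (cong ℤ.∣_∣ (⟪⟫-injective {m ℤ.* n} {1ℤ} (trans (⟪⟫-* m n) (trans eq (sym ⟪1⟫≡1)))))))
      where
      cases : ∀ n → ℤ.∣ n ∣ ≡ 1 → ⟪ n ⟫ ≡ 1ℚ ⊎ ⟪ n ⟫ ≡ - 1ℚ
      cases (+ 1)      refl = inj₁ ⟪1⟫≡1
      cases (-[1+ 0 ]) refl = inj₂ (trans (⟪⟫-neg 1ℤ) (cong -_ ⟪1⟫≡1))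

  form : (b c : ℕ) (U V : ℤ) → ℤ
  form b c U V = + b ℤ.* (U ℤ.* U) ℤ.+ + 2 ℤ.* + c ℤ.* (U ℤ.* V) ℤ.- + b ℤ.* (V ℤ.* V)

  opaque
    ⟪form⟫ : ∀ b c U V → ⟪ form b c U V ⟫ ≡ Q ⟪ + b ⟫ ⟪ + c ⟫ ⟪ U ⟫ ⟪ V ⟫
    ⟪form⟫ b c U V = trans (⟪⟫-minus (+ b ℤ.* (U ℤ.* U) ℤ.+ + 2 ℤ.* + c ℤ.* (U ℤ.* V)) (+ b ℤ.* (V ℤ.* V)))
      (cong₂ _-_ (trans (⟪⟫-+ (+ b ℤ.* (U ℤ.* U)) (+ 2 ℤ.* + c ℤ.* (U ℤ.* V)))
                   (cong₂ _+_ (cube (+ b) U U) (trans (⟪⟫-* (+ 2 ℤ.* + c) (U ℤ.* V)) (cong₂ _*_ (trans (⟪⟫-* (+ 2) (+ c)) (cong (_* ⟪ + c ⟫) ⟪2⟫≡2)) (⟪⟫-* U V)))))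
                 (cube (+ b) V V))
      where
      cube : ∀ i j k → ⟪ i ℤ.* (j ℤ.* k) ⟫ ≡ ⟪ i ⟫ * (⟪ j ⟫ * ⟪ k ⟫)
      cube i j k = trans (⟪⟫-* i (j ℤ.* k)) (cong (⟪ i ⟫ *_) (⟪⟫-* j k))

    form≡1⇒Q : ∀ b c U V → form b c U V ≡ 1ℤ → Q ⟪ + b ⟫ ⟪ + c ⟫ ⟪ U ⟫ ⟪ V ⟫ ≡ 1ℚ
    form≡1⇒Q b c U V eq = trans (sym (⟪form⟫ b c U V)) (trans (cong ⟪_⟫ eq) ⟪1⟫≡1)

    -- The quarter turn (U , V) ↦ (V , -U) negates the form, so that it represents 1 as soon as it
    -- represents -1.
    Q⇒form≡1 : ∀ b c {g h} → Z g → Z h → Q ⟪ + b ⟫ ⟪ + c ⟫ g h ≡ 1ℚ ⊎ Q ⟪ + b ⟫ ⟪ + c ⟫ g h ≡ - 1ℚ → ∃[ U ] ∃[ V ] form b c U V ≡ 1ℤ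
    Q⇒form≡1 b c (U , refl) (V , refl) (inj₁ eq) = U , V , ⟪⟫-injective (trans (⟪form⟫ b c U V) (trans eq (sym ⟪1⟫≡1)))
    Q⇒form≡1 b c (U , refl) (V , refl) (inj₂ eq) = V , ℤ.- U , ⟪⟫-injective (trans (⟪form⟫ b c V (ℤ.- U))
      (trans (cong (Q ⟪ + b ⟫ ⟪ + c ⟫ ⟪ V ⟫) (⟪⟫-neg U)) (trans (lem ⟪ + b ⟫ ⟪ + c ⟫ ⟪ U ⟫ ⟪ V ⟫) (trans (cong -_ eq) (sym ⟪1⟫≡1)))))
      where
      lem : ∀ b c U V → b * (V * V) + 2ℚ * c * (V * - U) - b * (- U * - U) ≡ - (b * (U * U) + 2ℚ * c * (U * V) - b * (V * V))
      lem = solve-∀ ℚ-acr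

    -- As b is odd, U and V have different parity.
    Q-parity : ∀ {b c g h} → Odd b → Z c → Z g → Z h → Q b c g h ≡ 1ℚ → Even (h - g + 1ℚ)
    Q-parity {c = c} (b , zb , refl) zc zg zh = go (parity zg) (parity zh)
      where
      go : ∀ {g h} → Parity g → Parity h → Q (F.od b) c g h ≡ 1ℚ → Even (h - g + 1ℚ)
      go (even {g} zg) (odd {h} zh) _ = _ , zh ⊖ zg ⊕ 1∈Z , lem g h
        where
        lem : ∀ g h → (2ℚ * h + 1ℚ) - 2ℚ * g + 1ℚ ≡ 2ℚ * (h - g + 1ℚ)
        lem = solve-∀ ℚ-acr
      go (odd {g} zg) (even {h} zh) _ = _ , zh ⊖ zg , lem g h
        where
        lem : ∀ g h → 2ℚ * h - (2ℚ * g + 1ℚ) + 1ℚ ≡ 2ℚ * (h - g)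
        lem = solve-∀ ℚ-acr
      go (even {g} zg) (even {h} zh) eq = ⊥-elim (½∉Z (subst Z (cong (½ *_) eq)
        (poly-Z (λ { (b ∷ c ∷ g ∷ h ∷ []) → con ½ :* (P.od b :* (P.ev g :* P.ev g) :+ con 2ℚ :* c :* (P.ev g :* P.ev h) :- P.od b :* (P.ev h :* P.ev h)) }) (zb ∷ zc ∷ zg ∷ zh ∷ []))))
      go (odd {g} zg) (odd {h} zh) eq = ⊥-elim (½∉Z (subst Z (cong (½ *_) eq)
        (poly-Z (λ { (b ∷ c ∷ g ∷ h ∷ []) → con ½ :* (P.od b :* (P.od g :* P.od g) :+ con 2ℚ :* c :* (P.od g :* P.od h) :- P.od b :* (P.od h :* P.od h)) }) (zb ∷ zc ∷ zg ∷ zh ∷ []))))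

  norm-form : ∀ b c x′ y → let d = + b ℤ.* + b ℤ.+ + c ℤ.* + c ; x = x′ ℤ.* + b ℤ.+ + c ℤ.* y in
    x ℤ.* x ℤ.- d ℤ.* (y ℤ.* y) ≡ + b ℤ.* form b c x′ y
  norm-form b c x′ y = lem (+ b) (+ c) x′ y
    where
    lem : ∀ b c x′ y → (x′ ℤ.* b ℤ.+ c ℤ.* y) ℤ.* (x′ ℤ.* b ℤ.+ c ℤ.* y) ℤ.- (b ℤ.* b ℤ.+ c ℤ.* c) ℤ.* (y ℤ.* y) ≡
                        b ℤ.* (b ℤ.* (x′ ℤ.* x′) ℤ.+ + 2 ℤ.* c ℤ.* (x′ ℤ.* y) ℤ.- b ℤ.* (y ℤ.* y))
    lem = ℤSolver.solve-∀

  module Arithmetic (b c : ℕ) .{{_ : NonZero b}} {d : ℤ} (d≡ : d ≡ + b ℤ.* + b ℤ.+ + c ℤ.* + c) where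

    solution⇒form : ∀ x y → x ℤ.* x ℤ.- d ℤ.* (y ℤ.* y) ≡ + b → (p : + b ℤ∣.∣ x ℤ.- + c ℤ.* y) → form b c (ℤ∣.quotient p) y ≡ 1ℤ
    solution⇒form x y eq (ℤ∣.divides x′ p) = ℤₚ.*-cancelˡ-≡ (+ b) (form b c x′ y) 1ℤ
      (trans (sym (norm-form b c x′ y)) (trans (sym (cong₂ (λ d x → x ℤ.* x ℤ.- d ℤ.* (y ℤ.* y)) d≡ x≡)) (trans eq (sym (ℤₚ.*-identityʳ (+ b))))))
      where
      x≡ : x ≡ x′ ℤ.* + b ℤ.+ + c ℤ.* y
      x≡ = trans (lem x (+ c ℤ.* y)) (cong (ℤ._+ + c ℤ.* y) p)
        where
        lem : ∀ x t → x ≡ (x ℤ.- t) ℤ.+ t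
        lem = ℤSolver.solve-∀

    form⇒solution : ∀ U V → form b c U V ≡ 1ℤ → ∃[ x ] ∃[ y ] (x ℤ.* x ℤ.- d ℤ.* (y ℤ.* y) ≡ + b) × (+ b ℤ∣.∣ x ℤ.- + c ℤ.* y)
    form⇒solution U V eq = x , V ,
      trans (cong (λ d → x ℤ.* x ℤ.- d ℤ.* (V ℤ.* V)) d≡) (trans (norm-form b c U V) (trans (cong (+ b ℤ.*_) eq) (ℤₚ.*-identityʳ (+ b)))) ,
      ℤ∣.divides U (lem (U ℤ.* + b) (+ c ℤ.* V))
      where
      x : ℤ
      x = U ℤ.* + b ℤ.+ + c ℤ.* V
      lem : ∀ s t → s ℤ.+ t ℤ.- t ≡ s
      lem = ℤSolver.solve-∀

open AssociatedOrder

-- The ring of integers, the Hopf action and the generators in the five cases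

module Theorem (a : ℤ) (b₀ c₀ : ℕ) .{{_ : NonZero b₀}} .{{_ : NonZero c₀}} (odd-a : ¬ + 2 ℤ∣.∣ a)
  (sf-a : SquareFree ℤ.∣ a ∣) (sf-d : SquareFree (CyclicQuartic.d a b₀ c₀))
  (coprime : ℤGCD.gcd a (+ CyclicQuartic.d a b₀ c₀) ≡ 1ℤ) where
  open import Data.Rational.Base hiding (NonZero)

  open CyclicQuartic a b₀ c₀
  open Coordinates a b₀ c₀ using (α; β; γ′; δ)
  open OpaqueRing a b₀ c₀
  open Integrality a b₀ c₀
  open Invariants a b₀ c₀
  open SquareFreeParameters sf-a sf-d coprime
  private
    module L  = CommutativeRing 𝕃
    module L′ = CommutativeRing L

  AI⇒facts : ∀ {e f g h} → AlmostIntegral (mk e f g h) → Facts α β γ′ e f g h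
  AI⇒facts {e} {f} {g} {h} ai = record
    { 4e∈Z = 4e∈Z ai ; 4f∈Z = 4f∈Z ai ; 4g∈Z = 4g∈Z ai ; 4h∈Z = 4h∈Z ai
    ; trace = K-integral (AI-relTrace ai)
    ; norm = K-integral (AI-relNorm ai)
    ; plane = K-integral (AI-plane-norm ai)
    ; W∈Z = W∈Z ai }
    where
    K-integral : ∀ {p q} → AlmostIntegral (mk p q 0ℚ 0ℚ) → KIntegral δ p q
    K-integral ai = kIntegral (AI-K-trace _ _ ai) (AI-K-√d _ _ ai) (AI-K-norm _ _ ai)

  opaque
    -- Put ω = (1 + √d)/2, so that ω² = ω + k. The relative trace is s + t ω and the relative norm r
    -- + u ω, and the coefficients of the characteristic polynomial are traces and norms of such
    -- elements: integral polynomials in s, t, u, r and k.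
    relativelyIntegral⇒AI : ∀ {e f g h} → OddDiscriminant β γ′ → RelativelyIntegral α β γ′ e f g h → AlmostIntegral (mk e f g h)
    relativelyIntegral⇒AI {e} {f} {g} {h} (k , zk , eq) (relativelyIntegral zs zt zu zr) =
      integral⇒AI _ (charPoly⇒integral e f g h (charPoly
        (subst Z (lem₁ e f) (2∈Z ⊗ zs ⊕ zt))
        (subst Z (trans (lem₂ e f n₀ n₁ k) (cong (λ δ → 4ℚ * (e * e - δ * (f * f)) + 2ℚ * n₀) (sym eq)))
          (zs ⊗ zs ⊕ zt ⊗ zs ⊖ zk ⊗ (zt ⊗ zt) ⊕ (2∈Z ⊗ zr ⊕ zu)))
        (subst Z (trans (lem₃ e f n₀ n₁ k) (cong (λ δ → 4ℚ * (e * n₀ - δ * (f * n₁))) (sym eq)))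
          (2∈Z ⊗ (zs ⊗ zr) ⊕ zs ⊗ zu ⊕ zt ⊗ zr ⊖ 2∈Z ⊗ zk ⊗ (zt ⊗ zu)))
        (subst Z (trans (lem₄ n₀ n₁ k) (cong (λ δ → n₀ * n₀ - δ * (n₁ * n₁)) (sym eq)))
          (zr ⊗ zr ⊕ zr ⊗ zu ⊖ zk ⊗ (zu ⊗ zu)))))
      where
      n₀ n₁ : ℚ
      n₀ = N₀ e f g h
      n₁ = N₁ e f g h
      lem₁ : ∀ e f → 2ℚ * (2ℚ * e - 2ℚ * f) + 4ℚ * f ≡ 4ℚ * e
      lem₁ = solve-∀ ℚ-acr
      lem₂ : ∀ e f n₀ n₁ k → (2ℚ * e - 2ℚ * f) * (2ℚ * e - 2ℚ * f) + (4ℚ * f) * (2ℚ * e - 2ℚ * f) - k * ((4ℚ * f) * (4ℚ * f)) + (2ℚ * (n₀ - n₁) + 2ℚ * n₁)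
        ≡ 4ℚ * (e * e - (4ℚ * k + 1ℚ) * (f * f)) + 2ℚ * n₀
      lem₂ = solve-∀ ℚ-acr
      lem₃ : ∀ e f n₀ n₁ k → 2ℚ * ((2ℚ * e - 2ℚ * f) * (n₀ - n₁)) + (2ℚ * e - 2ℚ * f) * (2ℚ * n₁) + (4ℚ * f) * (n₀ - n₁) - 2ℚ * k * ((4ℚ * f) * (2ℚ * n₁))
        ≡ 4ℚ * (e * n₀ - (4ℚ * k + 1ℚ) * (f * n₁))
      lem₃ = solve-∀ ℚ-acr
      lem₄ : ∀ n₀ n₁ k → (n₀ - n₁) * (n₀ - n₁) + (n₀ - n₁) * (2ℚ * n₁) - k * ((2ℚ * n₁) * (2ℚ * n₁)) ≡ n₀ * n₀ - (4ℚ * k + 1ℚ) * (n₁ * n₁)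
      lem₄ = solve-∀ ℚ-acr

    AI-multiple : ∀ {r e f g h} → Z r → AlmostIntegral (mk e f g h) → AlmostIntegral (mk (r * e) (r * f) (r * g) (r * h))
    AI-multiple {r} {e} {f} {g} {h} zr ai = subst AlmostIntegral (scale r e f g h) (AI-* (M⇒AI (inM zr 0∈Z 0∈Z 0∈Z refl)) ai)

    AI-sum : ∀ {e f g h e′ f′ g′ h′} → AlmostIntegral (mk e f g h) → AlmostIntegral (mk e′ f′ g′ h′) →
             AlmostIntegral (mk (e + e′) (f + f′) (g + g′) (h + h′))
    AI-sum {e} {f} {g} {h} {e′} {f′} {g′} {h′} p q = subst AlmostIntegral (mk-+ e f g h e′ f′ g′ h′) (AI-+ p q)

    AI-span : ∀ {p q r e f g h} → AlmostIntegral (mkⱽ p) → AlmostIntegral (mkⱽ q) → AlmostIntegral (mkⱽ r) →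
              Z e → Z f → Z g → Z h → AlmostIntegral (mkⱽ (span p q r e f g h))
    AI-span p q r ze zf zg zh =
      AI-sum (AI-sum (AI-sum (AI-multiple ze (M⇒AI (inM 1∈Z 0∈Z 0∈Z 0∈Z refl))) (AI-multiple zf p)) (AI-multiple zg q)) (AI-multiple zh r)

  odd-α : Odd α
  odd-α = ¬∣⇒Odd odd-a

  ℕ-even : ∀ {n} → 2 ℕ∣.∣ n → Even ⟪ + n ⟫
  ℕ-even {n} 2∣n = ∣⇒Even (ℤ∣.∣ᵤ⇒∣ {+ 2} {+ n} 2∣n)

  ℕ-odd : ∀ {n} → ¬ 2 ℕ∣.∣ n → Odd ⟪ + n ⟫
  ℕ-odd ¬2∣n = ¬∣⇒Odd (λ 2∣n → ¬2∣n (ℤ∣.∣⇒∣ᵤ 2∣n))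

  Odd⇒¬ℕ∣ : ∀ {n} → Odd ⟪ + n ⟫ → ¬ 2 ℕ∣.∣ n
  Odd⇒¬ℕ∣ o 2∣n = Even∧Odd⇒⊥ (ℕ-even 2∣n) o

  odd-d : Odd δ → ¬ 2 ℕ∣.∣ d
  odd-d o = Odd⇒¬ℕ∣ (subst Odd (sym δ≡) o)

  b₀-c₀-not-both-even : 2 ℕ∣.∣ b₀ → ¬ 2 ℕ∣.∣ c₀
  b₀-c₀-not-both-even p q with sf-d 2 (ℕ∣.∣m∣n⇒∣m+n (ℕ∣.*-pres-∣ p p) (ℕ∣.*-pres-∣ q q))
  ... | ()

  d-even⇒b₀-c₀-odd : 2 ℕ∣.∣ d → (¬ 2 ℕ∣.∣ b₀) × (¬ 2 ℕ∣.∣ c₀)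
  d-even⇒b₀-c₀-odd 2∣d with 2 ℕ∣.∣? b₀ | 2 ℕ∣.∣? c₀
  ... | yes p | yes q = ⊥-elim (b₀-c₀-not-both-even p q)
  ... | yes p | no ¬q = ⊥-elim (odd-d (od-δ (ℕ-even p) (ℕ-odd ¬q)) 2∣d)
  ... | no ¬p | yes q = ⊥-elim (odd-d (od-δ′ (ℕ-odd ¬p) (ℕ-even q)) 2∣d)
  ... | no ¬p | no ¬q = ¬p , ¬q

  d-odd∧b₀-odd⇒c₀-even : ¬ 2 ℕ∣.∣ d → ¬ 2 ℕ∣.∣ b₀ → 2 ℕ∣.∣ c₀
  d-odd∧b₀-odd⇒c₀-even ¬2∣d ¬p with 2 ℕ∣.∣? c₀
  ... | yes q = q
  ... | no ¬q = ⊥-elim (¬2∣d (ℤ∣.∣⇒∣ᵤ (Even⇒∣ {+ d} (subst Even (sym δ≡) (od-od-δ (ℕ-odd ¬p) (ℕ-odd ¬q))))))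

  mod4 : ∀ {j r} → ⟪ j ⟫ ≡ r → a ℤ.+ + b₀ ≡ j [mod 4 ] → ∃[ m ] Z m × α + β ≡ r + 4ℚ * m
  mod4 refl e =
    let m , zm , eq = congruence e
    in m , zm , trans (sym (⟪⟫-+ a (+ b₀))) eq

  Params : Case → Set
  Params (case₁ _)       = Params₁ α β γ′
  Params (case₂ _ _)     = Params₂ α β γ′
  Params (case₃ _ _ _)   = Params₃ α β γ′
  Params (case₄ _ _ _ _) = Params₄ α β γ′
  Params (case₅ _ _ _ _) = Params₅ α β γ′

  params : ∀ k → Params k
  params (case₁ 2∣d) = let ¬p , ¬q = d-even⇒b₀-c₀-odd 2∣d in toParams₁ odd-α (ℕ-odd ¬p) (ℕ-odd ¬q)
  params (case₂ ¬2∣d ¬p) = toParams₂ odd-α (ℕ-odd ¬p) (ℕ-even (d-odd∧b₀-odd⇒c₀-even ¬2∣d ¬p))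
  params (case₃ ¬2∣d p e) = toParams₃ (mod4 ⟪3⟫≡3 e) (ℕ-even p) (ℕ-odd (b₀-c₀-not-both-even p))
  params (case₄ ¬2∣d p e e′) = toParams₄ (mod4 ⟪1⟫≡1 e) (congruence e′) (ℕ-even p)
  params (case₅ ¬2∣d p e e′) = toParams₅ (mod4 ⟪1⟫≡1 e)
    (let m , zm , eq = congruence e′ in m , zm , trans eq (cong (λ t → t + 4ℚ * m) (⟪⟫-neg (+ c₀)))) (ℕ-even p)

  -- The element with coordinates (e , f , g , h) in the basis γ k.
  pt : Case → (e f g h : ℚ) → L.Carrier
  pt (case₁ _)       e f g h = mk e f g h
  pt (case₂ _ _)     e f g h = mk (e + ½ * f) (½ * f) g h
  pt (case₃ _ _ _)   e f g h = mk (e + ½ * f) (½ * f) (½ * (g + h)) (½ * (g - h))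
  pt (case₄ _ _ _ _) e f g h = mk (e + ½ * f + ¼ * (g + h)) (½ * f + ¼ * (g - h)) (¼ * (g + h)) (¼ * (g - h))
  pt (case₅ _ _ _ _) e f g h = mk (e + ½ * f + ¼ * (g + h)) (½ * f + ¼ * (g - h)) (¼ * (g + h)) (¼ * (h - g))

  record InLattice (k : Case) (x : L.Carrier) : Set where
    constructor inLattice
    field
      {e f g h} : ℚ
      e∈Z : Z e
      f∈Z : Z f
      g∈Z : Z g
      h∈Z : Z h
      coords : pt k e f g h ≡ x

  private
    lem-e₂ : ∀ e f → (e - f) + ½ * (2ℚ * f) ≡ e
    lem-e₂ = solve-∀ ℚ-acr
    lem-f₂ : ∀ f → ½ * (2ℚ * f) ≡ f
    lem-f₂ = solve-∀ ℚ-acr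
    lem-g₃ : ∀ g h → ½ * ((g + h) + (g - h)) ≡ g
    lem-g₃ = solve-∀ ℚ-acr
    lem-h₃ : ∀ g h → ½ * ((g + h) - (g - h)) ≡ h
    lem-h₃ = solve-∀ ℚ-acr
    lem-e₄ : ∀ e f g h → (e - f - g + h) + ½ * (2ℚ * f - 2ℚ * h) + ¼ * (2ℚ * (g + h) + 2ℚ * (g - h)) ≡ e
    lem-e₄ = solve-∀ ℚ-acr
    lem-f₄ : ∀ f g h → ½ * (2ℚ * f - 2ℚ * h) + ¼ * (2ℚ * (g + h) - 2ℚ * (g - h)) ≡ f
    lem-f₄ = solve-∀ ℚ-acr
    lem-g₄ : ∀ g h → ¼ * (2ℚ * (g + h) + 2ℚ * (g - h)) ≡ g
    lem-g₄ = solve-∀ ℚ-acr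
    lem-h₄ : ∀ g h → ¼ * (2ℚ * (g + h) - 2ℚ * (g - h)) ≡ h
    lem-h₄ = solve-∀ ℚ-acr
    lem-h₅ : ∀ g h → ¼ * (2ℚ * (g - - h) - 2ℚ * (g + - h)) ≡ h
    lem-h₅ = solve-∀ ℚ-acr

  facts⇒lattice : ∀ k {e f g h} → Params k → Facts α β γ′ e f g h → InLattice k (mk e f g h)
  facts⇒lattice (case₁ _) ps facts =
    let ze , zf , zg , zh = integers₁ ps facts in inLattice ze zf zg zh refl
  facts⇒lattice (case₂ _ _) {e} {f} ps facts =
    let ze , zf , zg , zh = integers₂ ps facts in
    inLattice ze zf zg zh (mk-cong (lem-e₂ e f) (lem-f₂ f) refl refl)
  facts⇒lattice (case₃ _ _ _) {e} {f} {g} {h} ps facts =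
    let ze , zf , zg , zh = integers₃ ps facts in
    inLattice ze zf zg zh (mk-cong (lem-e₂ e f) (lem-f₂ f) (lem-g₃ g h) (lem-h₃ g h))
  facts⇒lattice (case₄ _ _ _ _) {e} {f} {g} {h} ps facts =
    let ze , zf , zg , zh = integers₄ ps facts in
    inLattice ze zf zg zh (mk-cong (lem-e₄ e f g h) (lem-f₄ f g h) (lem-g₄ g h) (lem-h₄ g h))
  facts⇒lattice (case₅ _ _ _ _) {e} {f} {g} {h} ps facts =
    let ze , zf , zg , zh = integers₅ ps facts in
    inLattice ze zf zg zh (mk-cong (lem-e₄ e f g (- h)) (lem-f₄ f g (- h)) (lem-g₄ g (- h)) (lem-h₅ g h))

  integral⇒lattice : ∀ k {x} → IsIntegral x → InLattice k (to𝕃 x)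
  integral⇒lattice k {x} i =
    let e , f , g , h , eq = mk-surjective (to𝕃 x)
    in subst (InLattice k) eq (facts⇒lattice k (params k)
         (AI⇒facts (subst AlmostIntegral (sym eq) (integral⇒AI (to𝕃 x) (integral-to i)))))

  -- Coordinates of the last three elements of γ k.
  basis₂ basis₃ basis₄ : Case → V
  basis₂ (case₁ _)       = v 0ℚ 1ℚ 0ℚ 0ℚ
  basis₂ (case₂ _ _)     = v ½ ½ 0ℚ 0ℚ
  basis₂ (case₃ _ _ _)   = v ½ ½ 0ℚ 0ℚ
  basis₂ (case₄ _ _ _ _) = v ½ ½ 0ℚ 0ℚ
  basis₂ (case₅ _ _ _ _) = v ½ ½ 0ℚ 0ℚ
  basis₃ (case₁ _)       = v 0ℚ 0ℚ 1ℚ 0ℚ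
  basis₃ (case₂ _ _)     = v 0ℚ 0ℚ 1ℚ 0ℚ
  basis₃ (case₃ _ _ _)   = v 0ℚ 0ℚ ½ ½
  basis₃ (case₄ _ _ _ _) = v ¼ ¼ ¼ ¼
  basis₃ (case₅ _ _ _ _) = v ¼ ¼ ¼ -¼
  basis₄ (case₁ _)       = v 0ℚ 0ℚ 0ℚ 1ℚ
  basis₄ (case₂ _ _)     = v 0ℚ 0ℚ 0ℚ 1ℚ
  basis₄ (case₃ _ _ _)   = v 0ℚ 0ℚ ½ -½
  basis₄ (case₄ _ _ _ _) = v ¼ -¼ ¼ -¼
  basis₄ (case₅ _ _ _ _) = v ¼ -¼ ¼ ¼

  opaque
    span-pt : ∀ k e f g h → mkⱽ (span (basis₂ k) (basis₃ k) (basis₄ k) e f g h) ≡ pt k e f g h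
    span-pt k e f g h = by-case k
      where
      e₀ : ∀ e f g h → e * 1ℚ + f * 0ℚ + g * 0ℚ + h * 0ℚ ≡ e
      e₀ = solve-∀ ℚ-acr
      e½ : ∀ e f g h → e * 1ℚ + f * ½ + g * 0ℚ + h * 0ℚ ≡ e + ½ * f
      e½ = solve-∀ ℚ-acr
      e¼ : ∀ e f g h → e * 1ℚ + f * ½ + g * ¼ + h * ¼ ≡ e + ½ * f + ¼ * (g + h)
      e¼ = solve-∀ ℚ-acr
      f₀ : ∀ e f g h → e * 0ℚ + f * 1ℚ + g * 0ℚ + h * 0ℚ ≡ f
      f₀ = solve-∀ ℚ-acr
      f½ : ∀ e f g h → e * 0ℚ + f * ½ + g * 0ℚ + h * 0ℚ ≡ ½ * f
      f½ = solve-∀ ℚ-acr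
      f¼ : ∀ e f g h → e * 0ℚ + f * ½ + g * ¼ + h * -¼ ≡ ½ * f + ¼ * (g - h)
      f¼ = solve-∀ ℚ-acr
      g₀ : ∀ e f g h → e * 0ℚ + f * 0ℚ + g * 1ℚ + h * 0ℚ ≡ g
      g₀ = solve-∀ ℚ-acr
      g½ : ∀ e f g h → e * 0ℚ + f * 0ℚ + g * ½ + h * ½ ≡ ½ * (g + h)
      g½ = solve-∀ ℚ-acr
      g¼ : ∀ e f g h → e * 0ℚ + f * 0ℚ + g * ¼ + h * ¼ ≡ ¼ * (g + h)
      g¼ = solve-∀ ℚ-acr
      h₀ : ∀ e f g h → e * 0ℚ + f * 0ℚ + g * 0ℚ + h * 1ℚ ≡ h
      h₀ = solve-∀ ℚ-acr
      h½ : ∀ e f g h → e * 0ℚ + f * 0ℚ + g * ½ + h * -½ ≡ ½ * (g - h)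
      h½ = solve-∀ ℚ-acr
      h¼ : ∀ e f g h → e * 0ℚ + f * 0ℚ + g * ¼ + h * -¼ ≡ ¼ * (g - h)
      h¼ = solve-∀ ℚ-acr
      h¼′ : ∀ e f g h → e * 0ℚ + f * 0ℚ + g * -¼ + h * ¼ ≡ ¼ * (h - g)
      h¼′ = solve-∀ ℚ-acr
      by-case : ∀ k → mkⱽ (span (basis₂ k) (basis₃ k) (basis₄ k) e f g h) ≡ pt k e f g h
      by-case (case₁ _)       = mk-cong (e₀ e f g h) (f₀ e f g h) (g₀ e f g h) (h₀ e f g h)
      by-case (case₂ _ _)     = mk-cong (e½ e f g h) (f½ e f g h) (g₀ e f g h) (h₀ e f g h)
      by-case (case₃ _ _ _)   = mk-cong (e½ e f g h) (f½ e f g h) (g½ e f g h) (h½ e f g h)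
      by-case (case₄ _ _ _ _) = mk-cong (e¼ e f g h) (f¼ e f g h) (g¼ e f g h) (h¼ e f g h)
      by-case (case₅ _ _ _ _) = mk-cong (e¼ e f g h) (f¼ e f g h) (g¼ e f g h) (h¼′ e f g h)

  basis-AI : ∀ k → Params k →
    AlmostIntegral (mkⱽ (basis₂ k)) × AlmostIntegral (mkⱽ (basis₃ k)) × AlmostIntegral (mkⱽ (basis₄ k))
  basis-AI (case₁ _) ps =
    M⇒AI (inM 0∈Z 1∈Z 0∈Z 0∈Z refl) , M⇒AI (inM 0∈Z 0∈Z 1∈Z 0∈Z refl) , M⇒AI (inM 0∈Z 0∈Z 0∈Z 1∈Z refl)
  basis-AI (case₂ _ _) ps =
    let od = odd₂ ps in relativelyIntegral⇒AI od (half-1+√d {α} od) , M⇒AI (inM 0∈Z 0∈Z 1∈Z 0∈Z refl) , M⇒AI (inM 0∈Z 0∈Z 0∈Z 1∈Z refl)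
  basis-AI (case₃ _ _ _) ps =
    let od = odd₃ ps in relativelyIntegral⇒AI od (half-1+√d {α} od) , relativelyIntegral⇒AI od (half-z+w ps) , relativelyIntegral⇒AI od (half-z-w ps)
  basis-AI (case₄ _ _ _ _) ps =
    let od = odd₄ ps in relativelyIntegral⇒AI od (half-1+√d {α} od) , relativelyIntegral⇒AI od (quarter₄-+ ps) , relativelyIntegral⇒AI od (quarter₄-- ps)
  basis-AI (case₅ _ _ _ _) ps =
    let od = odd₅ ps in relativelyIntegral⇒AI od (half-1+√d {α} od) , relativelyIntegral⇒AI od (quarter₅-+ ps) , relativelyIntegral⇒AI od (quarter₅-- ps)

  -- Only the basis elements get monic equations of their own. Almost integrality is additive and so
  -- extends to the whole lattice, after which the characteristic polynomial provides an equation
  -- for each element.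
  lattice⇒AI : ∀ k {x} → Params k → InLattice k x → AlmostIntegral x
  lattice⇒AI k ps (inLattice {e} {f} {g} {h} ze zf zg zh refl) =
    let p , q , r = basis-AI k ps
    in subst AlmostIntegral (span-pt k e f g h) (AI-span {basis₂ k} {basis₃ k} {basis₄ k} p q r ze zf zg zh)

  lattice⇒integral : ∀ k {x} → InLattice k (to𝕃 x) → IsIntegral x
  lattice⇒integral k {x} l =
    let e , f , g , h , eq = mk-surjective (to𝕃 x)
    in integral-from (subst IsIntegral′ eq (charPoly⇒integral e f g h
         (AI⇒charPoly (subst AlmostIntegral (sym eq) (lattice⇒AI k (params k) l)))))

  opaque
    -- As σ takes (e , f , g , h) to (e , -f , -h , g), on the plane σ² = -1 and σ + σ³ = 0, while σ
    -- - σ³ vanishes on ℚ(√d). What remains is p + q ± 2 r at 1 and √d, the scalar p - q on the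
    -- plane, and there 2 t times √d σ, whose square is d because σ negates √d.
    hopf-mk : ∀ p q r t e f g h → hopf p q r t (mk e f g h) ≡
      mk ((p + q + 2ℚ * r) * e) ((p + q - 2ℚ * r) * f)
         ((p - q) * g + 2ℚ * t * (γ′ * g - β * h)) ((p - q) * h - 2ℚ * t * (β * g + γ′ * h))
    hopf-mk p q r t e f g h =
      trans (cong₂ L._+_ (cong₂ L._+_ (cong₂ L._+_ term₁ term₂) term₃) term₄)
      (trans (cong (L._+ mk (t * 0ℚ) (t * 0ℚ) (t * y₁) (t * y₂)) (trans (cong (L._+ mk (r * (e + e)) (r * (- f + - f)) (r * (- h + - - h)) (r * (g + - g)))
           (mk-+ (p * e) (p * f) (p * g) (p * h) (q * e) (q * f) (q * - g) (q * - h)))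
         (mk-+ (p * e + q * e) (p * f + q * f) (p * g + q * - g) (p * h + q * - h) (r * (e + e)) (r * (- f + - f)) (r * (- h + - - h)) (r * (g + - g)))))
      (trans (mk-+ (p * e + q * e + r * (e + e)) (p * f + q * f + r * (- f + - f)) (p * g + q * - g + r * (- h + - - h)) (p * h + q * - h + r * (g + - g)) (t * 0ℚ) (t * 0ℚ) (t * y₁) (t * y₂))
        (mk-cong (lem₁ p q r t e) (lem₂ p q r t f) (lem₃ p q r t g h β γ′) (lem₄ p q r t g h β γ′))))
      where
      y₁ y₂ : ℚ
      y₁ = 2ℚ * (γ′ * g - β * h)
      y₂ = - (2ℚ * (β * g + γ′ * h))
      σ³ : σ′ (σ′ (σ′ (mk e f g h))) ≡ mk e (- f) (- - h) (- g)
      σ³ = trans (cong σ′ (σ²-mk e f g h)) (σ-mk e f (- g) (- h))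
      term₁ : to𝕃 (ι p) L.* mk e f g h ≡ mk (p * e) (p * f) (p * g) (p * h)
      term₁ = trans (cong (L._* mk e f g h) (to-ι p)) (scale p e f g h)
      term₂ : to𝕃 (ι q) L.* σ′ (σ′ (mk e f g h)) ≡ mk (q * e) (q * f) (q * - g) (q * - h)
      term₂ = trans (cong₂ L._*_ (to-ι q) (σ²-mk e f g h)) (scale q e f (- g) (- h))
      term₃ : to𝕃 (ι r) L.* (σ′ (mk e f g h) L.+ σ′ (σ′ (σ′ (mk e f g h)))) ≡ mk (r * (e + e)) (r * (- f + - f)) (r * (- h + - - h)) (r * (g + - g))
      term₃ = trans (cong₂ L._*_ (to-ι r) (trans (cong₂ L._+_ (σ-mk e f g h) σ³) (mk-+ e (- f) (- h) g e (- f) (- - h) (- g))))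
                (scale r (e + e) (- f + - f) (- h + - - h) (g + - g))
      difference : σ′ (mk e f g h) L.- σ′ (σ′ (σ′ (mk e f g h))) ≡ mk (e + - e) (- f + - - f) (- h + - - - h) (g + - - g)
      difference = trans (cong₂ L._+_ (σ-mk e f g h) (trans (cong L.-_ σ³) (mk-neg e (- f) (- - h) (- g))))
                     (mk-+ e (- f) (- h) g (- e) (- - f) (- - - h) (- - g))
      √d-times : mk 0ℚ 1ℚ 0ℚ 0ℚ L.* mk (e + - e) (- f + - - f) (- h + - - - h) (g + - - g) ≡ mk 0ℚ 0ℚ y₁ y₂
      √d-times = trans (mk-* 0ℚ 1ℚ 0ℚ 0ℚ (e + - e) (- f + - - f) (- h + - - - h) (g + - - g))
        (mk-cong (m₁ e f g h δ α) (m₂ e f g h α β γ′) (m₃ e f g h β γ′) (m₄ e f g h β γ′))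
        where
        m₁ : ∀ e f g h δ α → 0ℚ * (e + - e) + δ * (1ℚ * (- f + - - f)) + α * δ * (0ℚ * (- h + - - - h) + 0ℚ * (g + - - g)) ≡ 0ℚ
        m₁ = solve-∀ ℚ-acr
        m₂ : ∀ e f g h α β γ → 0ℚ * (- f + - - f) + 1ℚ * (e + - e) + α * (β * (0ℚ * (- h + - - - h) - 0ℚ * (g + - - g)) + γ * (0ℚ * (g + - - g) + 0ℚ * (- h + - - - h))) ≡ 0ℚ
        m₂ = solve-∀ ℚ-acr
        m₃ : ∀ e f g h β γ → 0ℚ * (- h + - - - h) + 0ℚ * (e + - e) + 1ℚ * (β * (- h + - - - h) + γ * (g + - - g)) + (- f + - - f) * (β * 0ℚ + γ * 0ℚ) ≡ 2ℚ * (γ * g - β * h)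
        m₃ = solve-∀ ℚ-acr
        m₄ : ∀ e f g h β γ → 0ℚ * (g + - - g) + 0ℚ * (e + - e) + 1ℚ * (γ * (- h + - - - h) - β * (g + - - g)) + (- f + - - f) * (γ * 0ℚ - β * 0ℚ) ≡ - (2ℚ * (β * g + γ * h))
        m₄ = solve-∀ ℚ-acr
      term₄ : to𝕃 (ι t) L.* (to𝕃 √d L.* (σ′ (mk e f g h) L.- σ′ (σ′ (σ′ (mk e f g h))))) ≡ mk (t * 0ℚ) (t * 0ℚ) (t * y₁) (t * y₂)
      term₄ = trans (cong₂ L._*_ (to-ι t) (trans (cong₂ L._*_ to-√d difference) √d-times)) (scale t 0ℚ 0ℚ y₁ y₂)
      lem₁ : ∀ p q r t e → p * e + q * e + r * (e + e) + t * 0ℚ ≡ (p + q + 2ℚ * r) * e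
      lem₁ = solve-∀ ℚ-acr
      lem₂ : ∀ p q r t f → p * f + q * f + r * (- f + - f) + t * 0ℚ ≡ (p + q - 2ℚ * r) * f
      lem₂ = solve-∀ ℚ-acr
      lem₃ : ∀ p q r t g h β γ → p * g + q * - g + r * (- h + - - h) + t * (2ℚ * (γ * g - β * h)) ≡ (p - q) * g + 2ℚ * t * (γ * g - β * h)
      lem₃ = solve-∀ ℚ-acr
      lem₄ : ∀ p q r t g h β γ → p * h + q * - h + r * (g + - g) + t * (- (2ℚ * (β * g + γ * h))) ≡ (p - q) * h - 2ℚ * t * (β * g + γ * h)
      lem₄ = solve-∀ ℚ-acr

  kind : Case → Kind
  kind (case₁ _)       = split
  kind (case₂ _ _)     = halved
  kind (case₃ _ _ _)   = halved
  kind (case₄ _ _ _ _) = glued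
  kind (case₅ _ _ _ _) = glued

  -- The parameters b, c of J, which is multiplication by √d up to the sign ε.
  bᴶ cᴶ ε : Case → ℚ
  bᴶ (case₁ _)       = β
  bᴶ (case₂ _ _)     = β
  bᴶ (case₃ _ _ _)   = γ′
  bᴶ (case₄ _ _ _ _) = γ′
  bᴶ (case₅ _ _ _ _) = γ′
  cᴶ (case₁ _)       = γ′
  cᴶ (case₂ _ _)     = γ′
  cᴶ (case₃ _ _ _)   = β
  cᴶ (case₄ _ _ _ _) = β
  cᴶ (case₅ _ _ _ _) = - β
  ε (case₁ _)       = - 1ℚ
  ε (case₂ _ _)     = - 1ℚ
  ε (case₃ _ _ _)   = 1ℚ
  ε (case₄ _ _ _ _) = 1ℚ
  ε (case₅ _ _ _ _) = 1ℚ

  ptⱽ : Case → V → L.Carrier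
  ptⱽ k (v e f g h) = pt k e f g h

  operator : Case → (p q r t : ℚ) → Op
  operator k p q r t = op (p + q + 2ℚ * r) (p + q - 2ℚ * r) (p - q) (ε k * (2ℚ * t))

  opaque
    -- Passing from z, w to z + w, z - w exchanges the roles of b₀ and c₀ in the matrix of √d σ, up
    -- to a global sign; for the order z - w, z + w of case 5 the sign of b₀ changes too. Thus
    -- `bᴶ k` is odd in every case.
    hopf-pt : ∀ k p q r t x → hopf p q r t (ptⱽ k x) ≡ ptⱽ k (act (kind k) (bᴶ k) (cᴶ k) (operator k p q r t) x)
    hopf-pt k p q r t (v e f g h) = by-case k
      where
      lem₁ : ∀ p q t g h β γ → (p - q) * g + 2ℚ * t * (γ * g - β * h) ≡ (p - q) * g + - 1ℚ * (2ℚ * t) * (β * h - γ * g)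
      lem₁ = solve-∀ ℚ-acr
      lem₂ : ∀ p q t g h β γ → (p - q) * h - 2ℚ * t * (β * g + γ * h) ≡ (p - q) * h + - 1ℚ * (2ℚ * t) * (β * g + γ * h)
      lem₂ = solve-∀ ℚ-acr
      lem₃ : ∀ m p q t g h β γ → (p - q) * (m * (g + h)) + 2ℚ * t * (γ * (m * (g + h)) - β * (m * (g - h))) ≡
        m * (((p - q) * g + 1ℚ * (2ℚ * t) * (γ * h - β * g)) + ((p - q) * h + 1ℚ * (2ℚ * t) * (γ * g + β * h)))
      lem₃ = solve-∀ ℚ-acr
      lem₄ : ∀ m p q t g h β γ → (p - q) * (m * (g - h)) - 2ℚ * t * (β * (m * (g + h)) + γ * (m * (g - h))) ≡
        m * (((p - q) * g + 1ℚ * (2ℚ * t) * (γ * h - β * g)) - ((p - q) * h + 1ℚ * (2ℚ * t) * (γ * g + β * h)))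
      lem₄ = solve-∀ ℚ-acr
      lem₅ : ∀ p q t g h β γ → (p - q) * (¼ * (g + h)) + 2ℚ * t * (γ * (¼ * (g + h)) - β * (¼ * (h - g))) ≡
        ¼ * (((p - q) * g + 1ℚ * (2ℚ * t) * (γ * h - - β * g)) + ((p - q) * h + 1ℚ * (2ℚ * t) * (γ * g + - β * h)))
      lem₅ = solve-∀ ℚ-acr
      lem₆ : ∀ p q t g h β γ → (p - q) * (¼ * (h - g)) - 2ℚ * t * (β * (¼ * (g + h)) + γ * (¼ * (h - g))) ≡
        ¼ * (((p - q) * h + 1ℚ * (2ℚ * t) * (γ * g + - β * h)) - ((p - q) * g + 1ℚ * (2ℚ * t) * (γ * h - - β * g)))
      lem₆ = solve-∀ ℚ-acr
      g₁ h₁ : (c : ℚ) → ℚ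
      g₁ c = plane₁ γ′ c (p - q) (1ℚ * (2ℚ * t)) g h
      h₁ c = plane₂ γ′ c (p - q) (1ℚ * (2ℚ * t)) g h
      by-case : ∀ k → hopf p q r t (pt k e f g h) ≡ ptⱽ k (act (kind k) (bᴶ k) (cᴶ k) (operator k p q r t) (v e f g h))
      by-case (case₁ _) = trans (hopf-mk p q r t _ _ _ _)
        (mk-cong refl refl (lem₁ p q t g h β γ′) (lem₂ p q t g h β γ′))
      by-case (case₂ _ _) = trans (hopf-mk p q r t _ _ _ _)
        (mk-cong (sym (K₁-assemble halved _ _ 0ℚ 0ℚ)) (sym (K₂-assemble halved 0ℚ _ 0ℚ 0ℚ)) (lem₁ p q t g h β γ′) (lem₂ p q t g h β γ′))
      by-case (case₃ _ _ _) = trans (hopf-mk p q r t _ _ _ _)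
        (mk-cong (sym (K₁-assemble halved _ _ 0ℚ 0ℚ)) (sym (K₂-assemble halved 0ℚ _ 0ℚ 0ℚ)) (lem₃ ½ p q t g h β γ′) (lem₄ ½ p q t g h β γ′))
      by-case (case₄ _ _ _ _) = trans (hopf-mk p q r t _ _ _ _)
        (mk-cong (sym (K₁-assemble glued _ _ (g₁ β) (h₁ β))) (sym (K₂-assemble glued 0ℚ _ (g₁ β) (h₁ β))) (lem₃ ¼ p q t g h β γ′) (lem₄ ¼ p q t g h β γ′))
      by-case (case₅ _ _ _ _) = trans (hopf-mk p q r t _ _ _ _)
        (mk-cong (sym (K₁-assemble glued _ _ (g₁ (- β)) (h₁ (- β)))) (sym (K₂-assemble glued 0ℚ _ (g₁ (- β)) (h₁ (- β)))) (lem₅ p q t g h β γ′) (lem₆ p q t g h β γ′))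

  actᴶ : (k : Case) → Op → V → V
  actᴶ k = act (kind k) (bᴶ k) (cᴶ k)

  Qᴶ : Case → (g h : ℚ) → ℚ
  Qᴶ k = Q (bᴶ k) (cᴶ k)

  opaque
    ε² : ∀ k → ε k * ε k ≡ 1ℚ
    ε² (case₁ _)       = refl
    ε² (case₂ _ _)     = refl
    ε² (case₃ _ _ _)   = refl
    ε² (case₄ _ _ _ _) = refl
    ε² (case₅ _ _ _ _) = refl

    -- `H` has dimension four, as many as the parameters A, B, s, τ. Hence every operator obtained
    -- by solving for a prescribed image belongs to `H`.
    operator-surjective : ∀ k o → ∃[ p ] ∃[ q ] ∃[ r ] ∃[ t ] operator k p q r t ≡ o
    operator-surjective k (op A B s τ) =
      ½ * (½ * (A + B) + s) , ½ * (½ * (A + B) - s) , ¼ * (A - B) , ½ * (ε k * τ) ,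
      Op≡ (lem₁ A B s) (lem₂ A B s) (lem₃ A B s) (trans (lem₄ (ε k) τ) (trans (cong (_* τ) (ε² k)) (lem₅ τ)))
      where
      lem₁ : ∀ A B s → ½ * (½ * (A + B) + s) + ½ * (½ * (A + B) - s) + 2ℚ * (¼ * (A - B)) ≡ A
      lem₁ = solve-∀ ℚ-acr
      lem₂ : ∀ A B s → ½ * (½ * (A + B) + s) + ½ * (½ * (A + B) - s) - 2ℚ * (¼ * (A - B)) ≡ B
      lem₂ = solve-∀ ℚ-acr
      lem₃ : ∀ A B s → ½ * (½ * (A + B) + s) - ½ * (½ * (A + B) - s) ≡ s
      lem₃ = solve-∀ ℚ-acr
      lem₄ : ∀ ε τ → ε * (2ℚ * (½ * (ε * τ))) ≡ (ε * ε) * τ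
      lem₄ = solve-∀ ℚ-acr
      lem₅ : ∀ τ → 1ℚ * τ ≡ τ
      lem₅ = solve-∀ ℚ-acr

    -- Coordinates in the basis γ k of mk p q r t.
    unmk : Case → (p q r t : ℚ) → V
    unmk k@(case₁ _)       p q r t = assemble (kind k) p q r t
    unmk k@(case₂ _ _)     p q r t = assemble (kind k) p q r t
    unmk k@(case₃ _ _ _)   p q r t = assemble (kind k) p q (r + t) (r - t)
    unmk k@(case₄ _ _ _ _) p q r t = assemble (kind k) p q (2ℚ * (r + t)) (2ℚ * (r - t))
    unmk k@(case₅ _ _ _ _) p q r t = assemble (kind k) p q (2ℚ * (r - t)) (2ℚ * (r + t))

    pt-unmk : ∀ k p q r t → ptⱽ k (unmk k p q r t) ≡ mk p q r t
    pt-unmk (case₁ _) p q r t = refl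
    pt-unmk (case₂ _ _) p q r t = mk-cong (K₁-assemble halved p q r t) (K₂-assemble halved p q r t) refl refl
    pt-unmk (case₃ _ _ _) p q r t = mk-cong (K₁-assemble halved p q (r + t) (r - t)) (K₂-assemble halved p q (r + t) (r - t)) (lem₁ r t) (lem₂ r t)
      where
      lem₁ : ∀ r t → ½ * ((r + t) + (r - t)) ≡ r
      lem₁ = solve-∀ ℚ-acr
      lem₂ : ∀ r t → ½ * ((r + t) - (r - t)) ≡ t
      lem₂ = solve-∀ ℚ-acr
    pt-unmk (case₄ _ _ _ _) p q r t = mk-cong (K₁-assemble glued p q (2ℚ * (r + t)) (2ℚ * (r - t))) (K₂-assemble glued p q (2ℚ * (r + t)) (2ℚ * (r - t))) (lem₁ r t) (lem₂ r t)
      where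
      lem₁ : ∀ r t → ¼ * (2ℚ * (r + t) + 2ℚ * (r - t)) ≡ r
      lem₁ = solve-∀ ℚ-acr
      lem₂ : ∀ r t → ¼ * (2ℚ * (r + t) - 2ℚ * (r - t)) ≡ t
      lem₂ = solve-∀ ℚ-acr
    pt-unmk (case₅ _ _ _ _) p q r t = mk-cong (K₁-assemble glued p q (2ℚ * (r - t)) (2ℚ * (r + t))) (K₂-assemble glued p q (2ℚ * (r - t)) (2ℚ * (r + t))) (lem₁ r t) (lem₂ r t)
      where
      lem₁ : ∀ r t → ¼ * (2ℚ * (r - t) + 2ℚ * (r + t)) ≡ r
      lem₁ = solve-∀ ℚ-acr
      lem₂ : ∀ r t → ¼ * (2ℚ * (r + t) - 2ℚ * (r - t)) ≡ t
      lem₂ = solve-∀ ℚ-acr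

    unmk-cong : ∀ k {p q r t p′ q′ r′ t′} → mk p q r t ≡ mk p′ q′ r′ t′ → unmk k p q r t ≡ unmk k p′ q′ r′ t′
    unmk-cong k eq with mk-injective eq
    ... | refl , refl , refl , refl = refl

    unmk-pt : ∀ k x {p q r t} → mk p q r t ≡ ptⱽ k x → unmk k p q r t ≡ x
    unmk-pt k@(case₁ _) x eq = unmk-cong k eq
    unmk-pt k@(case₂ _ _) x@(v e f g h) eq = trans (unmk-cong k eq) (assemble-K halved x)
    unmk-pt k@(case₃ _ _ _) x@(v e f g h) eq = trans (unmk-cong k eq)
      (trans (cong₂ (assemble halved (K₁ halved x) (K₂ halved x)) (lem₁ g h) (lem₂ g h)) (assemble-K halved x))
      where
      lem₁ : ∀ g h → ½ * (g + h) + ½ * (g - h) ≡ g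
      lem₁ = solve-∀ ℚ-acr
      lem₂ : ∀ g h → ½ * (g + h) - ½ * (g - h) ≡ h
      lem₂ = solve-∀ ℚ-acr
    unmk-pt k@(case₄ _ _ _ _) x@(v e f g h) eq = trans (unmk-cong k eq)
      (trans (cong₂ (assemble glued (K₁ glued x) (K₂ glued x)) (lem₁ g h) (lem₂ g h)) (assemble-K glued x))
      where
      lem₁ : ∀ g h → 2ℚ * (¼ * (g + h) + ¼ * (g - h)) ≡ g
      lem₁ = solve-∀ ℚ-acr
      lem₂ : ∀ g h → 2ℚ * (¼ * (g + h) - ¼ * (g - h)) ≡ h
      lem₂ = solve-∀ ℚ-acr
    unmk-pt k@(case₅ _ _ _ _) x@(v e f g h) eq = trans (unmk-cong k eq)
      (trans (cong₂ (assemble glued (K₁ glued x) (K₂ glued x)) (lem₁ g h) (lem₂ g h)) (assemble-K glued x))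
      where
      lem₁ : ∀ g h → 2ℚ * (¼ * (g + h) - ¼ * (h - g)) ≡ g
      lem₁ = solve-∀ ℚ-acr
      lem₂ : ∀ g h → 2ℚ * (¼ * (g + h) + ¼ * (h - g)) ≡ h
      lem₂ = solve-∀ ℚ-acr

    ptⱽ-injective : ∀ k x y → ptⱽ k x ≡ ptⱽ k y → x ≡ y
    ptⱽ-injective k x y eq =
      let p , q , r , t , m = mk-surjective (ptⱽ k y)
      in trans (sym (unmk-pt k x (trans m (sym eq)))) (unmk-pt k y m)

    ptⱽ-surjective : ∀ k x → ∃[ y ] ptⱽ k y ≡ x
    ptⱽ-surjective k x =
      let p , q , r , t , m = mk-surjective x
      in unmk k p q r t , trans (pt-unmk k p q r t) m

  Λ⇒integral : ∀ k {x y} → ZV x → to𝕃 y ≡ ptⱽ k x → IsIntegral y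
  Λ⇒integral k {v e f g h} (ze , zf , zg , zh) eq = lattice⇒integral k (inLattice ze zf zg zh (sym eq))

  integral⇒Λ : ∀ k {y} → IsIntegral y → ∃[ x ] ZV x × to𝕃 y ≡ ptⱽ k x
  integral⇒Λ k i = let inLattice {e} {f} {g} {h} ze zf zg zh eq = integral⇒lattice k i
                   in v e f g h , (ze , zf , zg , zh) , sym eq

  operatorOf : ∀ k {h} → InH h → Op
  operatorOf k (p , q , r , t , _) = operator k p q r t

  InH-act : ∀ k {h} (inH : InH h) {x y} → to𝕃 y ≡ ptⱽ k x → to𝕃 (h y) ≡ ptⱽ k (actᴶ k (operatorOf k inH) x)
  InH-act k {h} inH@(p , q , r , t , _) {x} {y} eq =
    trans (InH⇒hopf {h} inH y) (trans (cong (hopf p q r t) eq) (hopf-pt k p q r t x))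

  preserves⇒ZV : ∀ k {h} (inH : InH h) → (∀ x → IsIntegral x → IsIntegral (h x)) → ∀ x → ZV x → ZV (actᴶ k (operatorOf k inH) x)
  preserves⇒ZV k {h} inH pres x zx =
    let y , zy , eq = integral⇒Λ k (pres (from𝕃 (ptⱽ k x)) (Λ⇒integral k {x} zx (to-from (ptⱽ k x))))
    in subst ZV (ptⱽ-injective k y (actᴶ k (operatorOf k inH) x) (trans (sym eq) (InH-act k {h} inH (to-from (ptⱽ k x))))) zy

  ZV⇒preserves : ∀ k {h} (inH : InH h) → (∀ x → ZV x → ZV (actᴶ k (operatorOf k inH) x)) → ∀ x → IsIntegral x → IsIntegral (h x)
  ZV⇒preserves k {h} inH zv y i =
    let x , zx , eq = integral⇒Λ k i
    in Λ⇒integral k (zv x zx) (InH-act k {h} inH eq)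

  -- `recover` inverts h ↦ h β. By `recover-act` the image of β determines the operator, hence h on
  -- all of L; by `act-recover` and `recover-integral` the operator recovered from an integer hits
  -- it and preserves integrality. The determinant ±1 is given as 2 δ′ + 1 because its oddness is
  -- used.
  isGenerator : ∀ k {β x δ′} → Z (bᴶ k) → Z (cᴶ k) → to𝕃 β ≡ ptⱽ k x → Generator (bᴶ k) (cᴶ k) (kind k) x →
                Z δ′ → F.od δ′ * Qᴶ k (V.g x) (V.h x) ≡ 1ℚ → IsGenerator β
  isGenerator k {β} {x} {δ′} zb zc β≡ gen zδ δQ =
    β-int , (λ {h₁} {h₂} → injective {h₁} {h₂}) , surjective
    where
    β-int : IsIntegral β
    β-int = Λ⇒integral k (generator-Z gen) β≡
    inv : Invertible (kind k) (bᴶ k) (cᴶ k) x (k₁ gen) (k₂ gen) (F.od δ′)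
    inv = generator-invertible gen δQ
    rec : V → Op
    rec = recover (kind k) (bᴶ k) (cᴶ k) (k₁ gen) (k₂ gen) (F.od δ′) (V.g x) (V.h x)
    injective : ∀ {h₁ h₂ : 𝔄} → (h₁ · (β , β-int)) ≈𝒪 (h₂ · (β , β-int)) → h₁ ≈𝔄 h₂
    injective {h₁ , inH₁ , _} {h₂ , inH₂ , _} eq y =
      let u , u≡ = ptⱽ-surjective k (to𝕃 y)
          acts = ptⱽ-injective k (actᴶ k (operatorOf k inH₁) x) (actᴶ k (operatorOf k inH₂) x)
                   (trans (sym (InH-act k {h₁} inH₁ β≡)) (trans (to-≈ eq) (InH-act k {h₂} inH₂ β≡)))
          ops = trans (sym (recover-act (kind k) inv (operatorOf k inH₁)))
                  (trans (cong rec acts) (recover-act (kind k) inv (operatorOf k inH₂)))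
      in to-injective (trans (InH-act k {h₁} inH₁ (sym u≡))
           (trans (cong (λ o → ptⱽ k (actᴶ k o u)) ops) (sym (InH-act k {h₂} inH₂ (sym u≡)))))
    surjective : ∀ (y : 𝒪) → Σ[ h ∈ 𝔄 ] (∀ {g : 𝔄} → g ≈𝔄 h → (g · (β , β-int)) ≈𝒪 y)
    surjective (y , y-int) =
      let u , zu , y≡ = integral⇒Λ k y-int
          p , q , r , t , o≡ = operator-surjective k (rec u)
          inH = hopf-InH p q r t
          h = hopfᴸ p q r t
          pres = ZV⇒preserves k {h} inH (λ w zw → subst (λ o → ZV (actᴶ k o w)) (sym o≡)
                   (recover-integral gen zb zc zδ refl zu zw))
          hβ≡y = trans (InH-act k {h} inH β≡) (trans (cong (λ o → ptⱽ k (actᴶ k o x)) o≡)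
                   (trans (cong (ptⱽ k) (act-recover (kind k) inv u)) (sym y≡)))
      in (h , inH , pres) , λ {g} g≈h → to-injective (trans (to-≈ (g≈h β)) hβ≡y)

  -- Surjectivity of h ↦ h β is applied to the third and fourth basis elements. The two operators so
  -- obtained have integral s and τ, and by `plane-determinant` the value of the form at the plane
  -- coordinates of β divides 1.
  free⇒unit : ∀ k {b′ u w} → bᴶ k ≡ F.od b′ → Z b′ → Z (cᴶ k) → Z u → Z w → u * bᴶ k + w * cᴶ k ≡ 1ℚ → 𝒪-free →
              ∃[ g ] ∃[ h ] Z g × Z h × (Qᴶ k g h ≡ 1ℚ ⊎ Qᴶ k g h ≡ - 1ℚ)
  free⇒unit k b≡ zb′ zc zu zw bez (β , β-int , _ , surj) =
    let x , zx , β≡ = integral⇒Λ k β-int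
        (h₁ , inH₁ , pres₁) , s₁ = surj (generator₃ , generator₃-int)
        (h₂ , inH₂ , pres₂) , s₂ = surj (generator₄ , generator₄-int)
        a₁ = ptⱽ-injective k (actᴶ k (operatorOf k inH₁) x) unit₃
               (trans (sym (InH-act k {h₁} inH₁ β≡)) (trans (to-≈ (s₁ {h₁ , inH₁ , pres₁} (λ _ → L′.refl))) (to-from (ptⱽ k unit₃))))
        a₂ = ptⱽ-injective k (actᴶ k (operatorOf k inH₂) x) unit₄
               (trans (sym (InH-act k {h₂} inH₂ β≡)) (trans (to-≈ (s₂ {h₂ , inH₂ , pres₂} (λ _ → L′.refl))) (to-from (ptⱽ k unit₄))))
        zs₁ , zτ₁ = op-integral (kind k) (operatorOf k {h₁} inH₁) b≡ zb′ zu zw bez zc (preserves⇒ZV k {h₁} inH₁ pres₁ unit₃ ze₃) (preserves⇒ZV k {h₁} inH₁ pres₁ unit₄ ze₄)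
        zs₂ , zτ₂ = op-integral (kind k) (operatorOf k {h₂} inH₂) b≡ zb′ zu zw bez zc (preserves⇒ZV k {h₂} inH₂ pres₂ unit₃ ze₃) (preserves⇒ZV k {h₂} inH₂ pres₂ unit₄ ze₄)
        _ , _ , zg , zh = zx
        zb = subst Z (sym b≡) (2∈Z ⊗ zb′ ⊕ 1∈Z)
        zQ = zb ⊗ (zg ⊗ zg) ⊕ 2∈Z ⊗ zc ⊗ (zg ⊗ zh) ⊖ zb ⊗ (zh ⊗ zh)
    in V.g x , V.h x , zg , zh , unit (zs₁ ⊗ zτ₂ ⊖ zτ₁ ⊗ zs₂) zQ (plane-determinant (kind k) (bᴶ k) (cᴶ k) {operatorOf k {h₁} inH₁} {operatorOf k {h₂} inH₂} x a₁ a₂)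
    where
    unit₃ unit₄ : V
    unit₃ = v 0ℚ 0ℚ 1ℚ 0ℚ
    unit₄ = v 0ℚ 0ℚ 0ℚ 1ℚ
    ze₃ : ZV unit₃
    ze₃ = 0∈Z , 0∈Z , 1∈Z , 0∈Z
    ze₄ : ZV unit₄
    ze₄ = 0∈Z , 0∈Z , 0∈Z , 1∈Z
    generator₃ generator₄ : L′.Carrier
    generator₃ = from𝕃 (ptⱽ k unit₃)
    generator₄ = from𝕃 (ptⱽ k unit₄)
    generator₃-int : IsIntegral generator₃
    generator₃-int = Λ⇒integral k ze₃ (to-from (ptⱽ k unit₃))
    generator₄-int : IsIntegral generator₄
    generator₄-int = Λ⇒integral k ze₄ (to-from (ptⱽ k unit₄))

  opaque
    to-multiple : ∀ n {x e f g h} → to𝕃 x ≡ mk e f g h → to𝕃 (ιᶻ n L′.* x) ≡ mk (⟪ n ⟫ * e) (⟪ n ⟫ * f) (⟪ n ⟫ * g) (⟪ n ⟫ * h)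
    to-multiple n {x} {e} {f} {g} {h} eq = trans (to-* (ιᶻ n) x)
      (trans (cong₂ L._*_ (trans (to-ι (n / 1)) (mk-cong (sym (⟪⟫≡/1 n)) refl refl refl)) eq) (scale ⟪ n ⟫ e f g h))

    to-scaled : ∀ q {x e f g h} → to𝕃 x ≡ mk e f g h → to𝕃 (ι q L′.* x) ≡ mk (q * e) (q * f) (q * g) (q * h)
    to-scaled q {x} {e} {f} {g} {h} eq = trans (to-* (ι q) x) (trans (cong₂ L._*_ (to-ι q) eq) (scale q e f g h))

    to-sum : ∀ {x y e f g h e′ f′ g′ h′} → to𝕃 x ≡ mk e f g h → to𝕃 y ≡ mk e′ f′ g′ h′ →
             to𝕃 (x L′.+ y) ≡ mk (e + e′) (f + f′) (g + g′) (h + h′)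
    to-sum {x} {y} {e} {f} {g} {h} {e′} {f′} {g′} {h′} p q = trans (to-+ x y) (trans (cong₂ L._+_ p q) (mk-+ e f g h e′ f′ g′ h′))

    to-minus : ∀ {x e f g h} → to𝕃 x ≡ mk e f g h → to𝕃 (L′.- x) ≡ mk (- e) (- f) (- g) (- h)
    to-minus {x} {e} {f} {g} {h} p = trans (to-neg x) (trans (cong L.-_ p) (mk-neg e f g h))

    to-combination : ∀ n₁ n₂ n₃ n₄ {x₁ x₂ x₃ x₄ p q r} →
      to𝕃 x₁ ≡ mk 1ℚ 0ℚ 0ℚ 0ℚ → to𝕃 x₂ ≡ mkⱽ p → to𝕃 x₃ ≡ mkⱽ q → to𝕃 x₄ ≡ mkⱽ r →
      to𝕃 (combination (n₁ ∷ n₂ ∷ n₃ ∷ n₄ ∷ []) (x₁ ∷ x₂ ∷ x₃ ∷ x₄ ∷ [])) ≡ mkⱽ (span p q r ⟪ n₁ ⟫ ⟪ n₂ ⟫ ⟪ n₃ ⟫ ⟪ n₄ ⟫)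
    to-combination n₁ n₂ n₃ n₄ {p = v p₁ p₂ p₃ p₄} {v q₁ q₂ q₃ q₄} {v r₁ r₂ r₃ r₄} e₁ e₂ e₃ e₄ =
      trans (to-sum (to-multiple n₁ e₁) (to-sum (to-multiple n₂ e₂) (to-sum (to-multiple n₃ e₃) (to-sum (to-multiple n₄ e₄) to-0))))
        (mk-cong (sum 1ℚ p₁ q₁ r₁) (sum 0ℚ p₂ q₂ r₂) (sum 0ℚ p₃ q₃ r₃) (sum 0ℚ p₄ q₄ r₄))
      where
      lem : ∀ p q r s → p + (q + (r + (s + 0ℚ))) ≡ p + q + r + s
      lem = solve-∀ ℚ-acr
      sum : ∀ o p q r → ⟪ n₁ ⟫ * o + (⟪ n₂ ⟫ * p + (⟪ n₃ ⟫ * q + (⟪ n₄ ⟫ * r + 0ℚ))) ≡ ⟪ n₁ ⟫ * o + ⟪ n₂ ⟫ * p + ⟪ n₃ ⟫ * q + ⟪ n₄ ⟫ * r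
      sum o p q r = lem (⟪ n₁ ⟫ * o) (⟪ n₂ ⟫ * p) (⟪ n₃ ⟫ * q) (⟪ n₄ ⟫ * r)

    to-½1+√d : to𝕃 (half (L′.1# L′.+ √d)) ≡ mk ½ ½ 0ℚ 0ℚ
    to-½1+√d = to-scaled ½ (to-sum to-1 to-√d)

    combination-pt : ∀ k n₁ n₂ n₃ n₄ →
      to𝕃 (combination (n₁ ∷ n₂ ∷ n₃ ∷ n₄ ∷ []) (γ k)) ≡ pt k ⟪ n₁ ⟫ ⟪ n₂ ⟫ ⟪ n₃ ⟫ ⟪ n₄ ⟫
    combination-pt k n₁ n₂ n₃ n₄ = trans (by-case k) (span-pt k ⟪ n₁ ⟫ ⟪ n₂ ⟫ ⟪ n₃ ⟫ ⟪ n₄ ⟫)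
      where
      by-case : ∀ k → to𝕃 (combination (n₁ ∷ n₂ ∷ n₃ ∷ n₄ ∷ []) (γ k)) ≡ mkⱽ (span (basis₂ k) (basis₃ k) (basis₄ k) ⟪ n₁ ⟫ ⟪ n₂ ⟫ ⟪ n₃ ⟫ ⟪ n₄ ⟫)
      by-case k@(case₁ _) = to-combination n₁ n₂ n₃ n₄ {p = basis₂ k} {basis₃ k} {basis₄ k} to-1 to-√d to-z to-w
      by-case k@(case₂ _ _) = to-combination n₁ n₂ n₃ n₄ {p = basis₂ k} {basis₃ k} {basis₄ k} to-1 to-½1+√d to-z to-w
      by-case k@(case₃ _ _ _) = to-combination n₁ n₂ n₃ n₄ {p = basis₂ k} {basis₃ k} {basis₄ k} to-1 to-½1+√d
        (to-scaled ½ (to-sum to-z to-w)) (to-scaled ½ (to-sum to-z (to-minus to-w)))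
      by-case k@(case₄ _ _ _ _) = to-combination n₁ n₂ n₃ n₄ {p = basis₂ k} {basis₃ k} {basis₄ k} to-1 to-½1+√d
        (to-scaled ¼ (to-sum (to-sum (to-sum to-1 to-√d) to-z) to-w))
        (to-scaled ¼ (to-sum (to-sum (to-sum to-1 (to-minus to-√d)) to-z) (to-minus to-w)))
      by-case k@(case₅ _ _ _ _) = to-combination n₁ n₂ n₃ n₄ {p = basis₂ k} {basis₃ k} {basis₄ k} to-1 to-½1+√d
        (to-scaled ¼ (to-sum (to-sum (to-sum to-1 to-√d) to-z) (to-minus to-w)))
        (to-scaled ¼ (to-sum (to-sum (to-sum to-1 (to-minus to-√d)) to-z) to-w))

  b-c-odd : ¬ 2 ℕ∣.∣ b₀ → b ≡ b₀ × c ≡ c₀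
  b-c-odd ¬p with 2 ℕ∣.∣? b₀
  ... | yes p = ⊥-elim (¬p p)
  ... | no _  = refl , refl

  b-c-even : 2 ℕ∣.∣ b₀ → b ≡ c₀ × c ≡ b₀
  b-c-even p with 2 ℕ∣.∣? b₀
  ... | yes _ = refl , refl
  ... | no ¬p = ⊥-elim (¬p p)

  b-nonZero : NonZero b
  b-nonZero with 2 ℕ∣.∣? b₀
  ... | yes _ = ℕ.≢-nonZero (ℕ.≢-nonZero⁻¹ c₀)
  ... | no _  = ℕ.≢-nonZero (ℕ.≢-nonZero⁻¹ b₀)

  d≡b²+c² : + d ≡ + b ℤ.* + b ℤ.+ + c ℤ.* + c
  d≡b²+c² with 2 ℕ∣.∣? b₀
  ... | yes _ = trans squares (ℤₚ.+-comm (+ b₀ ℤ.* + b₀) (+ c₀ ℤ.* + c₀))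
    where
    squares : + d ≡ + b₀ ℤ.* + b₀ ℤ.+ + c₀ ℤ.* + c₀
    squares = trans (ℤₚ.pos-+ (b₀ ℕ.* b₀) (c₀ ℕ.* c₀)) (cong₂ ℤ._+_ (ℤₚ.pos-* b₀ b₀) (ℤₚ.pos-* c₀ c₀))
  ... | no _ = trans (ℤₚ.pos-+ (b₀ ℕ.* b₀) (c₀ ℕ.* c₀)) (cong₂ ℤ._+_ (ℤₚ.pos-* b₀ b₀) (ℤₚ.pos-* c₀ c₀))

  odd-b : Odd ⟪ + b ⟫
  odd-b with 2 ℕ∣.∣? b₀
  ... | yes p = ℕ-odd (b₀-c₀-not-both-even p)
  ... | no ¬p = ℕ-odd ¬p

  -- The square of a common divisor divides d = b₀² + c₀².
  coprime-b₀-c₀ : ℕC.Coprime b₀ c₀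
  coprime-b₀-c₀ {k} (p , q) = sf-d k (ℕ∣.∣m∣n⇒∣m+n (ℕ∣.*-pres-∣ p p) (ℕ∣.*-pres-∣ q q))

  data Jᶜ (k : Case) : Set where
    c⁺ : cᴶ k ≡ ⟪ + c ⟫ → Jᶜ k
    c⁻ : cᴶ k ≡ - ⟪ + c ⟫ → Jᶜ k

  bᴶ≡ : ∀ k → bᴶ k ≡ ⟪ + b ⟫
  bᴶ≡ (case₁ 2∣d)       = cong (λ n → ⟪ + n ⟫) (sym (proj₁ (b-c-odd (proj₁ (d-even⇒b₀-c₀-odd 2∣d)))))
  bᴶ≡ (case₂ _ ¬p)      = cong (λ n → ⟪ + n ⟫) (sym (proj₁ (b-c-odd ¬p)))
  bᴶ≡ (case₃ _ p _)     = cong (λ n → ⟪ + n ⟫) (sym (proj₁ (b-c-even p)))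
  bᴶ≡ (case₄ _ p _ _)   = cong (λ n → ⟪ + n ⟫) (sym (proj₁ (b-c-even p)))
  bᴶ≡ (case₅ _ p _ _)   = cong (λ n → ⟪ + n ⟫) (sym (proj₁ (b-c-even p)))

  cᴶ≡ : ∀ k → Jᶜ k
  cᴶ≡ (case₁ 2∣d)       = c⁺ (cong (λ n → ⟪ + n ⟫) (sym (proj₂ (b-c-odd (proj₁ (d-even⇒b₀-c₀-odd 2∣d))))))
  cᴶ≡ (case₂ _ ¬p)      = c⁺ (cong (λ n → ⟪ + n ⟫) (sym (proj₂ (b-c-odd ¬p))))
  cᴶ≡ (case₃ _ p _)     = c⁺ (cong (λ n → ⟪ + n ⟫) (sym (proj₂ (b-c-even p))))
  cᴶ≡ (case₄ _ p _ _)   = c⁺ (cong (λ n → ⟪ + n ⟫) (sym (proj₂ (b-c-even p))))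
  cᴶ≡ (case₅ _ p _ _)   = c⁻ (cong (λ n → - ⟪ + n ⟫) (sym (proj₂ (b-c-even p))))

  zcᴶ : ∀ k → Z (cᴶ k)
  zcᴶ k with cᴶ≡ k
  ... | c⁺ eq = subst Z (sym eq) (⟪⟫∈Z (+ c))
  ... | c⁻ eq = subst Z (sym eq) (⊝ ⟪⟫∈Z (+ c))

  coprime-b-c : ℕC.Coprime b c
  coprime-b-c with 2 ℕ∣.∣? b₀
  ... | yes _ = ℕC.sym coprime-b₀-c₀
  ... | no _  = coprime-b₀-c₀

  bezoutᴶ : ∀ k → ∃[ u ] ∃[ w ] Z u × Z w × u * bᴶ k + w * cᴶ k ≡ 1ℚ
  bezoutᴶ k = signed (bezout-ℚ (+ b) (+ c) coprime-b-c) (cᴶ≡ k)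
    where
    signed : (∃[ u ] ∃[ w ] Z u × Z w × u * ⟪ + b ⟫ + w * ⟪ + c ⟫ ≡ 1ℚ) → Jᶜ k → ∃[ u ] ∃[ w ] Z u × Z w × u * bᴶ k + w * cᴶ k ≡ 1ℚ
    signed (u , w , zu , zw , eq) (c⁺ e) = u , w , zu , zw , trans (cong₂ (λ b c → u * b + w * c) (bᴶ≡ k) e) eq
    signed (u , w , zu , zw , eq) (c⁻ e) = u , - w , zu , ⊝ zw ,
      trans (cong₂ (λ b c → u * b + - w * c) (bᴶ≡ k) e) (trans (lem u ⟪ + b ⟫ w ⟪ + c ⟫) eq)
      where
      lem : ∀ u b w c → u * b + - w * - c ≡ u * b + w * c
      lem = solve-∀ ℚ-acr

  free⇒represents : Case → 𝒪-free → ∃[ U ] ∃[ V ] form b c U V ≡ 1ℤ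
  free⇒represents k free =
    let b′ , zb′ , b≡ = odd-b
        u , w , zu , zw , bez = bezoutᴶ k
        g , h , zg , zh , q = free⇒unit k (trans (bᴶ≡ k) b≡) zb′ (zcᴶ k) zu zw bez free
    in signed (cᴶ≡ k) zg zh q
    where
    signed : Jᶜ k → ∀ {g h} → Z g → Z h → Qᴶ k g h ≡ 1ℚ ⊎ Qᴶ k g h ≡ - 1ℚ → ∃[ U ] ∃[ V ] form b c U V ≡ 1ℤ
    signed (c⁺ e) {g} {h} zg zh q = Q⇒form≡1 b c zg zh (subst (λ t → t ≡ 1ℚ ⊎ t ≡ - 1ℚ) (cong₂ (λ b c → Q b c g h) (bᴶ≡ k) e) q)
    -- In case 5 the middle coefficient is -2 c; replacing h by -h restores [b, 2c, -b].
    signed (c⁻ e) {g} {h} zg zh q = Q⇒form≡1 b c zg (⊝ zh) (subst (λ t → t ≡ 1ℚ ⊎ t ≡ - 1ℚ)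
      (trans (cong₂ (λ b c → Q b c g h) (bᴶ≡ k) e) (lem ⟪ + b ⟫ ⟪ + c ⟫ g h)) q)
      where
      lem : ∀ b c g h → b * (g * g) + 2ℚ * - c * (g * h) - b * (h * h) ≡ b * (g * g) + 2ℚ * c * (g * - h) - b * (- h * - h)
      lem = solve-∀ ℚ-acr

  module _ (x′ y : ℤ) (form≡1 : form b c x′ y ≡ 1ℤ) where

    Q≡1 : Q ⟪ + b ⟫ ⟪ + c ⟫ ⟪ x′ ⟫ ⟪ y ⟫ ≡ 1ℚ
    Q≡1 = form≡1⇒Q b c x′ y form≡1

    2∣y-x′+1 : + 2 ℤ∣.∣ y ℤ.- x′ ℤ.+ 1ℤ
    2∣y-x′+1 = Even⇒∣ (subst Even (sym cast) (Q-parity odd-b (⟪⟫∈Z (+ c)) (⟪⟫∈Z x′) (⟪⟫∈Z y) Q≡1))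
      where
      cast : ⟪ y ℤ.- x′ ℤ.+ 1ℤ ⟫ ≡ ⟪ y ⟫ - ⟪ x′ ⟫ + 1ℚ
      cast = trans (⟪⟫-+ (y ℤ.- x′) 1ℤ) (cong₂ _+_ (⟪⟫-minus y x′) ⟪1⟫≡1)

    y′ : ℤ
    y′ = ℤ∣.quotient 2∣y-x′+1

    2y′≡ : 2ℚ * ⟪ y′ ⟫ ≡ ⟪ y ⟫ - ⟪ x′ ⟫ + 1ℚ
    2y′≡ = trans (cong (_* ⟪ y′ ⟫) (sym ⟪2⟫≡2)) (trans (sym (⟪⟫-* (+ 2) y′)) (trans (cong ⟪_⟫ (trans (ℤₚ.*-comm (+ 2) y′) (sym (ℤ∣._∣_.equality 2∣y-x′+1))))
      (trans (⟪⟫-+ (y ℤ.- x′) 1ℤ) (cong₂ _+_ (⟪⟫-minus y x′) ⟪1⟫≡1))))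

    generates : ∀ k {β x δ′} → to𝕃 β ≡ ptⱽ k x → Generator (bᴶ k) (cᴶ k) (kind k) x → Z δ′ → F.od δ′ * Qᴶ k (V.g x) (V.h x) ≡ 1ℚ → IsGenerator β
    generates k = isGenerator k (subst Z (sym (bᴶ≡ k)) (⟪⟫∈Z (+ b))) (zcᴶ k)

    opaque
      Qᴶ⁺ : ∀ k → cᴶ k ≡ ⟪ + c ⟫ → F.od 0ℚ * Qᴶ k ⟪ x′ ⟫ ⟪ y ⟫ ≡ 1ℚ
      Qᴶ⁺ k e = trans (cong (λ t → 1ℚ * t) (trans (cong₂ (λ b c → Q b c ⟪ x′ ⟫ ⟪ y ⟫) (bᴶ≡ k) e) Q≡1)) refl

      -- Exchanging the arguments and changing the sign of c negates the form, so the determinant in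
      -- case 5 is -1 = 2 · (-1) + 1.
      Qᴶ⁻ : ∀ k → cᴶ k ≡ - ⟪ + c ⟫ → F.od (- 1ℚ) * Qᴶ k ⟪ y ⟫ ⟪ x′ ⟫ ≡ 1ℚ
      Qᴶ⁻ k e = trans (cong (λ t → - 1ℚ * t) (cong₂ (λ b c → Q b c ⟪ y ⟫ ⟪ x′ ⟫) (bᴶ≡ k) e)) (trans (lem ⟪ + b ⟫ ⟪ + c ⟫ ⟪ x′ ⟫ ⟪ y ⟫) Q≡1)
        where
        lem : ∀ b c x y → - 1ℚ * (b * (y * y) + 2ℚ * - c * (y * x) - b * (x * x)) ≡ b * (x * x) + 2ℚ * c * (x * y) - b * (y * y)
        lem = solve-∀ ℚ-acr

    -- The equation says 4 K₂ = 1 and turns 4 K₁ into 4 e + 2 h + 1. With e = -⌈h/2⌉ this is 1 for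
    -- even h and -1 for odd h, the two families of glued generators.
    glued-generator : ∀ {b c f g} h → Odd b → Even c → Z f → 2ℚ * f + g - ⟪ h ⟫ ≡ 1ℚ →
                      Generator b c glued (v ⟪ ℤ.- ceiling (h / 2) ⟫ f g ⟪ h ⟫)
    glued-generator {b} {c} {f} {g} h (b′ , zb′ , b≡) (c′ , zc′ , c≡) zf eq = view (ceiling-half h)
      where
      g≡ : g ≡ 1ℚ - 2ℚ * f + ⟪ h ⟫
      g≡ = trans (lem f g ⟪ h ⟫) (cong (λ t → t - 2ℚ * f + ⟪ h ⟫) eq)
        where
        lem : ∀ f g h → g ≡ (2ℚ * f + g - h) - 2ℚ * f + h
        lem = solve-∀ ℚ-acr
      view : Ceiling h → Generator b c glued (v ⟪ ℤ.- ceiling (h / 2) ⟫ f g ⟪ h ⟫)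
      view (ceiling-even m h≡ e) = subst (Generator b c glued) (V≡ (cong (λ t → ⟪ ℤ.- t ⟫) (sym e)) refl
          (sym (trans g≡ (trans (cong (λ t → 1ℚ - 2ℚ * f + t) (trans h≡ (sym -2e≡))) (lem ⟪ ℤ.- m ⟫ f)))) (trans -2e≡ (sym h≡)))
          (gen-glued⁺ b≡ c≡ zb′ zc′ (⟪⟫∈Z (ℤ.- m)) zf)
        where
        -2e≡ : - (2ℚ * ⟪ ℤ.- m ⟫) ≡ 2ℚ * ⟪ m ⟫
        -2e≡ = trans (cong (λ t → - (2ℚ * t)) (⟪⟫-neg m)) (lem′ ⟪ m ⟫)
          where
          lem′ : ∀ m → - (2ℚ * - m) ≡ 2ℚ * m
          lem′ = solve-∀ ℚ-acr
        lem : ∀ e f → 1ℚ - 2ℚ * f + - (2ℚ * e) ≡ 1ℚ - 2ℚ * e - 2ℚ * f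
        lem = solve-∀ ℚ-acr
      view (ceiling-odd m h≡ e) = subst (Generator b c glued) (V≡ (cong (λ t → ⟪ ℤ.- t ⟫) (sym e)) refl
          (sym (trans g≡ (trans (cong (λ t → 1ℚ - 2ℚ * f + t) (trans h≡ (sym -2e-1≡))) (lem ⟪ ℤ.- m ⟫ f)))) (trans -2e-1≡ (sym h≡)))
          (gen-glued⁻ b≡ c≡ zb′ zc′ (⟪⟫∈Z (ℤ.- m)) zf)
        where
        -2e-1≡ : - (2ℚ * ⟪ ℤ.- m ⟫) - 1ℚ ≡ 2ℚ * ⟪ m ⟫ - 1ℚ
        -2e-1≡ = trans (cong (λ t → - (2ℚ * t) - 1ℚ) (⟪⟫-neg m)) (lem′ ⟪ m ⟫)
          where
          lem′ : ∀ m → - (2ℚ * - m) - 1ℚ ≡ 2ℚ * m - 1ℚ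
          lem′ = solve-∀ ℚ-acr
        lem : ∀ e f → 1ℚ - 2ℚ * f + (- (2ℚ * e) - 1ℚ) ≡ - (2ℚ * e) - 2ℚ * f
        lem = solve-∀ ℚ-acr

    generator : ∀ k → IsGenerator (combination (β-coords k x′ y y′) (γ k))
    generator k@(case₁ 2∣d) = generates k (trans (combination-pt k 1ℤ 1ℤ x′ y) (cong (λ t → pt k t t ⟪ x′ ⟫ ⟪ y ⟫) ⟪1⟫≡1))
      (gen-split (⟪⟫∈Z x′) (⟪⟫∈Z y)) 0∈Z (Qᴶ⁺ k (cong (λ n → ⟪ + n ⟫) (sym (proj₂ (b-c-odd (proj₁ (d-even⇒b₀-c₀-odd 2∣d)))))))
    generator k@(case₂ _ ¬p) = generates k (trans (combination-pt k 0ℤ 1ℤ x′ y) (cong₂ (λ s t → pt k s t ⟪ x′ ⟫ ⟪ y ⟫) ⟪0⟫≡0 ⟪1⟫≡1))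
      (gen-halved (⟪⟫∈Z x′) (⟪⟫∈Z y)) 0∈Z (Qᴶ⁺ k (cong (λ n → ⟪ + n ⟫) (sym (proj₂ (b-c-odd ¬p)))))
    generator k@(case₃ _ p _) = generates k (trans (combination-pt k 0ℤ 1ℤ x′ y) (cong₂ (λ s t → pt k s t ⟪ x′ ⟫ ⟪ y ⟫) ⟪0⟫≡0 ⟪1⟫≡1))
      (gen-halved (⟪⟫∈Z x′) (⟪⟫∈Z y)) 0∈Z (Qᴶ⁺ k (cong (λ n → ⟪ + n ⟫) (sym (proj₂ (b-c-even p)))))
    generator k@(case₄ _ p _ _) = generates k (combination-pt k (ℤ.- ceiling (y / 2)) y′ x′ y)
      (glued-generator y (ℕ-odd (b₀-c₀-not-both-even p)) (ℕ-even p) (⟪⟫∈Z y′) (trans (cong (λ t → t + ⟪ x′ ⟫ - ⟪ y ⟫) 2y′≡) (lem ⟪ x′ ⟫ ⟪ y ⟫)))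
      0∈Z (Qᴶ⁺ k (cong (λ n → ⟪ + n ⟫) (sym (proj₂ (b-c-even p)))))
      where
      lem : ∀ x y → (y - x + 1ℚ) + x - y ≡ 1ℚ
      lem = solve-∀ ℚ-acr
    generator k@(case₅ _ p _ _) = generates k (combination-pt k (ℤ.- ceiling (x′ / 2)) (1ℤ ℤ.- y′) y x′)
      (glued-generator x′ (ℕ-odd (b₀-c₀-not-both-even p)) (negate (ℕ-even p)) (⟪⟫∈Z (1ℤ ℤ.- y′))
        (trans (cong (λ t → 2ℚ * t + ⟪ y ⟫ - ⟪ x′ ⟫) (trans (⟪⟫-minus 1ℤ y′) (cong (_- ⟪ y′ ⟫) ⟪1⟫≡1)))
          (trans (lem ⟪ y′ ⟫ ⟪ x′ ⟫ ⟪ y ⟫) (trans (cong (λ t → 2ℚ - t + ⟪ y ⟫ - ⟪ x′ ⟫) 2y′≡) (lem′ ⟪ x′ ⟫ ⟪ y ⟫)))))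
      (⊝ 1∈Z) (Qᴶ⁻ k (cong (λ n → - ⟪ + n ⟫) (sym (proj₂ (b-c-even p)))))
      where
      lem : ∀ y′ x y → 2ℚ * (1ℚ - y′) + y - x ≡ 2ℚ - 2ℚ * y′ + y - x
      lem = solve-∀ ℚ-acr
      lem′ : ∀ x y → 2ℚ - (y - x + 1ℚ) + y - x ≡ 1ℚ
      lem′ = solve-∀ ℚ-acr
      negate : ∀ {r} → Even r → Even (- r)
      negate (s , zs , refl) = - s , ⊝ zs , lem″ s
        where
        lem″ : ∀ s → - (2ℚ * s) ≡ 2ℚ * - s
        lem″ = solve-∀ ℚ-acr

  opaque
    -- Freeness mentions no case, yet its analysis needs a basis. For d odd and b₀ even, a and c₀
    -- are odd: so a + b₀ is 1 or 3 modulo 4, and a ≡ ± c₀ (mod 4).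
    some-case : Case
    some-case with 2 ℕ∣.∣? d | 2 ℕ∣.∣? b₀
    ... | yes 2∣d | _ = case₁ 2∣d
    ... | no ¬2∣d | no ¬2∣b₀ = case₂ ¬2∣d ¬2∣b₀
    ... | no ¬2∣d | yes 2∣b₀ = b₀-even odd-α (ℕ-even 2∣b₀) (ℕ-odd (b₀-c₀-not-both-even 2∣b₀))
      where
      divides4 : ∀ i → (∃[ t ] Z t × ⟪ i ⟫ ≡ 4ℚ * t) → + 4 ℤ∣.∣ i
      divides4 i (t , (q , t≡) , eq) = ℤ∣.divides q (⟪⟫-injective (trans eq (trans (cong (4ℚ *_) t≡) (trans (lem ⟪ q ⟫) (trans (cong (⟪ q ⟫ *_) (sym ⟪4⟫≡4)) (sym (⟪⟫-* q (+ 4))))))))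
        where
        lem : ∀ q → 4ℚ * q ≡ q * 4ℚ
        lem = solve-∀ ℚ-acr
      sum- : ∀ {r} j → ⟪ j ⟫ ≡ r → ⟪ (a ℤ.+ + b₀) ℤ.- j ⟫ ≡ (α + β) - r
      sum- j eq = trans (⟪⟫-minus (a ℤ.+ + b₀) j) (cong₂ _-_ (⟪⟫-+ a (+ b₀)) eq)
      b₀-even : Odd α → Even β → Odd γ′ → Case
      b₀-even (s , zs , α≡) (t , zt , β≡) (u , zu , γ≡) = sum-parity (parity (zs ⊕ zt)) refl
        where
        lem₁ : ∀ s t → (2ℚ * s + 1ℚ) + 2ℚ * t ≡ 2ℚ * (s + t) + 1ℚ
        lem₁ = solve-∀ ℚ-acr
        α+β≡ : α + β ≡ F.od (s + t)
        α+β≡ = trans (cong₂ _+_ α≡ β≡) (lem₁ s t)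
        ≡3 : ∀ r → F.od (F.od r) - 3ℚ ≡ 4ℚ * r
        ≡3 r = lem r
          where
          lem : ∀ r → (2ℚ * (2ℚ * r + 1ℚ) + 1ℚ) - 3ℚ ≡ 4ℚ * r
          lem = solve-∀ ℚ-acr
        ≡1 : ∀ r → F.od (F.ev r) - 1ℚ ≡ 4ℚ * r
        ≡1 r = lem r
          where
          lem : ∀ r → (2ℚ * (2ℚ * r) + 1ℚ) - 1ℚ ≡ 4ℚ * r
          lem = solve-∀ ℚ-acr
        difference-parity : + 4 ℤ∣.∣ (a ℤ.+ + b₀) ℤ.- + 1 → ∀ {r} → Parity r → r ≡ s - u → Case
        difference-parity a+b₀≡1 (even {r} zr) eq = case₄ ¬2∣d 2∣b₀ a+b₀≡1 (divides4 (a ℤ.- + c₀) (r , zr ,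
          trans (⟪⟫-minus a (+ c₀)) (trans (cong₂ _-_ α≡ γ≡) (trans (lem s u) (trans (cong (2ℚ *_) (sym eq)) (lem′ r))))))
          where
          lem : ∀ s u → (2ℚ * s + 1ℚ) - (2ℚ * u + 1ℚ) ≡ 2ℚ * (s - u)
          lem = solve-∀ ℚ-acr
          lem′ : ∀ r → 2ℚ * (2ℚ * r) ≡ 4ℚ * r
          lem′ = solve-∀ ℚ-acr
        -- With a = 2 s + 1 and c₀ = 2 u + 1 the sum a + c₀ is 2 (s - u) + 4 u + 2, which is
        -- divisible by 4 when s - u is odd.
        difference-parity a+b₀≡1 (odd {r} zr) eq = case₅ ¬2∣d 2∣b₀ a+b₀≡1 (divides4 (a ℤ.- (ℤ.- + c₀)) (r + 1ℚ + u , zr ⊕ 1∈Z ⊕ zu ,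
          trans (⟪⟫-minus a (ℤ.- + c₀)) (trans (cong₂ _-_ α≡ (trans (⟪⟫-neg (+ c₀)) (cong -_ γ≡)))
            (trans (lem s u) (trans (cong (λ t → 2ℚ * t + 4ℚ * u + 2ℚ) (sym eq)) (lem′ r u))))))
          where
          lem : ∀ s u → (2ℚ * s + 1ℚ) - - (2ℚ * u + 1ℚ) ≡ 2ℚ * (s - u) + 4ℚ * u + 2ℚ
          lem = solve-∀ ℚ-acr
          lem′ : ∀ r u → 2ℚ * (2ℚ * r + 1ℚ) + 4ℚ * u + 2ℚ ≡ 4ℚ * (r + 1ℚ + u)
          lem′ = solve-∀ ℚ-acr
        sum-parity : ∀ {r} → Parity r → r ≡ s + t → Case
        sum-parity (odd {r} zr) eq = case₃ ¬2∣d 2∣b₀ (divides4 ((a ℤ.+ + b₀) ℤ.- + 3) (r , zr ,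
          trans (sum- (+ 3) ⟪3⟫≡3) (trans (cong (_- 3ℚ) (trans α+β≡ (cong F.od (sym eq)))) (≡3 r))))
        sum-parity (even {r} zr) eq = difference-parity (divides4 ((a ℤ.+ + b₀) ℤ.- + 1) (r , zr ,
          trans (sum- (+ 1) ⟪1⟫≡1) (trans (cong (_- 1ℚ) (trans α+β≡ (cong F.od (sym eq)))) (≡1 r)))) (parity (zs ⊖ zu)) refl

open import Data.Integer using (ℤ; +_; -_; 1ℤ; ∣_∣; _+_; _-_; _*_)
open import Data.Integer.Divisibility.Signed using (_∣_; quotient)
open import Data.Integer.GCD using (gcd)
open import Data.Nat using (ℕ; NonZero)
open import Data.Product using (Σ-syntax; ∃-syntax; _×_)
open import Function.Bundles using (_⇔_)
open import Relation.Binary.PropositionalEquality using (_≡_)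
open import Relation.Nullary using (¬_)

theorem4p3 :
    (a : ℤ) (b₀ c₀ : ℕ) .{{_ : NonZero b₀}} .{{_ : NonZero c₀}} →
    let open CyclicQuartic a b₀ c₀ in
    ¬ + 2 ∣ a → SquareFree ∣ a ∣ → SquareFree d → gcd a (+ d) ≡ 1ℤ →
    let Represents1 = ∃[ U ] ∃[ V ]
          + b * (U * U) + + 2 * + c * (U * V) - + b * (V * V) ≡ 1ℤ
        Solvable = ∃[ x ] ∃[ y ]
          x * x - + d * (y * y) ≡ + b × + b ∣ x - + c * y
    in
    (𝒪-free ⇔ Represents1)
    × (Represents1 ⇔ Solvable)
    × ((k : Case) (x y : ℤ) →
       x * x - + d * (y * y) ≡ + b → (b∣x-cy : + b ∣ x - + c * y) →
       let x′ = quotient b∣x-cy in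
       Σ[ 2∣y-x′+1 ∈ + 2 ∣ y - x′ + 1ℤ ]
         IsGenerator (combination (β-coords k x′ y (quotient 2∣y-x′+1)) (γ k)))
theorem4p3 a b₀ c₀ odd-a sf-a sf-d coprime =
    mk⇔ (free⇒represents some-case) (λ (U , V , form≡1) → _ , generator U V form≡1 some-case)
  , mk⇔ (λ (U , V , form≡1) → form⇒solution U V form≡1)
        (λ (x , y , eq , b∣x-cy) → quotient b∣x-cy , y , solution⇒form x y eq b∣x-cy)
  , λ k x y eq b∣x-cy →
      let form≡1 = solution⇒form x y eq b∣x-cy in
      2∣y-x′+1 (quotient b∣x-cy) y form≡1 , generator (quotient b∣x-cy) y form≡1 k
  where
  open CyclicQuartic a b₀ c₀ using (b; c)
  open Theorem a b₀ c₀ odd-a sf-a sf-d coprime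
  open Arithmetic b c {{b-nonZero}} d≡b²+c²
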